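{- Let $\Delta_n$ be a uniform flag triangulation of the boundary $\partial P_n$ of the root polytope belonging to the Simion class such that pairs of arrows of type $THTH$ nest and pairs of type $HTHT$ do not nest. Then for $i\ge1$ the number of facets of $\Delta_n$ consisting of $i$ forward arrows and $n-i$ backward arrows is $$f(\Delta_n,i,n-i)=2^{i-1}\cdot\frac{(i+1)\,(2n-i)!}{(n-i)!\,(n+1)!},$$ and the number of facets consisting of no forward arrows and $n$ backward arrows is the Catalan number $C_n$.
   Context: $P_n$ is the convex hull of $e_j-e_i$ ($i\ne j$) in $\mathbb{R}^{n+1}$. An arrow $(i,j)$, $i\ne j\in\{1,\dots,n+1\}$, with tail $i$ and head $j$, is identified with $e_j-e_i$; it is forward if $i<j$, backward if $i>j$; $V_n$ is the set of arrows. A uniform flag triangulation of $\partial P_n$ is a flag simplicial complex on $V_n$ representing a triangulation of $\partial P_n$ (without new vertices) in which whether a pair $\{(i_1,j_1),(i_2,j_2)\}$ is an edge depends only on the equalities and inequalities among $i_1,i_2,j_1,j_2$. For two arrows with four distinct endpoints $p_1<\dots<p_4$ the type is the $T/H$ word recording tails/heads at $p_1,\dots,p_4$; the pair nests if it joins $\{p_1,p_4\},\{p_2,p_3\}$, crosses if it joins $\{p_1,p_3\},\{p_2,p_4\}$; "type $W$ nests" means nesting pairs of type $W$ are edges, "does not nest" that they are not; similarly for crossing. The Simion class: exactly one of $THTH$, $HTHT$ nests, and if both $THHT$ and $HTTH$ cross then both $TTHH$ and $HHTT$ nest. $f(\Delta_n,i,j)$ is the number of faces with $i$ forward and $j$ backward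 arrows. -}

module Defs where

open import Data.Nat as ℕ using (ℕ; zero; suc; _∸_; _<ᵇ_)
open import Data.Nat.Combinatorics using (_C_)
open import Data.Nat.DivMod using (_/_)
open import Data.Fin as Fin using (Fin; toℕ; _≟_)
open import Data.Fin.Properties using () renaming (_≟_ to _≟F_)
open import Data.Bool using (Bool; true; false; _∧_; not; if_then_else_)
open import Data.List as List using (List; []; _∷_; allFin; length; filterᵇ; concatMap; map)
open import Data.Vec as Vec using (Vec; lookup)
open import Data.Nat.ListAction using (sum)
open import Data.Bool.ListAction using (and)
open import Data.Product using (Σ; ∃; _×_; _,_; proj₁; proj₂)
open import Data.Rational as ℚ using (ℚ; 0ℚ; 1ℚ; _≤_; _<_)
open import Relation.Nullary using (¬_)
open import Relation.Nullary.Decidable using (⌊_⌋)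
open import Relation.Binary.PropositionalEquality using (_≡_; _≢_)

-- Arrows on {1,…,n+1} are pairs (tail , head) of elements of Fin (suc n)
-- with tail ≢ head.  Arrow (t , h) is identified with e_h − e_t.

allᵇ : {A : Set} → (A → Bool) → List A → Bool
allᵇ p xs = and (map p xs)

Pt : ℕ → Set
Pt n = Fin (suc n) → ℚ

ind : ∀ {m} → Fin m → Fin m → ℚ
ind a b = if ⌊ a ≟ b ⌋ then 1ℚ else 0ℚ

arrowVec : ∀ {n} → Fin (suc n) → Fin (suc n) → Pt n
arrowVec t h k = ind k h ℚ.- ind k t

sumFin : ∀ {m} → (Fin m → ℚ) → ℚ
sumFin {zero}  f = 0ℚ
sumFin {suc m} f = f Fin.zero ℚ.+ sumFin (λ i → f (Fin.suc i))

sumFin2 : ∀ {m} → (Fin m → Fin m → ℚ) → ℚ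
sumFin2 f = sumFin (λ a → sumFin (λ b → f a b))

dot : ∀ {n} → Pt n → Pt n → ℚ
dot x y = sumFin (λ k → x k ℚ.* y k)

ArrowSet : ℕ → Set
ArrowSet n = Vec (Vec Bool (suc n)) (suc n)

member : ∀ {n} → ArrowSet n → Fin (suc n) → Fin (suc n) → Bool
member S t h = lookup (lookup S t) h

noLoopsᵇ : ∀ {n} → ArrowSet n → Bool
noLoopsᵇ S = allᵇ (λ t → not (member S t t)) (allFin _)

allArrows : ∀ {n} → ArrowSet n
allArrows = Vec.tabulate (λ t → Vec.tabulate (λ h → not ⌊ t ≟ h ⌋))

_∩S_ : ∀ {n} → ArrowSet n → ArrowSet n → ArrowSet n
S ∩S S' = Vec.zipWith (Vec.zipWith _∧_) S S'

-- An edge rule: E t₁ h₁ t₂ h₂ = true iff the arrows (t₁,h₁), (t₂,h₂)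
-- form an edge of the flag complex (values on non-arrows are irrelevant).

EdgeRule : ℕ → Set
EdgeRule n = Fin (suc n) → Fin (suc n) → Fin (suc n) → Fin (suc n) → Bool

Symmetric : ∀ {n} → EdgeRule n → Set
Symmetric E = ∀ t₁ h₁ t₂ h₂ → E t₁ h₁ t₂ h₂ ≡ E t₂ h₂ t₁ h₁

SamePattern : ∀ {n} → (Fin 4 → Fin (suc n)) → (Fin 4 → Fin (suc n)) → Set
SamePattern q q' = ∀ a b → (toℕ (q a) <ᵇ toℕ (q b)) ≡ (toℕ (q' a) <ᵇ toℕ (q' b))

quad : {A : Set} → A → A → A → A → Fin 4 → A
quad a b c d Fin.zero = a
quad a b c d (Fin.suc Fin.zero) = b
quad a b c d (Fin.suc (Fin.suc Fin.zero)) = c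
quad a b c d (Fin.suc (Fin.suc (Fin.suc Fin.zero))) = d

Uniform : ∀ {n} → EdgeRule n → Set
Uniform {n} E = ∀ t₁ h₁ t₂ h₂ t₁' h₁' t₂' h₂' →
  t₁ ≢ h₁ → t₂ ≢ h₂ → t₁' ≢ h₁' → t₂' ≢ h₂' →
  SamePattern (quad t₁ h₁ t₂ h₂) (quad t₁' h₁' t₂' h₂') →
  E t₁ h₁ t₂ h₂ ≡ E t₁' h₁' t₂' h₂'

isFaceᵇ : ∀ {n} → EdgeRule n → ArrowSet n → Bool
isFaceᵇ E S = noLoopsᵇ S ∧
  allᵇ (λ t₁ → allᵇ (λ h₁ → allᵇ (λ t₂ → allᵇ (λ h₂ →
    not (member S t₁ h₁ ∧ member S t₂ h₂ ∧ not (⌊ t₁ ≟ t₂ ⌋ ∧ ⌊ h₁ ≟ h₂ ⌋))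
    Data.Bool.∨ E t₁ h₁ t₂ h₂) (allFin _)) (allFin _)) (allFin _)) (allFin _)

IsFace : ∀ {n} → EdgeRule n → ArrowSet n → Set
IsFace E S = isFaceᵇ E S ≡ true

InConv : ∀ {n} → ArrowSet n → Pt n → Set
InConv {n} S x = Σ (Fin (suc n) → Fin (suc n) → ℚ) λ λc →
  (∀ t h → 0ℚ ≤ λc t h) ×
  (∀ t h → member S t h ≡ false → λc t h ≡ 0ℚ) ×
  (sumFin2 λc ≡ 1ℚ) ×
  (∀ k → x k ≡ sumFin2 (λ t h → λc t h ℚ.* arrowVec t h k))

AffIndep : ∀ {n} → ArrowSet n → Set
AffIndep {n} S = ∀ (μ : Fin (suc n) → Fin (suc n) → ℚ) →
  (∀ t h → member S t h ≡ false → μ t h ≡ 0ℚ) →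
  sumFin2 μ ≡ 0ℚ →
  (∀ k → sumFin2 (λ t h → μ t h ℚ.* arrowVec t h k) ≡ 0ℚ) →
  ∀ t h → μ t h ≡ 0ℚ

InP : ∀ {n} → Pt n → Set
InP = InConv allArrows

-- x lies on the boundary ∂P_n: x ∈ P_n and x lies on a supporting
-- hyperplane of P_n that does not contain all of P_n (a proper face)
InBoundary : ∀ {n} → Pt n → Set
InBoundary {n} x = InP x × Σ (Pt n) λ c →
  (∀ t h → t ≢ h → dot c (arrowVec t h) ≤ dot c x) ×
  Σ (Fin (suc n)) λ t → Σ (Fin (suc n)) λ h → t ≢ h × dot c (arrowVec t h) < dot c x

IsTriangulationOfBoundary : ∀ {n} → EdgeRule n → Set
IsTriangulationOfBoundary {n} E =
  (∀ S → IsFace E S → AffIndep S) ×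
  (∀ S → IsFace E S → ∀ x → InConv S x → InBoundary x) ×
  (∀ x → InBoundary x → Σ (ArrowSet n) λ S → IsFace E S × InConv S x) ×
  (∀ S S' → IsFace E S → IsFace E S' → ∀ x → InConv S x → InConv S' x →
     InConv (S ∩S S') x)

data Letter : Set where
  T H : Letter

-- the arrow joining positions x (letter l) and y (other letter):
-- returns (tail , head)
join : ∀ {m} → Letter → Fin m → Fin m → Fin m × Fin m
join T x y = x , y
join H x y = y , x

edgeOf : ∀ {n} → EdgeRule n → Fin (suc n) × Fin (suc n) → Fin (suc n) × Fin (suc n) → Bool
edgeOf E (t₁ , h₁) (t₂ , h₂) = E t₁ h₁ t₂ h₂

NestValue : ∀ {n} → EdgeRule n → Letter → Letter → Letter → Letter → Bool → Set
NestValue {n} E w₁ w₂ w₃ w₄ b = ∀ (p₁ p₂ p₃ p₄ : Fin (suc n)) →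
  p₁ Fin.< p₂ → p₂ Fin.< p₃ → p₃ Fin.< p₄ →
  edgeOf E (join w₁ p₁ p₄) (join w₂ p₂ p₃) ≡ b

CrossValue : ∀ {n} → EdgeRule n → Letter → Letter → Letter → Letter → Bool → Set
CrossValue {n} E w₁ w₂ w₃ w₄ b = ∀ (p₁ p₂ p₃ p₄ : Fin (suc n)) →
  p₁ Fin.< p₂ → p₂ Fin.< p₃ → p₃ Fin.< p₄ →
  edgeOf E (join w₁ p₁ p₃) (join w₂ p₂ p₄) ≡ b

Nests DoesNotNest Crosses : ∀ {n} → EdgeRule n → Letter → Letter → Letter → Letter → Set
Nests E a b c d = NestValue E a b c d true
DoesNotNest E a b c d = NestValue E a b c d false
Crosses E a b c d = CrossValue E a b c d true

InSimionClass : ∀ {n} → EdgeRule n → Set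
InSimionClass E =
  ((Nests E T H T H × DoesNotNest E H T H T) Data.Sum.⊎
   (DoesNotNest E T H T H × Nests E H T H T)) ×
  (Crosses E T H H T × Crosses E H T T H → Nests E T T H H × Nests E H H T T)
  where import Data.Sum

allVecs : {A : Set} → List A → (k : ℕ) → List (Vec A k)
allVecs xs zero = Vec.[] ∷ []
allVecs xs (suc k) = concatMap (λ x → map (x Vec.∷_) (allVecs xs k)) xs

allArrowSets : ∀ n → List (ArrowSet n)
allArrowSets n = allVecs (allVecs (true ∷ false ∷ []) (suc n)) (suc n)

countArrows : ∀ {n} → (Fin (suc n) → Fin (suc n) → Bool) → ArrowSet n → ℕ
countArrows p S = sum (map (λ t → length (filterᵇ (λ h → member S t h ∧ p t h) (allFin _))) (allFin _))

numForward numBackward : ∀ {n} → ArrowSet n → ℕ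
numForward = countArrows (λ t h → toℕ t <ᵇ toℕ h)
numBackward = countArrows (λ t h → toℕ h <ᵇ toℕ t)

f : ∀ {n} → EdgeRule n → ℕ → ℕ → ℕ
f {n} E i j = length (filterᵇ (λ S → isFaceᵇ E S ∧ (numForward S ℕ.≡ᵇ i) ∧ (numBackward S ℕ.≡ᵇ j))
                              (allArrowSets n))

catalan : ℕ → ℕ
catalan n = ((2 ℕ.* n) C n) / suc n

-- A face is a clique of arrows in which no vertex is both a head and a tail; by affine independence it is a
-- forest, so it has at most n arrows.
--
-- Lower bound. For a weak composition y of n into n + 1 parts, the point with coordinates proportional to
-- y v − 1 + 1/(n+1) lies on the boundary, and the face carrying it must have the indegrees y. Hence there are
-- at least as many facets as such compositions.
--
-- Upper bounds. A spanning forest carries, for positive charges c of sum 1, a unique weighting with balance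
-- indegree − 1 + c at every vertex, and its weights lie strictly between 0 and 1. As a point has only one
-- carrier, a facet is determined by its indegrees, and by replacing weights w with 1 − w also by its outdegrees.
-- The class hypotheses yield, in a facet with a forward arrow, a gap that is crossed by every forward arrow and
-- by no backward arrow. Left of the gap contract all heads beyond it to a single vertex: the result is again a
-- facet, determined by its indegrees. The remaining arrows are determined by their outdegrees. The left indegrees
-- followed by the right outdegrees in reverse order form a Łukasiewicz word, and the outdegrees of the tails of
-- the i forward arrows form a composition of i, which leaves at most 2^(i−1) · ballot (n−i) (i+1) facets. Without
-- forward arrows the indegrees themselves form a Łukasiewicz word, one of ballot n 1.
--
-- Summed over i these upper bounds equal the lower bound, so all of them are attained.

module Submission where

open import Defs
open import Data.Bool as Bool using (Bool; true; false; _∧_; _∨_; not; if_then_else_)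
import Data.Bool.Properties as Boolₚ
open import Data.Empty using (⊥; ⊥-elim)
open import Data.Fin as Fin using (Fin; zero; suc; toℕ; fromℕ<; _≟_)
import Data.Fin.Properties as Finₚ
open import Data.List as List using (List; []; _∷_; _++_; length; map; filterᵇ; allFin; concatMap)
import Data.List.Properties as Listₚ
open import Data.List.Membership.Propositional using (_∈_; _∉_)
import Data.List.Membership.Propositional.Properties as ∈ₚ
open import Data.List.Relation.Unary.All as All using (All; []; _∷_)
open import Data.List.Relation.Unary.Any as Any using (Any; here; there)
open import Data.List.Relation.Unary.AllPairs as AllPairs using (AllPairs; []; _∷_)
import Data.List.Relation.Unary.AllPairs.Properties as AllPairsₚ
open import Data.List.Relation.Unary.Unique.Propositional using (Unique)
import Data.List.Relation.Unary.Unique.Propositional.Properties as Uniqueₚ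
open import Data.Maybe using (Maybe; just; nothing)
open import Data.Nat as ℕ using (ℕ; zero; suc; _+_; _*_; _∸_; _^_; _≤_; _<_; _<ᵇ_; _!; z≤n; s≤s)
open import Data.Nat.ListAction using () renaming (sum to ∑)
open import Data.Nat.ListAction.Properties using () renaming (sum-++ to ∑-++)
open import Data.Nat.Combinatorics using (_C_; nCk≡n!/k![n-k]!)
open import Data.Nat.DivMod using (_/_; m*n/n≡m)
import Data.Nat.Properties as ℕₚ
open import Data.Nat.Tactic.RingSolver using () renaming (solve-∀ to ℕ-solve-∀)
open import Data.Product using (Σ; ∃; ∃₂; _×_; _,_; proj₁; proj₂)
import Data.Product.Properties
open import Data.Rational as ℚ using (ℚ; 0ℚ; 1ℚ)
import Data.Rational.Properties as ℚₚ
open import Data.Sum using (_⊎_; inj₁; inj₂)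
open import Data.Unit using (⊤; tt)
open import Data.Vec as Vec using (Vec; lookup)
import Data.Vec.Properties as Vecₚ
open import Function using (_∘_; id; Equivalence)
open import Relation.Binary.Definitions using (tri<; tri≈; tri>)
open import Relation.Binary.PropositionalEquality
open import Relation.Nullary using (¬_; Dec; yes; no; contradiction)
open import Relation.Nullary.Decidable using (⌊_⌋; _×-dec_)
open import Tactic.RingSolver using (solve-∀)
open import Tactic.RingSolver.Core.AlmostCommutativeRing using (AlmostCommutativeRing; fromCommutativeRing)

-- That indegrees match the facets with the weak compositions of n into n + 1 parts uses only the
-- triangulation property, so the total binom(2n, n) is the same for every rule. The number of
-- forward arrows is not visible in the indegrees, which is why a second code is needed. Its halves
-- are read in opposite directions because a Łukasiewicz word arises only when the arrows counted
-- run against the order of the list: to the left of the gap the backward arrows are counted at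
-- their heads, to the right of it at their tails.
--
-- Cutting at the gap severs the forward arrows, and the left piece alone no longer spans a tree, so
-- uniqueness of carriers says nothing about it. Contraction repairs this, and uniformity keeps the
-- result a face, since moving a head within the right side changes no comparison with a vertex on
-- the left.
--
-- The word does not mark where its left half ends. The missing information is the length of the
-- composition: it is the number of forward tails, and hence the amount by which the sum of the left
-- half falls short of its length.
--
-- The total charge 1 is forced: nets sum to 0, while indegree - 1 sums to -1 over the vertices of a
-- tree.

private
  variable
    m : ℕ

ℚ-ring : AlmostCommutativeRing _ _
ℚ-ring = fromCommutativeRing ℚₚ.+-*-commutativeRing is-zero
  where
  is-zero : (x : ℚ) → Maybe (0ℚ ≡ x)
  is-zero x with 0ℚ ℚₚ.≟ x
  ... | yes p = just p
  ... | no _  = nothing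

-- Finite sums

sumFin-cong : {f g : Fin m → ℚ} → (∀ i → f i ≡ g i) → sumFin f ≡ sumFin g
sumFin-cong {zero}  f≡g = refl
sumFin-cong {suc m} f≡g = cong₂ ℚ._+_ (f≡g zero) (sumFin-cong (f≡g ∘ suc))

sumFin-0 : sumFin {m} (λ _ → 0ℚ) ≡ 0ℚ
sumFin-0 {zero}  = refl
sumFin-0 {suc m} = trans (ℚₚ.+-identityˡ _) (sumFin-0 {m})

sumFin-+ : (f g : Fin m → ℚ) → sumFin (λ i → f i ℚ.+ g i) ≡ sumFin f ℚ.+ sumFin g
sumFin-+ {zero}  f g = refl
sumFin-+ {suc m} f g = trans (cong (f zero ℚ.+ g zero ℚ.+_) (sumFin-+ (f ∘ suc) (g ∘ suc))) (shuffle (f zero) (g zero) (sumFin (f ∘ suc)) (sumFin (g ∘ suc)))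
  where
  shuffle : ∀ a b c d → a ℚ.+ b ℚ.+ (c ℚ.+ d) ≡ a ℚ.+ c ℚ.+ (b ℚ.+ d)
  shuffle = solve-∀ ℚ-ring

sumFin-* : (c : ℚ) (f : Fin m → ℚ) → sumFin (λ i → c ℚ.* f i) ≡ c ℚ.* sumFin f
sumFin-* {zero}  c f = sym (ℚₚ.*-zeroʳ c)
sumFin-* {suc m} c f = trans (cong (c ℚ.* f zero ℚ.+_) (sumFin-* c (f ∘ suc))) (sym (ℚₚ.*-distribˡ-+ c _ _))

sumFin-*ʳ : (c : ℚ) (f : Fin m → ℚ) → sumFin (λ i → f i ℚ.* c) ≡ sumFin f ℚ.* c
sumFin-*ʳ c f = trans (sumFin-cong λ i → ℚₚ.*-comm (f i) c) (trans (sumFin-* c f) (ℚₚ.*-comm c _))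

sumFin-neg : (f : Fin m → ℚ) → sumFin (λ i → ℚ.- f i) ≡ ℚ.- sumFin f
sumFin-neg {zero}  f = refl
sumFin-neg {suc m} f = trans (cong (ℚ.- f zero ℚ.+_) (sumFin-neg (f ∘ suc))) (sym (ℚₚ.neg-distrib-+ (f zero) _))

sumFin-minus : (f g : Fin m → ℚ) → sumFin (λ i → f i ℚ.- g i) ≡ sumFin f ℚ.- sumFin g
sumFin-minus f g = trans (sumFin-+ f _) (cong (sumFin f ℚ.+_) (sumFin-neg g))

sumFin-comm : ∀ {k} (f : Fin m → Fin k → ℚ) → sumFin (λ a → sumFin (f a)) ≡ sumFin (λ b → sumFin (λ a → f a b))
sumFin-comm {zero}  {k} f = sym (sumFin-0 {k})
sumFin-comm {suc m} f = trans (cong (sumFin (f zero) ℚ.+_) (sumFin-comm (f ∘ suc))) (sym (sumFin-+ (f zero) _))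

ind-refl : (a : Fin m) → ind a a ≡ 1ℚ
ind-refl a with a ≟ a
... | yes _  = refl
... | no a≢a = contradiction refl a≢a

ind-≢ : {a b : Fin m} → a ≢ b → ind a b ≡ 0ℚ
ind-≢ {a = a} {b} a≢b with a ≟ b
... | yes a≡b = contradiction a≡b a≢b
... | no _    = refl

ind-sym : (a b : Fin m) → ind a b ≡ ind b a
ind-sym a b with a ≟ b
... | yes refl = sym (ind-refl a)
... | no a≢b   = sym (ind-≢ (a≢b ∘ sym))

ind-suc : (a b : Fin m) → ind (suc a) (suc b) ≡ ind a b
ind-suc a b with a ≟ b
... | yes _ = refl
... | no _  = refl

sumFin-ind : (a : Fin m) (f : Fin m → ℚ) → sumFin (λ i → ind i a ℚ.* f i) ≡ f a
sumFin-ind {suc m} zero f = begin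
  1ℚ ℚ.* f zero ℚ.+ sumFin (λ i → ind (suc i) zero ℚ.* f (suc i))
    ≡⟨ cong₂ ℚ._+_ (ℚₚ.*-identityˡ (f zero)) (trans (sumFin-cong λ i → ℚₚ.*-zeroˡ (f (suc i))) (sumFin-0 {m})) ⟩
  f zero ℚ.+ 0ℚ
    ≡⟨ ℚₚ.+-identityʳ (f zero) ⟩
  f zero ∎
  where open ≡-Reasoning
sumFin-ind {suc m} (suc a) f = begin
  0ℚ ℚ.* f zero ℚ.+ sumFin (λ i → ind (suc i) (suc a) ℚ.* f (suc i))
    ≡⟨ cong₂ ℚ._+_ (ℚₚ.*-zeroˡ (f zero)) (trans (sumFin-cong λ i → cong (ℚ._* f (suc i)) (ind-suc i a)) (sumFin-ind a (f ∘ suc))) ⟩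
  0ℚ ℚ.+ f (suc a)
    ≡⟨ ℚₚ.+-identityˡ (f (suc a)) ⟩
  f (suc a) ∎
  where open ≡-Reasoning

sumFin-ind′ : (a : Fin m) → sumFin (λ i → ind i a) ≡ 1ℚ
sumFin-ind′ a = trans (sumFin-cong λ i → sym (ℚₚ.*-identityʳ (ind i a))) (sumFin-ind a (λ _ → 1ℚ))

sumFin-mono : {f g : Fin m → ℚ} → (∀ i → f i ℚ.≤ g i) → sumFin f ℚ.≤ sumFin g
sumFin-mono {zero}  f≤g = ℚₚ.≤-refl
sumFin-mono {suc m} f≤g = ℚₚ.+-mono-≤ (f≤g zero) (sumFin-mono (f≤g ∘ suc))

≡-≤-trans : ∀ {a b c : ℚ} → a ≡ b → b ℚ.≤ c → a ℚ.≤ c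
≡-≤-trans refl b≤c = b≤c

≡-<-trans : ∀ {a b c : ℚ} → a ≡ b → b ℚ.< c → a ℚ.< c
≡-<-trans refl b<c = b<c

sumFin-≥0 : {f : Fin m → ℚ} → (∀ i → 0ℚ ℚ.≤ f i) → 0ℚ ℚ.≤ sumFin f
sumFin-≥0 {m} 0≤f = ≡-≤-trans (sym (sumFin-0 {m})) (sumFin-mono 0≤f)

sumFin-≥term : {f : Fin m → ℚ} → (∀ i → 0ℚ ℚ.≤ f i) → ∀ i → f i ℚ.≤ sumFin f
sumFin-≥term {f = f} 0≤f zero    = ≡-≤-trans (sym (ℚₚ.+-identityʳ (f zero))) (ℚₚ.+-monoʳ-≤ (f zero) (sumFin-≥0 (0≤f ∘ suc)))
sumFin-≥term {f = f} 0≤f (suc i) = ℚₚ.≤-trans (sumFin-≥term (0≤f ∘ suc) i)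
  (≡-≤-trans (sym (ℚₚ.+-identityˡ _)) (ℚₚ.+-monoˡ-≤ (sumFin (f ∘ suc)) (0≤f zero)))

sumFin-≡0 : {f : Fin m → ℚ} → (∀ i → 0ℚ ℚ.≤ f i) → sumFin f ≡ 0ℚ → ∀ i → f i ≡ 0ℚ
sumFin-≡0 0≤f Σ≡0 i = ℚₚ.≤-antisym (ℚₚ.≤-trans (sumFin-≥term 0≤f i) (ℚₚ.≤-reflexive Σ≡0)) (0≤f i)

sumℕ : (Fin m → ℕ) → ℕ
sumℕ {zero}  f = 0
sumℕ {suc m} f = f zero + sumℕ (f ∘ suc)

sumℕ-cong : {f g : Fin m → ℕ} → (∀ i → f i ≡ g i) → sumℕ f ≡ sumℕ g
sumℕ-cong {zero}  f≡g = refl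
sumℕ-cong {suc m} f≡g = cong₂ _+_ (f≡g zero) (sumℕ-cong (f≡g ∘ suc))

sumℕ-0 : sumℕ {m} (λ _ → 0) ≡ 0
sumℕ-0 {zero}  = refl
sumℕ-0 {suc m} = sumℕ-0 {m}

+-interchange : ∀ a b c d → a + b + (c + d) ≡ a + c + (b + d)
+-interchange a b c d = begin
  a + b + (c + d)   ≡⟨ ℕₚ.+-assoc a b _ ⟩
  a + (b + (c + d)) ≡⟨ cong (a +_) (trans (sym (ℕₚ.+-assoc b c d)) (trans (cong (_+ d) (ℕₚ.+-comm b c)) (ℕₚ.+-assoc c b d))) ⟩
  a + (c + (b + d)) ≡⟨ sym (ℕₚ.+-assoc a c _) ⟩
  a + c + (b + d)   ∎
  where open ≡-Reasoning

sumℕ-+ : (f g : Fin m → ℕ) → sumℕ (λ i → f i + g i) ≡ sumℕ f + sumℕ g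
sumℕ-+ {zero}  f g = refl
sumℕ-+ {suc m} f g = trans (cong (f zero + g zero +_) (sumℕ-+ (f ∘ suc) (g ∘ suc))) (+-interchange (f zero) (g zero) _ _)

sumℕ-comm : ∀ {k} (f : Fin m → Fin k → ℕ) → sumℕ (λ a → sumℕ (f a)) ≡ sumℕ (λ b → sumℕ (λ a → f a b))
sumℕ-comm {zero}  {k} f = sym (sumℕ-0 {k})
sumℕ-comm {suc m} f = trans (cong (sumℕ (f zero) +_) (sumℕ-comm (f ∘ suc))) (sym (sumℕ-+ (f zero) _))

sumℕ-* : (c : ℕ) (f : Fin m → ℕ) → sumℕ (λ i → c * f i) ≡ c * sumℕ f
sumℕ-* {zero}  c f = sym (ℕₚ.*-zeroʳ c)
sumℕ-* {suc m} c f = trans (cong (c * f zero +_) (sumℕ-* c (f ∘ suc))) (sym (ℕₚ.*-distribˡ-+ c (f zero) _))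

sumℕ-mono : {f g : Fin m → ℕ} → (∀ i → f i ≤ g i) → sumℕ f ≤ sumℕ g
sumℕ-mono {zero}  f≤g = z≤n
sumℕ-mono {suc m} f≤g = ℕₚ.+-mono-≤ (f≤g zero) (sumℕ-mono (f≤g ∘ suc))

sumℕ-≥term : (f : Fin m → ℕ) → ∀ i → f i ≤ sumℕ f
sumℕ-≥term f zero    = ℕₚ.m≤m+n (f zero) _
sumℕ-≥term f (suc i) = ℕₚ.≤-trans (sumℕ-≥term (f ∘ suc) i) (ℕₚ.m≤n+m _ (f zero))

-- The squeeze by which equalities are obtained from estimates: for the indegrees of a carrier, for
-- the arrows into a common head, and at the end for the facet numbers themselves.
sumℕ-≡⇒≡ : {f g : Fin m → ℕ} → (∀ i → f i ≤ g i) → sumℕ g ≤ sumℕ f → ∀ i → f i ≡ g i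
sumℕ-≡⇒≡ {f = f} {g} f≤g Σg≤Σf zero = ℕₚ.≤-antisym (f≤g zero)
  (ℕₚ.+-cancelʳ-≤ _ (g zero) (f zero) (ℕₚ.≤-trans Σg≤Σf (ℕₚ.+-monoʳ-≤ (f zero) (sumℕ-mono (f≤g ∘ suc)))))
sumℕ-≡⇒≡ {f = f} {g} f≤g Σg≤Σf (suc i) = sumℕ-≡⇒≡ (f≤g ∘ suc)
  (ℕₚ.+-cancelˡ-≤ (g zero) _ _ (ℕₚ.≤-trans Σg≤Σf (ℕₚ.+-monoˡ-≤ _ (f≤g zero)))) i

toℕᵇ : Bool → ℕ
toℕᵇ true  = 1
toℕᵇ false = 0

toℚᵇ : Bool → ℚ
toℚᵇ true  = 1ℚ
toℚᵇ false = 0ℚ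

ℕ⇒ℚ : ℕ → ℚ
ℕ⇒ℚ zero    = 0ℚ
ℕ⇒ℚ (suc n) = 1ℚ ℚ.+ ℕ⇒ℚ n

ℕ⇒ℚ-+ : ∀ a b → ℕ⇒ℚ (a + b) ≡ ℕ⇒ℚ a ℚ.+ ℕ⇒ℚ b
ℕ⇒ℚ-+ zero    b = sym (ℚₚ.+-identityˡ _)
ℕ⇒ℚ-+ (suc a) b = trans (cong (1ℚ ℚ.+_) (ℕ⇒ℚ-+ a b)) (sym (ℚₚ.+-assoc 1ℚ (ℕ⇒ℚ a) (ℕ⇒ℚ b)))

count : (Fin m → Bool) → ℕ
count p = sumℕ (toℕᵇ ∘ p)

sumFin-ℕ⇒ℚ : (f : Fin m → ℕ) → sumFin (ℕ⇒ℚ ∘ f) ≡ ℕ⇒ℚ (sumℕ f)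
sumFin-ℕ⇒ℚ {zero}  f = refl
sumFin-ℕ⇒ℚ {suc m} f = trans (cong (ℕ⇒ℚ (f zero) ℚ.+_) (sumFin-ℕ⇒ℚ (f ∘ suc))) (sym (ℕ⇒ℚ-+ (f zero) (sumℕ (f ∘ suc))))

toℚᵇ-ℕ : ∀ b → toℚᵇ b ≡ ℕ⇒ℚ (toℕᵇ b)
toℚᵇ-ℕ true  = refl
toℚᵇ-ℕ false = refl

sumFin-count : (p : Fin m → Bool) → sumFin (toℚᵇ ∘ p) ≡ ℕ⇒ℚ (count p)
sumFin-count p = trans (sumFin-cong (toℚᵇ-ℕ ∘ p)) (sumFin-ℕ⇒ℚ (toℕᵇ ∘ p))

-- Linear dependence

record Functional (A : Set) : Set where
  field
    app    : (A → ℚ) → ℚ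
    cong-≗ : ∀ {f g} → (∀ a → f a ≡ g a) → app f ≡ app g
    linear : ∀ f c g → app (λ a → f a ℚ.+ c ℚ.* g a) ≡ app f ℚ.+ c ℚ.* app g

open Functional

module Kernel {A : Set} (_≟A_ : (a b : A) → Dec (a ≡ b)) where

  δ : A → A → ℚ
  δ x a = if ⌊ a ≟A x ⌋ then 1ℚ else 0ℚ

  δ-refl : ∀ x → δ x x ≡ 1ℚ
  δ-refl x with x ≟A x
  ... | yes _  = refl
  ... | no x≢x = contradiction refl x≢x

  δ-≢ : ∀ {x a} → a ≢ x → δ x a ≡ 0ℚ
  δ-≢ {x} {a} a≢x with a ≟A x
  ... | yes a≡x = contradiction a≡x a≢x
  ... | no _    = refl

  combine : Functional A → ℚ → Functional A → Functional A
  combine φ c ψ .app f = app φ f ℚ.+ c ℚ.* app ψ f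
  combine φ c ψ .cong-≗ f≗g = cong₂ (λ x y → x ℚ.+ c ℚ.* y) (cong-≗ φ f≗g) (cong-≗ ψ f≗g)
  combine φ c ψ .linear f d g =
    trans (cong₂ (λ x y → x ℚ.+ c ℚ.* y) (linear φ f d g) (linear ψ f d g))
          (rearrange (app φ f) (app φ g) (app ψ f) (app ψ g) c d)
    where
    rearrange : ∀ a b a′ b′ c d → a ℚ.+ d ℚ.* b ℚ.+ c ℚ.* (a′ ℚ.+ d ℚ.* b′) ≡ a ℚ.+ c ℚ.* a′ ℚ.+ d ℚ.* (b ℚ.+ c ℚ.* b′)
    rearrange = solve-∀ ℚ-ring

  Vanish : (A → ℚ) → List (Functional A) → Set
  Vanish μ = All (λ φ → app φ μ ≡ 0ℚ)

  -- Taking the pivot `ψ` out of `Φ` forgets its position, so the result carries a function that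
  -- reassembles the equations for `Φ` from those for `ψ` and `Φ′`.
  pivot : ∀ x Φ → Vanish (δ x) Φ ⊎ ∃₂ λ ψ Φ′ → app ψ (δ x) ≢ 0ℚ × length Φ ≡ suc (length Φ′) ×
            (∀ μ → app ψ μ ≡ 0ℚ → Vanish μ Φ′ → Vanish μ Φ)
  pivot x [] = inj₁ []
  pivot x (φ ∷ Φ) with app φ (δ x) ℚₚ.≟ 0ℚ
  ... | no φδ≢0 = inj₂ (φ , Φ , φδ≢0 , refl , λ _ → _∷_)
  ... | yes φδ≡0 with pivot x Φ
  ...   | inj₁ Φδ≡0 = inj₁ (φδ≡0 ∷ Φδ≡0)
  ...   | inj₂ (ψ , Φ′ , ψδ≢0 , len , restore) =
    inj₂ (ψ , φ ∷ Φ′ , ψδ≢0 , cong suc len , λ { μ ψμ (φμ ∷ Φ′μ) → φμ ∷ restore μ ψμ Φ′μ })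

  inverse : ∀ {p} → p ≢ 0ℚ → ∃ λ r → p ℚ.* r ≡ 1ℚ
  inverse {p} p≢0 = ℚ.1/_ p {{ℚ.≢-nonZero p≢0}} , ℚₚ.*-inverseʳ p {{ℚ.≢-nonZero p≢0}}

  Dependence : List A → List (Functional A) → Set
  Dependence xs Φ = ∃ λ μ → (∀ a → a ∉ xs → μ a ≡ 0ℚ) × (∃ λ a → a ∈ xs × μ a ≢ 0ℚ) × Vanish μ Φ

  module _ (x : A) (ψ : Functional A) (r : ℚ) (r-inverse : app ψ (δ x) ℚ.* r ≡ 1ℚ) where

    -- With `r` the inverse of the value of `ψ` at `δ x`, the multiple of `ψ` is chosen so that the
    -- new functional vanishes at `δ x`: the unknown at `x` disappears from the equation.
    eliminate : Functional A → Functional A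
    eliminate φ = combine φ (ℚ.- (app φ (δ x) ℚ.* r)) ψ

    module _ (ν : A → ℚ) where

      d : ℚ
      d = ℚ.- (app ψ ν ℚ.* r)

      -- Back substitution: `d` is the value at `x` for which `ψ` vanishes, and the other
      -- functionals then take on `lift` the values of their eliminated forms on `ν`.
      lift : A → ℚ
      lift b = ν b ℚ.+ d ℚ.* δ x b

      lift-≢ : ∀ {b} → b ≢ x → lift b ≡ ν b
      lift-≢ {b} b≢x = trans (cong (λ z → ν b ℚ.+ d ℚ.* z) (δ-≢ b≢x)) (absorb (ν b) d)
        where
        absorb : ∀ p q → p ℚ.+ q ℚ.* 0ℚ ≡ p
        absorb = solve-∀ ℚ-ring

      lift-pivot : app ψ lift ≡ 0ℚ
      lift-pivot = begin
        app ψ lift                                ≡⟨ linear ψ ν d (δ x) ⟩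
        app ψ ν ℚ.+ d ℚ.* app ψ (δ x)             ≡⟨ expand (app ψ ν) (app ψ (δ x)) r ⟩
        app ψ ν ℚ.* (1ℚ ℚ.- app ψ (δ x) ℚ.* r)    ≡⟨ cong (λ z → app ψ ν ℚ.* (1ℚ ℚ.- z)) r-inverse ⟩
        app ψ ν ℚ.* (1ℚ ℚ.- 1ℚ)                   ≡⟨ ℚₚ.*-zeroʳ (app ψ ν) ⟩
        0ℚ                                        ∎
        where
        open ≡-Reasoning
        expand : ∀ p q r → p ℚ.+ ℚ.- (p ℚ.* r) ℚ.* q ≡ p ℚ.* (1ℚ ℚ.- q ℚ.* r)
        expand = solve-∀ ℚ-ring

      lift-vanish : ∀ Φ → Vanish ν (map eliminate Φ) → Vanish lift Φ
      lift-vanish [] [] = []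
      lift-vanish (φ ∷ Φ) (v ∷ vs) =
        trans (linear φ ν d (δ x)) (trans (swap (app φ ν) (app ψ ν) r (app φ (δ x))) v) ∷ lift-vanish Φ vs
        where
        swap : ∀ p q r s → p ℚ.+ ℚ.- (q ℚ.* r) ℚ.* s ≡ p ℚ.+ ℚ.- (s ℚ.* r) ℚ.* q
        swap = solve-∀ ℚ-ring

    lift-dependence : ∀ {xs} → All (x ≢_) xs → ∀ Φ′ → Dependence xs (map eliminate Φ′) →
      ∀ Φ → (∀ μ → app ψ μ ≡ 0ℚ → Vanish μ Φ′ → Vanish μ Φ) → Dependence (x ∷ xs) Φ
    lift-dependence x∉xs Φ′ (ν , supp , (a , a∈xs , νa≢0) , vanish) Φ restore =
      lift ν ,
      (λ b b∉ → trans (lift-≢ ν (b∉ ∘ here)) (supp b (b∉ ∘ there))) ,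
      (a , there a∈xs , νa≢0 ∘ trans (sym (lift-≢ ν (λ a≡x → All.lookup x∉xs a∈xs (sym a≡x))))) ,
      restore (lift ν) (lift-pivot ν) (lift-vanish ν Φ′ vanish)

  -- More unknowns than equations. Each round of Gaussian elimination removes one unknown together
  -- with one equation, until some `δ x` is annihilated by all equations that are left and is itself
  -- a solution.
  kernel : ∀ xs → Unique xs → ∀ Φ → length Φ < length xs → Dependence xs Φ
  kernel (x ∷ xs) (x∉xs ∷ xs!) Φ len with pivot x Φ
  ... | inj₁ Φδ≡0 = δ x , (λ a a∉ → δ-≢ (a∉ ∘ here)) , (x , here refl , λ δ≡0 → ℚₚ.1≢0 (trans (sym (δ-refl x)) δ≡0)) , Φδ≡0
  ... | inj₂ (ψ , Φ′ , ψδ≢0 , len′ , restore) with inverse ψδ≢0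
  ...   | r , r-inverse = lift-dependence x ψ r r-inverse x∉xs Φ′
    (kernel xs xs! (map (eliminate x ψ r r-inverse) Φ′)
      (subst (_< length xs) (sym (Listₚ.length-map _ Φ′)) (ℕₚ.≤-pred (subst (_< suc (length xs)) len′ len)))) Φ restore

-- Flows on digraphs

Digraph : ℕ → Set
Digraph m = Fin m → Fin m → Bool

Weight : ℕ → Set
Weight m = Fin m → Fin m → ℚ

inflow outflow net : Weight m → Fin m → ℚ
inflow g w  = sumFin (λ t → g t w)
outflow g w = sumFin (g w)
net g w     = inflow g w ℚ.- outflow g w

total≡Σinflow : (g : Weight m) → sumFin2 g ≡ sumFin (inflow g)
total≡Σinflow = sumFin-comm

sumFin2-cong : {g h : Weight m} → (∀ a b → g a b ≡ h a b) → sumFin2 g ≡ sumFin2 h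
sumFin2-cong g≡h = sumFin-cong λ a → sumFin-cong (g≡h a)

sumFin2-* : (c : ℚ) (g : Weight m) → sumFin2 (λ a b → c ℚ.* g a b) ≡ c ℚ.* sumFin2 g
sumFin2-* c g = trans (sumFin-cong λ a → sumFin-* c (g a)) (sumFin-* c (λ a → sumFin (g a)))

sumFin2-+ : (g h : Weight m) → sumFin2 (λ a b → g a b ℚ.+ h a b) ≡ sumFin2 g ℚ.+ sumFin2 h
sumFin2-+ g h = trans (sumFin-cong λ a → sumFin-+ (g a) (h a)) (sumFin-+ (λ a → sumFin (g a)) (λ a → sumFin (h a)))

sumFin2-neg : (g : Weight m) → sumFin2 (λ a b → ℚ.- g a b) ≡ ℚ.- sumFin2 g
sumFin2-neg g = trans (sumFin-cong λ a → sumFin-neg (g a)) (sumFin-neg (λ a → sumFin (g a)))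

sumFin2-minus : (g h : Weight m) → sumFin2 (λ a b → g a b ℚ.- h a b) ≡ sumFin2 g ℚ.- sumFin2 h
sumFin2-minus g h = trans (sumFin2-+ g _) (cong (sumFin2 g ℚ.+_) (sumFin2-neg h))

sumFin2-≡0 : {g : Weight m} → (∀ a b → 0ℚ ℚ.≤ g a b) → sumFin2 g ≡ 0ℚ → ∀ a b → g a b ≡ 0ℚ
sumFin2-≡0 0≤g Σ≡0 a = sumFin-≡0 (0≤g a) (sumFin-≡0 (sumFin-≥0 ∘ 0≤g) Σ≡0 a)

unit : Fin m → Fin m → Weight m
unit a b t h = ind t a ℚ.* ind h b

sumFin2-unit : (a b : Fin m) (g : Weight m) → sumFin2 (λ t h → unit a b t h ℚ.* g t h) ≡ g a b
sumFin2-unit a b g = begin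
  sumFin2 (λ t h → ind t a ℚ.* ind h b ℚ.* g t h)
    ≡⟨ sumFin-cong (λ t → trans (sumFin-cong λ h → ℚₚ.*-assoc (ind t a) (ind h b) (g t h)) (sumFin-* (ind t a) (λ h → ind h b ℚ.* g t h))) ⟩
  sumFin (λ t → ind t a ℚ.* sumFin (λ h → ind h b ℚ.* g t h))
    ≡⟨ sumFin-ind a (λ t → sumFin (λ h → ind h b ℚ.* g t h)) ⟩
  sumFin (λ h → ind h b ℚ.* g a h)
    ≡⟨ sumFin-ind b (g a) ⟩
  g a b ∎
  where open ≡-Reasoning

unit-≥0 : (a b t h : Fin m) → 0ℚ ℚ.≤ unit a b t h
unit-≥0 a b t h with t ≟ a | h ≟ b
... | yes _ | yes _ = ℚₚ.nonNegative⁻¹ 1ℚ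
... | yes _ | no  _ = ℚₚ.≤-refl
... | no  _ | yes _ = ℚₚ.≤-refl
... | no  _ | no  _ = ℚₚ.≤-refl

unit-supported : (R : Digraph m) {a b : Fin m} → R a b ≡ true → ∀ t h → R t h ≡ false → unit a b t h ≡ 0ℚ
unit-supported R {a} {b} Rab t h Rth with t ≟ a | h ≟ b
... | yes refl | yes refl = contradiction (trans (sym Rab) Rth) λ ()
... | yes _    | no  _    = refl
... | no  _    | yes _    = refl
... | no  _    | no  _    = refl

unit-diag : (a b : Fin m) → unit a b a b ≡ 1ℚ
unit-diag a b = cong₂ ℚ._*_ (ind-refl a) (ind-refl b)

unit-≢ : {a b t h : Fin m} → ¬ (t ≡ a × h ≡ b) → unit a b t h ≡ 0ℚ
unit-≢ {a = a} {b} {t} {h} ≢ab with t ≟ a | h ≟ b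
... | yes p | yes q = contradiction (p , q) ≢ab
... | yes _ | no  _ = refl
... | no  _ | yes _ = refl
... | no  _ | no  _ = refl

inflow-cong : {g h : Weight m} → (∀ a b → g a b ≡ h a b) → ∀ w → inflow g w ≡ inflow h w
inflow-cong g≡h w = sumFin-cong λ t → g≡h t w

outflow-cong : {g h : Weight m} → (∀ a b → g a b ≡ h a b) → ∀ w → outflow g w ≡ outflow h w
outflow-cong g≡h w = sumFin-cong (g≡h w)

net-cong : {g h : Weight m} → (∀ a b → g a b ≡ h a b) → ∀ w → net g w ≡ net h w
net-cong g≡h w = cong₂ ℚ._-_ (inflow-cong g≡h w) (outflow-cong g≡h w)

net-+* : (g : Weight m) (c : ℚ) (h : Weight m) → ∀ w → net (λ a b → g a b ℚ.+ c ℚ.* h a b) w ≡ net g w ℚ.+ c ℚ.* net h w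
net-+* g c h w = trans
  (cong₂ ℚ._-_ (trans (sumFin-+ (λ t → g t w) _) (cong (inflow g w ℚ.+_) (sumFin-* c (λ t → h t w))))
               (trans (sumFin-+ (g w) _) (cong (outflow g w ℚ.+_) (sumFin-* c (h w)))))
  (regroup (inflow g w) c (inflow h w) (outflow g w) (outflow h w))
  where
  regroup : ∀ a c b a′ b′ → a ℚ.+ c ℚ.* b ℚ.- (a′ ℚ.+ c ℚ.* b′) ≡ a ℚ.- a′ ℚ.+ c ℚ.* (b ℚ.- b′)
  regroup = solve-∀ ℚ-ring

net-* : (c : ℚ) (g : Weight m) → ∀ w → net (λ a b → c ℚ.* g a b) w ≡ c ℚ.* net g w
net-* c g w = trans (cong₂ ℚ._-_ (sumFin-* c (λ t → g t w)) (sumFin-* c (g w))) (distrib c (inflow g w) (outflow g w))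
  where
  distrib : ∀ c a b → c ℚ.* a ℚ.- c ℚ.* b ≡ c ℚ.* (a ℚ.- b)
  distrib = solve-∀ ℚ-ring

inflow-unit : (a b w : Fin m) → inflow (unit a b) w ≡ ind w b
inflow-unit a b w = sumFin-ind a (λ _ → ind w b)

outflow-unit : (a b w : Fin m) → outflow (unit a b) w ≡ ind w a
outflow-unit a b w = trans (sumFin-* (ind w a) (λ h → ind h b)) (trans (cong (ind w a ℚ.*_) (sumFin-ind′ b)) (ℚₚ.*-identityʳ (ind w a)))

net-unit : (a b w : Fin m) → net (unit a b) w ≡ ind w b ℚ.- ind w a
net-unit a b w = cong₂ ℚ._-_ (inflow-unit a b w) (outflow-unit a b w)

sumFin2-arrowVec : ∀ {n} (g : Weight (suc n)) (k : Fin (suc n)) → sumFin2 (λ t h → g t h ℚ.* arrowVec t h k) ≡ net g k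
sumFin2-arrowVec g k = begin
  sumFin2 (λ t h → g t h ℚ.* (ind k h ℚ.- ind k t))
    ≡⟨ sumFin2-cong (λ t h → trans (cong₂ (λ x y → g t h ℚ.* (x ℚ.- y)) (ind-sym k h) (ind-sym k t)) (expand (g t h) (ind h k) (ind t k))) ⟩
  sumFin2 (λ t h → ind h k ℚ.* g t h ℚ.- ind t k ℚ.* g t h)
    ≡⟨ sumFin2-minus (λ t h → ind h k ℚ.* g t h) (λ t h → ind t k ℚ.* g t h) ⟩
  sumFin2 (λ t h → ind h k ℚ.* g t h) ℚ.- sumFin2 (λ t h → ind t k ℚ.* g t h)
    ≡⟨ cong₂ ℚ._-_ (sumFin-cong λ t → sumFin-ind k (g t))
                   (trans (sumFin-cong λ t → sumFin-* (ind t k) (g t)) (sumFin-ind k (outflow g))) ⟩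
  net g k ∎
  where
  open ≡-Reasoning
  expand : ∀ a b c → a ℚ.* (b ℚ.- c) ≡ b ℚ.* a ℚ.- c ℚ.* a
  expand = solve-∀ ℚ-ring

dot-arrowVec : ∀ {n} (c : Pt n) (t h : Fin (suc n)) → dot c (arrowVec t h) ≡ c h ℚ.- c t
dot-arrowVec c t h = begin
  sumFin (λ k → c k ℚ.* (ind k h ℚ.- ind k t))
    ≡⟨ sumFin-cong (λ k → expand (c k) (ind k h) (ind k t)) ⟩
  sumFin (λ k → ind k h ℚ.* c k ℚ.- ind k t ℚ.* c k)
    ≡⟨ sumFin-minus (λ k → ind k h ℚ.* c k) (λ k → ind k t ℚ.* c k) ⟩
  sumFin (λ k → ind k h ℚ.* c k) ℚ.- sumFin (λ k → ind k t ℚ.* c k)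
    ≡⟨ cong₂ ℚ._-_ (sumFin-ind h c) (sumFin-ind t c) ⟩
  c h ℚ.- c t ∎
  where
  open ≡-Reasoning
  expand : ∀ a b c → a ℚ.* (b ℚ.- c) ≡ b ℚ.* a ℚ.- c ℚ.* a
  expand = solve-∀ ℚ-ring

Σnet≡0 : (g : Weight m) → sumFin (net g) ≡ 0ℚ
Σnet≡0 g = trans (sumFin-minus (inflow g) (outflow g))
  (trans (cong (ℚ._- sumFin (outflow g)) (sym (total≡Σinflow g))) (ℚₚ.+-inverseʳ (sumFin2 g)))

-- Faces as cliques of the edge rule

module _ {A : Set} where
  allᵇ-tabulate⁻ : (p : A → Bool) (f : Fin m → A) → allᵇ p (List.tabulate f) ≡ true → ∀ i → p (f i) ≡ true
  allᵇ-tabulate⁻ {suc m} p f eq i with p (f zero) in eq₀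
  allᵇ-tabulate⁻ {suc m} p f eq zero    | true = eq₀
  allᵇ-tabulate⁻ {suc m} p f eq (suc i) | true = allᵇ-tabulate⁻ p (f ∘ suc) eq i

  allᵇ-tabulate⁺ : (p : A → Bool) (f : Fin m → A) → (∀ i → p (f i) ≡ true) → allᵇ p (List.tabulate f) ≡ true
  allᵇ-tabulate⁺ {zero}  p f pf = refl
  allᵇ-tabulate⁺ {suc m} p f pf = cong₂ _∧_ (pf zero) (allᵇ-tabulate⁺ p (f ∘ suc) (pf ∘ suc))

allᵇ-allFin⁻ : (p : Fin m → Bool) → allᵇ p (allFin m) ≡ true → ∀ i → p i ≡ true
allᵇ-allFin⁻ p = allᵇ-tabulate⁻ p id

allᵇ-allFin⁺ : (p : Fin m → Bool) → (∀ i → p i ≡ true) → allᵇ p (allFin m) ≡ true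
allᵇ-allFin⁺ p = allᵇ-tabulate⁺ p id

∧-true⁻ : ∀ {a b} → a ∧ b ≡ true → a ≡ true × b ≡ true
∧-true⁻ {true} {true} refl = refl , refl

not-true⁻ : ∀ {a} → not a ≡ true → a ≡ false
not-true⁻ {false} refl = refl

≢true⇒≡false : ∀ {a} → a ≢ true → a ≡ false
≢true⇒≡false {true}  a≢ = contradiction refl a≢
≢true⇒≡false {false} a≢ = refl

-- Stated for arbitrary digraphs rather than arrow sets, so that subgraphs and contractions of a
-- face can be treated as faces directly; `arrowSet` is applied only where the triangulation
-- hypothesis is invoked.
record Clique {n} (E : EdgeRule n) (R : Digraph (suc n)) : Set where
  constructor clique
  field
    loopless : ∀ {t h} → R t h ≡ true → t ≢ h
    adjacent : ∀ {t₁ h₁ t₂ h₂} → R t₁ h₁ ≡ true → R t₂ h₂ ≡ true → ¬ (t₁ ≡ t₂ × h₁ ≡ h₂) → E t₁ h₁ t₂ h₂ ≡ true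

open Clique public

IsFace⇒Clique : ∀ {n} {E : EdgeRule n} (S : ArrowSet n) → IsFace E S → Clique E (member S)
IsFace⇒Clique {n} {E} S face with ∧-true⁻ {noLoopsᵇ S} face
... | noLoops , pairs = clique
  (λ { {t} St refl → contradiction (trans (sym St) (not-true⁻ (allᵇ-allFin⁻ _ noLoops t))) λ () })
  (λ {t₁} {h₁} {t₂} {h₂} → pair t₁ h₁ t₂ h₂ (allᵇ-allFin⁻ _ (allᵇ-allFin⁻ _ (allᵇ-allFin⁻ _ (allᵇ-allFin⁻ _ pairs t₁) h₁) t₂) h₂))
  where
  pair : ∀ t₁ h₁ t₂ h₂ → not (member S t₁ h₁ ∧ member S t₂ h₂ ∧ not (⌊ t₁ ≟ t₂ ⌋ ∧ ⌊ h₁ ≟ h₂ ⌋)) ∨ E t₁ h₁ t₂ h₂ ≡ true →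
         member S t₁ h₁ ≡ true → member S t₂ h₂ ≡ true → ¬ (t₁ ≡ t₂ × h₁ ≡ h₂) → E t₁ h₁ t₂ h₂ ≡ true
  pair t₁ h₁ t₂ h₂ eq S₁ S₂ distinct rewrite S₁ | S₂ with t₁ ≟ t₂ | h₁ ≟ h₂
  ... | yes p | yes q = contradiction (p , q) distinct
  ... | yes p | no _  = eq
  ... | no _  | yes _ = eq
  ... | no _  | no _  = eq

Clique⇒IsFace : ∀ {n} {E : EdgeRule n} (S : ArrowSet n) → Clique E (member S) → IsFace E S
Clique⇒IsFace {n} {E} S c = cong₂ _∧_
  (allᵇ-allFin⁺ (λ t → not (member S t t)) λ t → cong not (≢true⇒≡false λ St → loopless c {t} {t} St refl))
  (allᵇ-allFin⁺ _ λ t₁ → allᵇ-allFin⁺ _ λ h₁ → allᵇ-allFin⁺ _ λ t₂ → allᵇ-allFin⁺ _ λ h₂ → pair t₁ h₁ t₂ h₂)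
  where
  pair : ∀ t₁ h₁ t₂ h₂ → not (member S t₁ h₁ ∧ member S t₂ h₂ ∧ not (⌊ t₁ ≟ t₂ ⌋ ∧ ⌊ h₁ ≟ h₂ ⌋)) ∨ E t₁ h₁ t₂ h₂ ≡ true
  pair t₁ h₁ t₂ h₂ with member S t₁ h₁ in S₁ | member S t₂ h₂ in S₂ | t₁ ≟ t₂ | h₁ ≟ h₂
  ... | false | _     | _     | _     = refl
  ... | true  | false | _     | _     = refl
  ... | true  | true  | yes _ | yes _ = refl
  ... | true  | true  | yes _ | no q  = adjacent c S₁ S₂ (q ∘ proj₂)
  ... | true  | true  | no p  | _     = adjacent c S₁ S₂ (p ∘ proj₁)

arrowSet : ∀ {n} → Digraph (suc n) → ArrowSet n
arrowSet R = Vec.tabulate (Vec.tabulate ∘ R)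

member-arrowSet : ∀ {n} (R : Digraph (suc n)) t h → member (arrowSet R) t h ≡ R t h
member-arrowSet R t h = trans (cong (λ v → lookup v h) (Vecₚ.lookup∘tabulate (Vec.tabulate ∘ R) t)) (Vecₚ.lookup∘tabulate (R t) h)

member-∩ : ∀ {n} (S S′ : ArrowSet n) t h → member (S ∩S S′) t h ≡ member S t h ∧ member S′ t h
member-∩ S S′ t h = trans (cong (λ v → lookup v h) (Vecₚ.lookup-zipWith (Vec.zipWith _∧_) t S S′))
  (Vecₚ.lookup-zipWith _∧_ h (lookup S t) (lookup S′ t))

Clique-resp : ∀ {n} {E : EdgeRule n} {R R′ : Digraph (suc n)} → (∀ t h → R′ t h ≡ true → R t h ≡ true) → Clique E R → Clique E R′
Clique-resp R′⊆R c = clique (loopless c ∘ R′⊆R _ _) λ p q → adjacent c (R′⊆R _ _ p) (R′⊆R _ _ q)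

-- Geometry of faces

dot-net : ∀ {n} (c : Pt n) (g : Weight (suc n)) → dot c (net g) ≡ sumFin2 (λ t h → g t h ℚ.* (c h ℚ.- c t))
dot-net c g = begin
  sumFin (λ k → c k ℚ.* (inflow g k ℚ.- outflow g k))
    ≡⟨ sumFin-cong (λ k → trans (expand (c k) (inflow g k) (outflow g k))
         (cong₂ ℚ._-_ (sym (sumFin-* (c k) (λ t → g t k))) (sym (sumFin-* (c k) (g k))))) ⟩
  sumFin (λ k → sumFin (λ t → c k ℚ.* g t k) ℚ.- sumFin (λ h → c k ℚ.* g k h))
    ≡⟨ sumFin-minus (λ k → sumFin (λ t → c k ℚ.* g t k)) (λ k → sumFin (λ h → c k ℚ.* g k h)) ⟩
  sumFin2 (λ k t → c k ℚ.* g t k) ℚ.- sumFin2 (λ k h → c k ℚ.* g k h)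
    ≡⟨ cong (ℚ._- sumFin2 (λ k h → c k ℚ.* g k h)) (sumFin-comm (λ k t → c k ℚ.* g t k)) ⟩
  sumFin2 (λ t h → c h ℚ.* g t h) ℚ.- sumFin2 (λ t h → c t ℚ.* g t h)
    ≡⟨ sym (sumFin2-minus (λ t h → c h ℚ.* g t h) (λ t h → c t ℚ.* g t h)) ⟩
  sumFin2 (λ t h → c h ℚ.* g t h ℚ.- c t ℚ.* g t h)
    ≡⟨ sumFin2-cong (λ t h → factor (c h) (c t) (g t h)) ⟩
  sumFin2 (λ t h → g t h ℚ.* (c h ℚ.- c t)) ∎
  where
  open ≡-Reasoning
  expand : ∀ a b c → a ℚ.* (b ℚ.- c) ≡ a ℚ.* b ℚ.- a ℚ.* c
  expand = solve-∀ ℚ-ring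
  factor : ∀ a b c → a ℚ.* c ℚ.- b ℚ.* c ≡ c ℚ.* (a ℚ.- b)
  factor = solve-∀ ℚ-ring

Supported : Digraph m → Weight m → Set
Supported R g = ∀ t h → R t h ≡ false → g t h ≡ 0ℚ

Nonneg : Weight m → Set
Nonneg g = ∀ t h → 0ℚ ℚ.≤ g t h

0≤+ : ∀ a b → 0ℚ ℚ.≤ a → 0ℚ ℚ.≤ b → 0ℚ ℚ.≤ a ℚ.+ b
0≤+ a b 0≤a 0≤b = ℚₚ.+-mono-≤ {0ℚ} {a} {0ℚ} {b} 0≤a 0≤b

0≤* : ∀ a b → 0ℚ ℚ.≤ a → 0ℚ ℚ.≤ b → 0ℚ ℚ.≤ a ℚ.* b
0≤* a b 0≤a 0≤b = ℚₚ.nonNegative⁻¹ (a ℚ.* b) {{ℚₚ.nonNeg*nonNeg⇒nonNeg a {{ℚ.nonNegative 0≤a}} b {{ℚ.nonNegative 0≤b}}}}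

positive-inverse : ∀ {s} → 0ℚ ℚ.≤ s → s ≢ 0ℚ → ∃ λ r → s ℚ.* r ≡ 1ℚ × 0ℚ ℚ.< r
positive-inverse {s} 0≤s s≢0 =
  ℚ.1/_ s {{ℚ.≢-nonZero s≢0}} , ℚₚ.*-inverseʳ s {{ℚ.≢-nonZero s≢0}} ,
  ℚₚ.positive⁻¹ _ {{ℚₚ.1/pos⇒pos s {{s>0}}}}
  where
  s>0 : ℚ.Positive s
  s>0 = ℚₚ.nonNeg∧nonZero⇒pos s {{ℚ.nonNegative 0≤s}} {{ℚ.≢-nonZero s≢0}}

a+a≤a⇒a≤0 : ∀ {a} → a ℚ.+ a ℚ.≤ a → a ℚ.≤ 0ℚ
a+a≤a⇒a≤0 {a} le = ≡-≤-trans (cancel a) (ℚₚ.≤-trans (ℚₚ.+-monoˡ-≤ (ℚ.- a) le) (ℚₚ.≤-reflexive (ℚₚ.+-inverseʳ a)))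
  where
  cancel : ∀ a → a ≡ a ℚ.+ a ℚ.+ ℚ.- a
  cancel = solve-∀ ℚ-ring

-- When one of the two nonnegative numbers is zero, the first is the positive part of the
-- difference. Applied to inflow and outflow, this recovers the inflow at a vertex from the net.
one-sided-difference : ∀ {i o i′ o′} → 0ℚ ℚ.≤ i → 0ℚ ℚ.≤ o → 0ℚ ℚ.≤ i′ → 0ℚ ℚ.≤ o′ →
  i ≡ 0ℚ ⊎ o ≡ 0ℚ → i′ ≡ 0ℚ ⊎ o′ ≡ 0ℚ → i ℚ.- o ≡ i′ ℚ.- o′ → i ≡ i′
one-sided-difference 0≤i 0≤o 0≤i′ 0≤o′ (inj₁ refl) (inj₁ refl) eq = refl
one-sided-difference {i} {i′ = i′} 0≤i 0≤o 0≤i′ 0≤o′ (inj₂ refl) (inj₂ refl) eq =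
  trans (sym (ℚₚ.+-identityʳ i)) (trans eq (ℚₚ.+-identityʳ i′))
one-sided-difference {o = o} {i′} 0≤i 0≤o 0≤i′ 0≤o′ (inj₁ refl) (inj₂ refl) eq =
  ℚₚ.≤-antisym 0≤i′ (≡-≤-trans (trans (sym (ℚₚ.+-identityʳ i′)) (sym eq)) (ℚₚ.+-monoʳ-≤ 0ℚ (ℚₚ.neg-antimono-≤ 0≤o)))
one-sided-difference {i} {o′ = o′} 0≤i 0≤o 0≤i′ 0≤o′ (inj₂ refl) (inj₁ refl) eq =
  ℚₚ.≤-antisym (≡-≤-trans (trans (sym (ℚₚ.+-identityʳ i)) eq) (ℚₚ.+-monoʳ-≤ 0ℚ (ℚₚ.neg-antimono-≤ 0≤o′))) 0≤i

-- The number φ c - φ a is itself the value of φ at an arrow, or zero, hence at most M; so 2M ≤ M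
-- and M ≤ 0. On the other hand the arrow t→h and its opposite have values of sum 0, one below M and
-- the other at most M, so 0 < 2M.
no-supporting-functional : (φ : Fin m → ℚ) (M : ℚ) → (∀ {t h} → t ≢ h → φ h ℚ.- φ t ℚ.≤ M) →
  ∀ a c → M ℚ.+ M ≡ φ c ℚ.- φ a → ∀ {t h} → t ≢ h → φ h ℚ.- φ t ℚ.< M → ⊥
no-supporting-functional φ M φ≤M a c M+M {t} {h} t≢h strict = ℚₚ.<-irrefl refl (ℚₚ.<-≤-trans 0<M+M (ℚₚ.+-mono-≤ {M} {0ℚ} {M} {0ℚ} M≤0 M≤0))
  where
  M≤0 : M ℚ.≤ 0ℚ
  M≤0 with a ≟ c
  ... | no a≢c   = a+a≤a⇒a≤0 {M} (≡-≤-trans M+M (φ≤M a≢c))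
  ... | yes refl with ℚₚ.≤-total M 0ℚ
  ...   | inj₁ M≤0 = M≤0
  ...   | inj₂ 0≤M = a+a≤a⇒a≤0 {M} (≡-≤-trans (trans M+M (ℚₚ.+-inverseʳ (φ a))) 0≤M)
  0<M+M : 0ℚ ℚ.< M ℚ.+ M
  0<M+M = ≡-<-trans (opposite (φ t) (φ h)) (ℚₚ.+-mono-<-≤ {φ h ℚ.- φ t} {M} {φ t ℚ.- φ h} {M} strict (φ≤M (t≢h ∘ sym)))
    where
    opposite : ∀ x y → 0ℚ ≡ y ℚ.- x ℚ.+ (x ℚ.- y)
    opposite = solve-∀ ℚ-ring

module Geometry {n : ℕ} {E : EdgeRule n} (tri : IsTriangulationOfBoundary E) where

  private
    N = suc n

  toFace : {R : Digraph N} → Clique E R → IsFace E (arrowSet R)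
  toFace {R} c = Clique⇒IsFace (arrowSet R) (Clique-resp (λ t h → trans (sym (member-arrowSet R t h))) c)

  supported-arrowSet : {R : Digraph N} {g : Weight N} → Supported R g → Supported (member (arrowSet R)) g
  supported-arrowSet {R} supp t h eq = supp t h (trans (sym (member-arrowSet R t h)) eq)

  convex : {R : Digraph N} {g : Weight N} → Nonneg g → Supported R g → sumFin2 g ≡ 1ℚ → {x : Pt n} →
           (∀ k → x k ≡ net g k) → InConv (arrowSet R) x
  convex {R} {g} 0≤g supp Σg x≡ = g , 0≤g , supported-arrowSet {R} {g} supp , Σg , λ k → trans (x≡ k) (sym (sumFin2-arrowVec g k))

  -- An arrow a→b and an arrow b→c have the midpoint (e_c − e_a)/2, which is interior to P_n.
  no-path : (p : ℚ) → p ℚ.+ p ≡ 1ℚ → 0ℚ ℚ.≤ p → {R : Digraph N} → Clique E R → ∀ {a b c} → R a b ≡ true → R b c ≡ true → ⊥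
  no-path p p+p≡1 0≤p {R} cl {a} {b} {c} Rab Rbc = absurd boundary
    where
    g : Weight N
    g t h = p ℚ.* (unit a b t h ℚ.+ unit b c t h)
    g≥0 : Nonneg g
    g≥0 t h = 0≤* p (unit a b t h ℚ.+ unit b c t h) 0≤p (0≤+ (unit a b t h) (unit b c t h) (unit-≥0 a b t h) (unit-≥0 b c t h))
    supp : Supported R g
    supp t h eq = trans (cong₂ (λ x y → p ℚ.* (x ℚ.+ y)) (unit-supported R Rab t h eq) (unit-supported R Rbc t h eq)) (ℚₚ.*-zeroʳ p)
    Σ-g : ∀ (k : Weight N) → sumFin2 (λ t h → g t h ℚ.* k t h) ≡ p ℚ.* (k a b ℚ.+ k b c)
    Σ-g k = begin
      sumFin2 (λ t h → g t h ℚ.* k t h)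
        ≡⟨ sumFin2-cong (λ t h → expand p (unit a b t h) (unit b c t h) (k t h)) ⟩
      sumFin2 (λ t h → p ℚ.* (unit a b t h ℚ.* k t h ℚ.+ unit b c t h ℚ.* k t h))
        ≡⟨ sumFin2-* p (λ t h → unit a b t h ℚ.* k t h ℚ.+ unit b c t h ℚ.* k t h) ⟩
      p ℚ.* sumFin2 (λ t h → unit a b t h ℚ.* k t h ℚ.+ unit b c t h ℚ.* k t h)
        ≡⟨ cong (p ℚ.*_) (trans (sumFin2-+ (λ t h → unit a b t h ℚ.* k t h) (λ t h → unit b c t h ℚ.* k t h))
                                  (cong₂ ℚ._+_ (sumFin2-unit a b k) (sumFin2-unit b c k))) ⟩
      p ℚ.* (k a b ℚ.+ k b c) ∎
      where
      open ≡-Reasoning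
      expand : ∀ q x y z → q ℚ.* (x ℚ.+ y) ℚ.* z ≡ q ℚ.* (x ℚ.* z ℚ.+ y ℚ.* z)
      expand = solve-∀ ℚ-ring
    Σg≡1 : sumFin2 g ≡ 1ℚ
    Σg≡1 = trans (sumFin2-cong λ t h → sym (ℚₚ.*-identityʳ (g t h))) (trans (Σ-g (λ _ _ → 1ℚ)) (trans (ℚₚ.*-distribˡ-+ p 1ℚ 1ℚ) (trans (cong₂ ℚ._+_ (ℚₚ.*-identityʳ p) (ℚₚ.*-identityʳ p)) p+p≡1)))
    boundary : InBoundary (net g)
    boundary = proj₁ (proj₂ tri) (arrowSet R) (toFace cl) (net g) (convex {R} {g} g≥0 supp Σg≡1 λ _ → refl)
    absurd : InBoundary (net g) → ⊥
    absurd (_ , φ , φ≤M , t , h , t≢h , strict) =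
      no-supporting-functional φ (dot φ (net g))
        (λ {t} {h} t≢h → ≡-≤-trans (sym (dot-arrowVec φ t h)) (φ≤M t h t≢h)) a c
        (trans (cong₂ ℚ._+_ M≡ M≡) (halves (φ c ℚ.- φ a)))
        t≢h (≡-<-trans (sym (dot-arrowVec φ t h)) strict)
      where
      telescope : ∀ x y z → y ℚ.- x ℚ.+ (z ℚ.- y) ≡ z ℚ.- x
      telescope = solve-∀ ℚ-ring
      M≡ : dot φ (net g) ≡ p ℚ.* (φ c ℚ.- φ a)
      M≡ = trans (dot-net φ g) (trans (Σ-g (λ t h → φ h ℚ.- φ t)) (cong (p ℚ.*_) (telescope (φ a) (φ b) (φ c))))
      halves : ∀ q → p ℚ.* q ℚ.+ p ℚ.* q ≡ q
      halves q = trans (sym (ℚₚ.*-distribʳ-+ q p p)) (trans (cong (ℚ._* q) p+p≡1) (ℚₚ.*-identityˡ q))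
  bipartite : {R : Digraph N} → Clique E R → ∀ {a b c} → R a b ≡ true → R b c ≡ true → ⊥
  bipartite = no-path ℚ.½ refl (ℚₚ.nonNegative⁻¹ ℚ.½)

  inflow≡0⊎outflow≡0 : {R : Digraph N} → Clique E R → {g : Weight N} → Supported R g → ∀ w → inflow g w ≡ 0ℚ ⊎ outflow g w ≡ 0ℚ
  inflow≡0⊎outflow≡0 {R} cl {g} supp w with Finₚ.any? (λ t → R t w Boolₚ.≟ true)
  ... | yes (t , Rtw) = inj₂ (trans (sumFin-cong λ h → supp w h (≢true⇒≡false λ Rwh → bipartite cl Rtw Rwh)) (sumFin-0 {N}))
  ... | no ∄t         = inj₁ (trans (sumFin-cong λ t → supp t w (≢true⇒≡false λ Rtw → ∄t (t , Rtw))) (sumFin-0 {N}))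

  -- Affine independence improves to linear independence. Every vertex is only a head or only a
  -- tail, so zero net forces zero inflow, and the condition on the total weight holds by itself.
  independent : {R : Digraph N} → Clique E R → {μ : Weight N} → Supported R μ → (∀ w → net μ w ≡ 0ℚ) → ∀ t h → μ t h ≡ 0ℚ
  independent {R} cl {μ} supp net≡0 = proj₁ tri (arrowSet R) (toFace cl) μ (supported-arrowSet {R} {μ} supp)
    (trans (total≡Σinflow μ) (trans (sumFin-cong inflow≡0) (sumFin-0 {N})))
    (λ k → trans (sumFin2-arrowVec μ k) (net≡0 k))
    where
    inflow≡0 : ∀ w → inflow μ w ≡ 0ℚ
    inflow≡0 w with inflow≡0⊎outflow≡0 cl {μ} supp w
    ... | inj₁ i≡0 = i≡0
    ... | inj₂ o≡0 = trans (sym (ℚₚ.+-identityʳ (inflow μ w))) (trans (cong (λ z → inflow μ w ℚ.- z) (sym o≡0)) (net≡0 w))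

  -- The inflows are the positive parts of the nets, so both weightings have the same total and can
  -- be scaled to represent one point. That point lies in both simplices, hence in the simplex on
  -- the common arrows, and independence identifies both weightings with the one found there.
  unique : {R R′ : Digraph N} → Clique E R → Clique E R′ → {g g′ : Weight N} → Nonneg g → Nonneg g′ →
           Supported R g → Supported R′ g′ → (∀ w → net g w ≡ net g′ w) → ∀ t h → g t h ≡ g′ t h
  unique {R} {R′} cl cl′ {g} {g′} 0≤g 0≤g′ supp supp′ nets = conclusion
    where
    inflows : ∀ w → inflow g w ≡ inflow g′ w
    inflows w = one-sided-difference (sumFin-≥0 λ t → 0≤g t w) (sumFin-≥0 (0≤g w)) (sumFin-≥0 λ t → 0≤g′ t w) (sumFin-≥0 (0≤g′ w))
      (inflow≡0⊎outflow≡0 cl {g} supp w) (inflow≡0⊎outflow≡0 cl′ {g′} supp′ w) (nets w)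
    totals : sumFin2 g ≡ sumFin2 g′
    totals = trans (total≡Σinflow g) (trans (sumFin-cong inflows) (sym (total≡Σinflow g′)))

    module Scaled (r : ℚ) (r-inverse : sumFin2 g ℚ.* r ≡ 1ℚ) (0≤r : 0ℚ ℚ.≤ r) where
      rg rg′ : Weight N
      rg t h = r ℚ.* g t h
      rg′ t h = r ℚ.* g′ t h
      rg-supp : Supported R rg
      rg-supp t h eq = trans (cong (r ℚ.*_) (supp t h eq)) (ℚₚ.*-zeroʳ r)
      rg′-supp : Supported R′ rg′
      rg′-supp t h eq = trans (cong (r ℚ.*_) (supp′ t h eq)) (ℚₚ.*-zeroʳ r)
      in-both : InConv (arrowSet R ∩S arrowSet R′) (net rg)
      in-both = proj₂ (proj₂ (proj₂ tri)) (arrowSet R) (arrowSet R′) (toFace cl) (toFace cl′) (net rg)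
        (convex {R} {rg} (λ t h → 0≤* r (g t h) 0≤r (0≤g t h)) rg-supp
          (trans (sumFin2-* r g) (trans (ℚₚ.*-comm r (sumFin2 g)) r-inverse)) (λ _ → refl))
        (convex {R′} {rg′} (λ t h → 0≤* r (g′ t h) 0≤r (0≤g′ t h)) rg′-supp
          (trans (sumFin2-* r g′) (trans (ℚₚ.*-comm r (sumFin2 g′)) (trans (cong (ℚ._* r) (sym totals)) r-inverse)))
          (λ k → trans (net-* r g k) (trans (cong (r ℚ.*_) (nets k)) (sym (net-* r g′ k)))))
      ν : Weight N
      ν = proj₁ in-both
      ν-supp : ∀ t h → R t h ≡ false ⊎ R′ t h ≡ false → ν t h ≡ 0ℚ
      ν-supp t h off = proj₁ (proj₂ (proj₂ in-both)) t h
        (trans (member-∩ (arrowSet R) (arrowSet R′) t h)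
          (trans (cong₂ _∧_ (member-arrowSet R t h) (member-arrowSet R′ t h)) (off∧ off)))
        where
        off∧ : R t h ≡ false ⊎ R′ t h ≡ false → R t h ∧ R′ t h ≡ false
        off∧ (inj₁ eq) rewrite eq = refl
        off∧ (inj₂ eq) rewrite eq = Boolₚ.∧-zeroʳ (R t h)
      ν-net : ∀ k → net rg k ≡ net ν k
      ν-net k = trans (proj₂ (proj₂ (proj₂ (proj₂ in-both))) k) (sumFin2-arrowVec ν k)
      agree : ∀ {Q} → Clique E Q → {k : Weight N} → Supported Q k → (∀ t h → Q t h ≡ false → ν t h ≡ 0ℚ) →
              (∀ w → net k w ≡ net ν w) → ∀ t h → k t h ≡ ν t h
      agree {Q} clQ {k} k-supp ν-supp nets t h = begin
        k t h                            ≡⟨ split (k t h) (ν t h) ⟩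
        ν t h ℚ.+ (k t h ℚ.+ ℚ.- 1ℚ ℚ.* ν t h) ≡⟨ cong (ν t h ℚ.+_) (independent clQ {μ} μ-supp μ-net t h) ⟩
        ν t h ℚ.+ 0ℚ                     ≡⟨ ℚₚ.+-identityʳ (ν t h) ⟩
        ν t h                            ∎
        where
        open ≡-Reasoning
        split : ∀ a b → a ≡ b ℚ.+ (a ℚ.+ ℚ.- 1ℚ ℚ.* b)
        split = solve-∀ ℚ-ring
        cancel : ∀ a → a ℚ.+ ℚ.- 1ℚ ℚ.* a ≡ 0ℚ
        cancel = solve-∀ ℚ-ring
        μ : Weight N
        μ t h = k t h ℚ.+ ℚ.- 1ℚ ℚ.* ν t h
        μ-supp : Supported Q μ
        μ-supp t h eq = cong₂ (λ x y → x ℚ.+ ℚ.- 1ℚ ℚ.* y) (k-supp t h eq) (ν-supp t h eq)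
        μ-net : ∀ w → net μ w ≡ 0ℚ
        μ-net w = trans (net-+* k (ℚ.- 1ℚ) ν w) (trans (cong (ℚ._+ ℚ.- 1ℚ ℚ.* net ν w) (nets w)) (cancel (net ν w)))
      rg≡rg′ : ∀ t h → rg t h ≡ rg′ t h
      rg≡rg′ t h = trans (agree cl {rg} rg-supp (λ t h → ν-supp t h ∘ inj₁) ν-net t h)
        (sym (agree cl′ {rg′} rg′-supp (λ t h → ν-supp t h ∘ inj₂)
               (λ w → trans (net-* r g′ w) (trans (cong (r ℚ.*_) (sym (nets w))) (trans (sym (net-* r g w)) (ν-net w)))) t h))
      unscale : ∀ z → sumFin2 g ℚ.* (r ℚ.* z) ≡ z
      unscale z = trans (sym (ℚₚ.*-assoc (sumFin2 g) r z)) (trans (cong (ℚ._* z) r-inverse) (ℚₚ.*-identityˡ z))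
      g≡g′ : ∀ t h → g t h ≡ g′ t h
      g≡g′ t h = trans (sym (unscale (g t h))) (trans (cong (sumFin2 g ℚ.*_) (rg≡rg′ t h)) (unscale (g′ t h)))

    conclusion : ∀ t h → g t h ≡ g′ t h
    conclusion with sumFin2 g ℚₚ.≟ 0ℚ
    ... | yes Σ≡0 = λ t h → trans (sumFin2-≡0 0≤g Σ≡0 t h) (sym (sumFin2-≡0 0≤g′ (trans (sym totals) Σ≡0) t h))
    ... | no Σ≢0 with positive-inverse (sumFin-≥0 λ t → sumFin-≥0 (0≤g t)) Σ≢0
    ...   | r , r-inverse , 0<r = Scaled.g≡g′ r r-inverse (ℚₚ.<⇒≤ 0<r)

-- Forests

sumℕ-ind : (a : Fin m) (f : Fin m → ℕ) → sumℕ (λ i → toℕᵇ ⌊ i ≟ a ⌋ * f i) ≡ f a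
sumℕ-ind {suc m} zero f = trans (cong₂ _+_ (ℕₚ.*-identityˡ (f zero)) (sumℕ-0 {m})) (ℕₚ.+-identityʳ (f zero))
sumℕ-ind {suc m} (suc a) f = trans (sumℕ-cong λ i → cong (λ b → toℕᵇ b * f (suc i)) (≟-suc i)) (sumℕ-ind a (f ∘ suc))
  where
  ≟-suc : ∀ i → ⌊ suc i ≟ suc a ⌋ ≡ ⌊ i ≟ a ⌋
  ≟-suc i with i ≟ a
  ... | yes _ = refl
  ... | no _  = refl

sumℕ-ind′ : (a : Fin m) → sumℕ (λ i → toℕᵇ ⌊ i ≟ a ⌋) ≡ 1
sumℕ-ind′ a = trans (sumℕ-cong λ i → sym (ℕₚ.*-identityʳ (toℕᵇ ⌊ i ≟ a ⌋))) (sumℕ-ind a (λ _ → 1))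

≟-refl : (a : Fin m) → ⌊ a ≟ a ⌋ ≡ true
≟-refl a with a ≟ a
... | yes _  = refl
... | no a≢a = contradiction refl a≢a

≟-≢ : {a b : Fin m} → a ≢ b → ⌊ a ≟ b ⌋ ≡ false
≟-≢ {a = a} {b} a≢b with a ≟ b
... | yes a≡b = contradiction a≡b a≢b
... | no _    = refl

≟-true⁻ : {a b : Fin m} → ⌊ a ≟ b ⌋ ≡ true → a ≡ b
≟-true⁻ {a = a} {b} eq with a ≟ b
... | yes a≡b = a≡b

≟-false⁻ : {a b : Fin m} → ⌊ a ≟ b ⌋ ≡ false → a ≢ b
≟-false⁻ {a = a} {b} eq with a ≟ b
... | no a≢b = a≢b

toℕᵇ-mono : ∀ {a b} → (a ≡ true → b ≡ true) → toℕᵇ a ≤ toℕᵇ b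
toℕᵇ-mono {false} a⇒b = z≤n
toℕᵇ-mono {true}  a⇒b rewrite a⇒b refl = ℕₚ.≤-refl

count-mono : {p q : Fin m → Bool} → (∀ i → p i ≡ true → q i ≡ true) → count p ≤ count q
count-mono p⇒q = sumℕ-mono (toℕᵇ-mono ∘ p⇒q)

count-≥1 : (p : Fin m → Bool) → ∀ i → p i ≡ true → 1 ≤ count p
count-≥1 p i pi = ℕₚ.≤-trans (ℕₚ.≤-reflexive (cong toℕᵇ (sym pi))) (sumℕ-≥term (toℕᵇ ∘ p) i)

count-true : count {m} (λ _ → true) ≡ m
count-true {zero}  = refl
count-true {suc m} = cong suc (count-true {m})

remove : (Fin m → Bool) → Fin m → Fin m → Bool
remove U u v = U v ∧ not ⌊ v ≟ u ⌋

remove⁻ : (U : Fin m → Bool) {u v : Fin m} → remove U u v ≡ true → U v ≡ true × v ≢ u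
remove⁻ U {u} {v} eq with ∧-true⁻ {U v} eq
... | Uv , v≢u = Uv , ≟-false⁻ (not-true⁻ v≢u)

remove⁺ : (U : Fin m → Bool) {u v : Fin m} → U v ≡ true → v ≢ u → remove U u v ≡ true
remove⁺ U {u} {v} Uv v≢u = cong₂ (λ a b → a ∧ not b) Uv (≟-≢ v≢u)

count-remove : (U : Fin m → Bool) (u : Fin m) → U u ≡ true → count U ≡ suc (count (remove U u))
count-remove U u Uu = begin
  count U
    ≡⟨ sumℕ-cong split ⟩
  sumℕ (λ v → toℕᵇ ⌊ v ≟ u ⌋ + toℕᵇ (remove U u v))
    ≡⟨ sumℕ-+ (λ v → toℕᵇ ⌊ v ≟ u ⌋) (toℕᵇ ∘ remove U u) ⟩
  sumℕ (λ v → toℕᵇ ⌊ v ≟ u ⌋) + count (remove U u)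
    ≡⟨ cong (_+ count (remove U u)) (sumℕ-ind′ u) ⟩
  suc (count (remove U u)) ∎
  where
  open ≡-Reasoning
  split : ∀ v → toℕᵇ (U v) ≡ toℕᵇ ⌊ v ≟ u ⌋ + toℕᵇ (remove U u v)
  split v with v ≟ u
  ... | yes refl rewrite Uu = refl
  ... | no _ = cong toℕᵇ (sym (Boolₚ.∧-identityʳ (U v)))

length-filterᵇ-tabulate : {A : Set} (p : A → Bool) (f : Fin m → A) → length (filterᵇ p (List.tabulate f)) ≡ count (p ∘ f)
length-filterᵇ-tabulate {zero}  p f = refl
length-filterᵇ-tabulate {suc m} p f with p (f zero)
... | true  = cong suc (length-filterᵇ-tabulate p (f ∘ suc))
... | false = length-filterᵇ-tabulate p (f ∘ suc)

length-filterᵇ-map : {A B : Set} (p : B → Bool) (f : A → B) (xs : List A) → length (filterᵇ p (map f xs)) ≡ length (filterᵇ (p ∘ f) xs)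
length-filterᵇ-map p f [] = refl
length-filterᵇ-map p f (x ∷ xs) with p (f x)
... | true  = cong suc (length-filterᵇ-map p f xs)
... | false = length-filterᵇ-map p f xs

∈-filterᵇ⁺ : {A : Set} (p : A → Bool) {x : A} {xs : List A} → x ∈ xs → p x ≡ true → x ∈ filterᵇ p xs
∈-filterᵇ⁺ p x∈xs px = ∈ₚ.∈-filter⁺ (Bool.T? ∘ p) x∈xs (subst Bool.T (sym px) _)

∈-filterᵇ⁻ : {A : Set} (p : A → Bool) {x : A} {xs : List A} → x ∈ filterᵇ p xs → x ∈ xs × p x ≡ true
∈-filterᵇ⁻ p x∈ with ∈ₚ.∈-filter⁻ (Bool.T? ∘ p) x∈
... | x∈xs , Tpx = x∈xs , Equivalence.to Boolₚ.T-≡ Tpx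

size : Digraph m → ℕ
size R = sumℕ (λ t → count (R t))

within : Digraph m → (Fin m → Bool) → Digraph m
within R U t h = R t h ∧ U t ∧ U h

within⁻ : (R : Digraph m) (U : Fin m → Bool) {t h : Fin m} → within R U t h ≡ true → R t h ≡ true × U t ≡ true × U h ≡ true
within⁻ R U {t} {h} eq with ∧-true⁻ {R t h} eq
... | Rth , UU with ∧-true⁻ {U t} UU
...   | Ut , Uh = Rth , Ut , Uh

within⁺ : (R : Digraph m) (U : Fin m → Bool) {t h : Fin m} → R t h ≡ true → U t ≡ true → U h ≡ true → within R U t h ≡ true
within⁺ R U Rth Ut Uh = cong₂ _∧_ Rth (cong₂ _∧_ Ut Uh)

size-mono : {R R′ : Digraph m} → (∀ t h → R t h ≡ true → R′ t h ≡ true) → size R ≤ size R′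
size-mono R⊆R′ = sumℕ-mono (λ t → count-mono (R⊆R′ t))

-- R is a forest, expressed by the number of edges that a nonempty vertex set may span.
Sparse : Digraph m → Set
Sparse R = ∀ U u → U u ≡ true → size (within R U) < count U

Sparse-mono : {R R′ : Digraph m} → (∀ t h → R t h ≡ true → R′ t h ≡ true) → Sparse R′ → Sparse R
Sparse-mono {R = R} {R′} R⊆R′ sparse U u Uu = ℕₚ.≤-<-trans
  (size-mono {R = within R U} λ t h eq → let Rth , Ut , Uh = within⁻ R U eq in within⁺ R′ U (R⊆R′ t h Rth) Ut Uh)
  (sparse U u Uu)

edges : Digraph m → List (Fin m × Fin m)
edges R = filterᵇ (λ e → R (proj₁ e) (proj₂ e)) (List.cartesianProduct (allFin _) (allFin _))

length-edges : (R : Digraph m) → length (edges R) ≡ size R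
length-edges {m} R = rows (λ t → t)
  where
  rows : ∀ {k} (f : Fin k → Fin m) →
    length (filterᵇ (λ e → R (proj₁ e) (proj₂ e)) (List.cartesianProduct (List.tabulate f) (allFin m))) ≡ sumℕ (λ t → count (R (f t)))
  rows {zero}  f = refl
  rows {suc k} f = begin
    length (filterᵇ p (map (f zero ,_) (allFin m) ++ rest))
      ≡⟨ cong length (Listₚ.filter-++ (Bool.T? ∘ p) (map (f zero ,_) (allFin m)) rest) ⟩
    length (filterᵇ p (map (f zero ,_) (allFin m)) ++ filterᵇ p rest)
      ≡⟨ Listₚ.length-++ (filterᵇ p (map (f zero ,_) (allFin m))) ⟩
    length (filterᵇ p (map (f zero ,_) (allFin m))) + length (filterᵇ p rest)
      ≡⟨ cong₂ _+_ (trans (length-filterᵇ-map p (f zero ,_) (allFin m)) (length-filterᵇ-tabulate (R (f zero)) id)) (rows (f ∘ suc)) ⟩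
    count (R (f zero)) + sumℕ (λ t → count (R (f (suc t)))) ∎
    where
    open ≡-Reasoning
    p = λ (e : Fin m × Fin m) → R (proj₁ e) (proj₂ e)
    rest = List.cartesianProduct (List.tabulate (f ∘ suc)) (allFin m)

edges-unique : (R : Digraph m) → Unique (edges R)
edges-unique {m} R = Uniqueₚ.filter⁺ (Bool.T? ∘ (λ e → R (proj₁ e) (proj₂ e))) (Uniqueₚ.cartesianProduct⁺ (Uniqueₚ.allFin⁺ m) (Uniqueₚ.allFin⁺ m))

module _ {n : ℕ} {E : EdgeRule n} (tri : IsTriangulationOfBoundary E) where
  open Geometry tri
  open Functional
  open Kernel {Fin (suc n) × Fin (suc n)} (Data.Product.Properties.≡-dec _≟_ _≟_)

  private
    netAt : Fin (suc n) → Functional (Fin (suc n) × Fin (suc n))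
    netAt w .app μ = net (λ t h → μ (t , h)) w
    netAt w .cong-≗ eq = net-cong (λ t h → eq (t , h)) w
    netAt w .linear f c g = net-+* (λ t h → f (t , h)) c (λ t h → g (t , h)) w

    net-within : (R : Digraph (suc n)) (U : Fin (suc n) → Bool) (u : Fin (suc n)) (μ : Weight (suc n)) → Supported (within R U) μ →
      (∀ w → U w ≡ true → w ≢ u → net μ w ≡ 0ℚ) → ∀ w → net μ w ≡ 0ℚ
    net-within R U u μ supp balanced = net≡0
      where
      off : ∀ {t h} → within R U t h ≢ true → μ t h ≡ 0ℚ
      off {t} {h} ¬w = supp t h (≢true⇒≡false ¬w)
      balanced-≢ : ∀ w → w ≢ u → net μ w ≡ 0ℚ
      balanced-≢ w w≢u with U w Boolₚ.≟ true
      ... | yes Uw = balanced w Uw w≢u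
      ... | no ¬Uw = cong₂ ℚ._-_
        (trans (sumFin-cong λ t → off λ eq → ¬Uw (proj₂ (proj₂ (within⁻ R U {t} {w} eq)))) (sumFin-0 {suc n}))
        (trans (sumFin-cong λ h → off λ eq → ¬Uw (proj₁ (proj₂ (within⁻ R U {w} {h} eq)))) (sumFin-0 {suc n}))
      only-u : ∀ i → ind i u ℚ.* net μ i ≡ net μ i
      only-u i with i ≟ u
      ... | yes _  = ℚₚ.*-identityˡ (net μ i)
      ... | no i≢u = trans (ℚₚ.*-zeroˡ (net μ i)) (sym (balanced-≢ i i≢u))
      net≡0 : ∀ w → net μ w ≡ 0ℚ
      net≡0 w with w ≟ u
      ... | no w≢u = balanced-≢ w w≢u
      ... | yes refl = trans (sym (sumFin-ind w (net μ))) (trans (sumFin-cong only-u) (Σnet≡0 μ))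

    independent-edges : {R : Digraph (suc n)} → Clique E R → ∀ U u → let V = filterᵇ (remove U u) (allFin (suc n)) in
      Dependence (edges (within R U)) (map netAt V) → ⊥
    independent-edges {R} cl U u (μ , supp , (a , _ , μa≢0) , vanish) =
      μa≢0 (independent cl {λ t h → μ (t , h)}
        (λ t h Rth → supp′ t h (cong (_∧ (U t ∧ U h)) Rth))
        (net-within R U u (λ t h → μ (t , h)) supp′
          (λ w Uw w≢u → All.lookup vanish (∈ₚ.∈-map⁺ netAt (∈-filterᵇ⁺ (remove U u) (∈ₚ.∈-allFin w) (remove⁺ U Uw w≢u)))))
        (proj₁ a) (proj₂ a))
      where
      supp′ : ∀ t h → within R U t h ≡ false → μ (t , h) ≡ 0ℚ
      supp′ t h eq = supp (t , h) λ e∈ →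
        contradiction (trans (sym (proj₂ (∈-filterᵇ⁻ (λ e → within R U (proj₁ e) (proj₂ e)) e∈))) eq) λ ()

  -- With |U| edges inside U, the balance conditions at all vertices of U but one have a nonzero solution;
  -- the last balance condition follows as the nets sum to zero.
  clique-sparse : {R : Digraph (suc n)} → Clique E R → Sparse R
  clique-sparse {R} cl U u Uu with size (within R U) ℕₚ.<? count U
  ... | yes size<count = size<count
  ... | no size≮count = ⊥-elim (independent-edges cl U u
    (kernel (edges (within R U)) (edges-unique (within R U)) (map netAt V) length-V))
    where
    V = filterᵇ (remove U u) (allFin (suc n))
    length-V : length (map netAt V) < length (edges (within R U))
    length-V = subst₂ _<_ (sym (trans (Listₚ.length-map netAt V) (length-filterᵇ-tabulate (remove U u) id)))
      (sym (length-edges (within R U)))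
      (ℕₚ.≤-trans (ℕₚ.≤-reflexive (sym (count-remove U u Uu))) (ℕₚ.≮⇒≥ size≮count))

-- Positive weightings of spanning forests

indicator : Digraph m → Weight m
indicator R t h = toℚᵇ (R t h)

sumOver : (Fin m → Bool) → (Fin m → ℚ) → ℚ
sumOver U c = sumFin (λ v → toℚᵇ (U v) ℚ.* c v)

sumOver-remove : (U : Fin m → Bool) (c : Fin m → ℚ) (u : Fin m) → U u ≡ true → sumOver U c ≡ c u ℚ.+ sumOver (remove U u) c
sumOver-remove U c u Uu = begin
  sumOver U c
    ≡⟨ sumFin-cong split ⟩
  sumFin (λ v → ind v u ℚ.* c v ℚ.+ toℚᵇ (remove U u v) ℚ.* c v)
    ≡⟨ sumFin-+ (λ v → ind v u ℚ.* c v) (λ v → toℚᵇ (remove U u v) ℚ.* c v) ⟩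
  sumFin (λ v → ind v u ℚ.* c v) ℚ.+ sumOver (remove U u) c
    ≡⟨ cong (ℚ._+ sumOver (remove U u) c) (sumFin-ind u c) ⟩
  c u ℚ.+ sumOver (remove U u) c ∎
  where
  open ≡-Reasoning
  split : ∀ v → toℚᵇ (U v) ℚ.* c v ≡ ind v u ℚ.* c v ℚ.+ toℚᵇ (remove U u v) ℚ.* c v
  split v with v ≟ u
  ... | yes refl rewrite Uu = sym (trans (cong (1ℚ ℚ.* c v ℚ.+_) (ℚₚ.*-zeroˡ (c v))) (ℚₚ.+-identityʳ (1ℚ ℚ.* c v)))
  ... | no _ = trans (cong (λ b → toℚᵇ b ℚ.* c v) (sym (Boolₚ.∧-identityʳ (U v))))
    (sym (trans (cong (ℚ._+ toℚᵇ (U v ∧ true) ℚ.* c v) (ℚₚ.*-zeroˡ (c v))) (ℚₚ.+-identityˡ (toℚᵇ (U v ∧ true) ℚ.* c v))))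

sumOver-≥0 : (U : Fin m → Bool) {c : Fin m → ℚ} → (∀ v → 0ℚ ℚ.< c v) → 0ℚ ℚ.≤ sumOver U c
sumOver-≥0 U {c} 0<c = sumFin-≥0 term
  where
  term : ∀ v → 0ℚ ℚ.≤ toℚᵇ (U v) ℚ.* c v
  term v with U v
  ... | true  = 0≤* 1ℚ (c v) (ℚₚ.nonNegative⁻¹ 1ℚ) (ℚₚ.<⇒≤ (0<c v))
  ... | false = ℚₚ.≤-reflexive (sym (ℚₚ.*-zeroˡ (c v)))

sumOver-none : (U : Fin m → Bool) (c : Fin m → ℚ) → (∀ v → U v ≡ false) → sumOver U c ≡ 0ℚ
sumOver-none {m} U c none = trans (sumFin-cong λ v → trans (cong (λ b → toℚᵇ b ℚ.* c v) (none v)) (ℚₚ.*-zeroˡ (c v))) (sumFin-0 {m})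

count≡0⇒none : (p : Fin m → Bool) → count p ≡ 0 → ∀ i → p i ≡ false
count≡0⇒none p eq i = ≢true⇒≡false λ pi → ℕₚ.1+n≰n (ℕₚ.≤-trans (count-≥1 p i pi) (ℕₚ.≤-reflexive eq))

count≥1⇒∃ : (p : Fin m → Bool) → 1 ≤ count p → ∃ λ i → p i ≡ true
count≥1⇒∃ {m} p 1≤ with Finₚ.any? (λ i → p i Boolₚ.≟ true)
... | yes found = found
... | no none = contradiction (ℕₚ.≤-trans 1≤ (ℕₚ.≤-reflexive
  (trans (sumℕ-cong λ i → cong toℕᵇ (≢true⇒≡false λ pi → none (i , pi))) (sumℕ-0 {m})))) λ ()

count≡1⇒unique : (p : Fin m → Bool) → count p ≡ 1 → ∃ λ i → p i ≡ true × (∀ j → p j ≡ true → j ≡ i)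
count≡1⇒unique p eq with count≥1⇒∃ p (ℕₚ.≤-reflexive (sym eq))
... | i , pi = i , pi , only
  where
  rest : count (remove p i) ≡ 0
  rest = ℕₚ.suc-injective (trans (sym (count-remove p i pi)) eq)
  only : ∀ j → p j ≡ true → j ≡ i
  only j pj with j ≟ i
  ... | yes j≡i = j≡i
  ... | no j≢i = contradiction (trans (sym (remove⁺ p pj j≢i)) (count≡0⇒none (remove p i) rest j)) λ ()

size≡0⇒none : (R : Digraph m) → size R ≡ 0 → ∀ t h → R t h ≡ false
size≡0⇒none R eq t = count≡0⇒none (R t) (ℕₚ.n≤0⇒n≡0 (ℕₚ.≤-trans (sumℕ-≥term (count ∘ R) t) (ℕₚ.≤-reflexive eq)))

outdegree indegree degree : Digraph m → Fin m → ℕ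
outdegree R v = count (R v)
indegree R v  = count (λ t → R t v)
degree R v    = outdegree R v + indegree R v

size≡Σindegree : (R : Digraph m) → size R ≡ sumℕ (indegree R)
size≡Σindegree R = sumℕ-comm (λ t h → toℕᵇ (R t h))

Inside : Digraph m → (Fin m → Bool) → Set
Inside R U = ∀ t h → R t h ≡ true → U t ≡ true × U h ≡ true

-- Double counting: if all vertices of `U` had degree at least 2, the degrees would sum to at least
-- twice `count U`, but they sum to twice `size R`.
low-degree : (R : Digraph m) (U : Fin m → Bool) → size R < count U → ∃ λ v → U v ≡ true × degree R v ≤ 1
low-degree R U size<count with Finₚ.any? (λ v → (U v Boolₚ.≟ true) ×-dec (degree R v ℕₚ.≤? 1))
... | yes found = found
... | no none = contradiction (ℕₚ.≤-trans doubled (ℕₚ.≤-reflexive total)) (ℕₚ.<⇒≱ (ℕₚ.+-mono-< size<count size<count))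
  where
  term : ∀ v → toℕᵇ (U v) + toℕᵇ (U v) ≤ degree R v
  term v with U v in Uv
  ... | false = z≤n
  ... | true  = ℕₚ.≰⇒> (λ le → none (v , Uv , le))
  doubled : count U + count U ≤ sumℕ (degree R)
  doubled = ℕₚ.≤-trans (ℕₚ.≤-reflexive (sym (sumℕ-+ (toℕᵇ ∘ U) (toℕᵇ ∘ U)))) (sumℕ-mono term)
  total : sumℕ (degree R) ≡ size R + size R
  total = trans (sumℕ-+ (outdegree R) (indegree R)) (cong (size R +_) (sym (size≡Σindegree R)))

-- An arrow inside `U` either survives the removal or has an end at `v`. The relation is only an
-- inequality because a loop at `v` enters the degree twice.
size-remove : (R : Digraph m) (U : Fin m → Bool) → Inside R U → ∀ v → size R ≤ size (within R (remove U v)) + degree R v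
size-remove {m} R U inside v = begin
  size R
    ≤⟨ sumℕ-mono (λ t → sumℕ-mono (term t)) ⟩
  sumℕ (λ t → sumℕ (λ h → a t h + (b t h + c t h)))
    ≡⟨ sumℕ-cong (λ t → trans (sumℕ-+ (a t) (λ h → b t h + c t h)) (cong (sumℕ (a t) +_) (sumℕ-+ (b t) (c t)))) ⟩
  sumℕ (λ t → sumℕ (a t) + (sumℕ (b t) + sumℕ (c t)))
    ≡⟨ trans (sumℕ-+ (sumℕ ∘ a) (λ t → sumℕ (b t) + sumℕ (c t))) (cong (sumℕ (sumℕ ∘ a) +_) (sumℕ-+ (sumℕ ∘ b) (sumℕ ∘ c))) ⟩
  sumℕ (sumℕ ∘ a) + (sumℕ (sumℕ ∘ b) + sumℕ (sumℕ ∘ c))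
    ≡⟨ cong (sumℕ (sumℕ ∘ a) +_) (cong₂ _+_
         (trans (sumℕ-comm b) (sumℕ-cong λ h → sumℕ-ind v (λ t → toℕᵇ (R t h))))
         (sumℕ-cong λ t → sumℕ-ind v (λ h → toℕᵇ (R t h)))) ⟩
  size (within R (remove U v)) + degree R v ∎
  where
  open ℕₚ.≤-Reasoning
  a b c : Fin m → Fin m → ℕ
  a t h = toℕᵇ (within R (remove U v) t h)
  b t h = toℕᵇ ⌊ t ≟ v ⌋ * toℕᵇ (R t h)
  c t h = toℕᵇ ⌊ h ≟ v ⌋ * toℕᵇ (R t h)
  term : ∀ t h → toℕᵇ (R t h) ≤ a t h + (b t h + c t h)
  term t h with R t h in Rth
  ... | false = z≤n
  ... | true with inside t h Rth
  ...   | Ut , Uh rewrite Ut | Uh with t ≟ v | h ≟ v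
  ...     | yes _ | _     = s≤s z≤n
  ...     | no _  | yes _ = s≤s z≤n
  ...     | no _  | no _  = s≤s z≤n

record Leaf (R : Digraph m) (v : Fin m) : Set where
  field
    tail head : Fin m
    edge      : R tail head ≡ true
    distinct  : tail ≢ head
    end       : tail ≡ v ⊎ head ≡ v
    only      : ∀ t h → R t h ≡ true → t ≡ v ⊎ h ≡ v → t ≡ tail × h ≡ head

-- A loop at `v` would add to both the outdegree and the indegree, so degree 1 also makes the two
-- ends of the arrow distinct.
leaf : (R : Digraph m) (v : Fin m) → degree R v ≡ 1 → Leaf R v
leaf R v deg≡1 with outdegree R v in out | indegree R v in in′
leaf R v refl | 1 | 0 with count≡1⇒unique (R v) out
... | u , Rvu , only = record
  { tail = v ; head = u ; edge = Rvu ; end = inj₁ refl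
  ; distinct = λ { refl → no-in v Rvu }
  ; only = λ { t h Rth (inj₁ refl) → refl , only h Rth ; t h Rth (inj₂ refl) → ⊥-elim (no-in t Rth) } }
  where
  no-in : ∀ t → R t v ≡ true → ⊥
  no-in t Rtv = contradiction (trans (sym Rtv) (count≡0⇒none (λ t → R t v) in′ t)) λ ()
leaf R v refl | 0 | 1 with count≡1⇒unique (λ t → R t v) in′
... | u , Ruv , only = record
  { tail = u ; head = v ; edge = Ruv ; end = inj₂ refl
  ; distinct = λ { refl → no-out v Ruv }
  ; only = λ { t h Rth (inj₂ refl) → only t Rth , refl ; t h Rth (inj₁ refl) → ⊥-elim (no-out h Rth) } }
  where
  no-out : ∀ h → R v h ≡ true → ⊥
  no-out h Rvh = contradiction (trans (sym Rvh) (count≡0⇒none (R v) out h)) λ ()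

-- If `R` is a tree on `U` and the charges sum to 1, removing an arrow splits `U` in two, and
-- summing `balance` over the side of its head shows that the weight of the arrow is the total
-- charge of that side. Hence `positive` and `below-1` for positive charges.
record UnitFlow (R : Digraph m) (U : Fin m → Bool) (c : Fin m → ℚ) : Set where
  field
    weight    : Weight m
    supported : Supported R weight
    positive  : ∀ t h → R t h ≡ true → 0ℚ ℚ.< weight t h
    below-1   : ∀ t h → R t h ≡ true → weight t h ℚ.< 1ℚ
    balance   : ∀ w → U w ≡ true → net weight w ≡ inflow (indicator R) w ℚ.- 1ℚ ℚ.+ c w

-- Removing the leaf v moves its charge c v to its neighbour.
module Extend (R : Digraph m) (U : Fin m → Bool) (inside : Inside R U) (v : Fin m) (Uv : U v ≡ true) (lf : Leaf R v)
              (c : Fin m → ℚ) (0<cv : 0ℚ ℚ.< c v) (cv<1 : c v ℚ.< 1ℚ) where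
  open Leaf lf

  U′ : Fin m → Bool
  U′ = remove U v

  R′ : Digraph m
  R′ = within R U′

  other : Fin m
  other with end
  ... | inj₁ _ = head
  ... | inj₂ _ = tail

  moved : Fin m → ℚ
  moved w = c w ℚ.+ c v ℚ.* ind w other

  -- Forced by the balance at the leaf: as a tail it has indegree 0 and -ρ = -1 + c v, as a head it
  -- has indegree 1 and ρ = 1 - 1 + c v.
  ρ : ℚ
  ρ with end
  ... | inj₁ _ = 1ℚ ℚ.- c v
  ... | inj₂ _ = c v

  0<ρ : 0ℚ ℚ.< ρ
  0<ρ with end
  ... | inj₁ _ = ≡-<-trans (sym (ℚₚ.+-inverseʳ (c v))) (ℚₚ.+-monoˡ-< (ℚ.- c v) cv<1)
  ... | inj₂ _ = 0<cv

  ρ<1 : ρ ℚ.< 1ℚ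
  ρ<1 with end
  ... | inj₁ _ = ℚₚ.<-≤-trans (ℚₚ.+-monoʳ-< 1ℚ (ℚₚ.neg-antimono-< 0<cv)) (ℚₚ.≤-reflexive (ℚₚ.+-identityʳ 1ℚ))
  ... | inj₂ _ = cv<1

  U′-other : U′ other ≡ true
  U′-other with end
  ... | inj₁ refl = remove⁺ U (proj₂ (inside tail head edge)) (distinct ∘ sym)
  ... | inj₂ refl = remove⁺ U (proj₁ (inside tail head edge)) distinct

  R′-avoids : ∀ t h → R′ t h ≡ true → t ≢ v × h ≢ v
  R′-avoids t h eq with within⁻ R U′ {t} {h} eq
  ... | _ , U′t , U′h = proj₂ (remove⁻ U U′t) , proj₂ (remove⁻ U U′h)

  R-split : ∀ t h → R t h ≡ true → R′ t h ≡ true ⊎ (t ≡ tail × h ≡ head)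
  R-split t h Rth = split (t ≟ v) (h ≟ v)
    where
    split : Dec (t ≡ v) → Dec (h ≡ v) → R′ t h ≡ true ⊎ (t ≡ tail × h ≡ head)
    split (yes t≡v) _         = inj₂ (only t h Rth (inj₁ t≡v))
    split (no _)    (yes h≡v) = inj₂ (only t h Rth (inj₂ h≡v))
    split (no t≢v)  (no h≢v)  = inj₁ (within⁺ R U′ Rth (remove⁺ U (proj₁ (inside t h Rth)) t≢v) (remove⁺ U (proj₂ (inside t h Rth)) h≢v))

  R′-leaf : ∀ {t h} → t ≡ tail × h ≡ head → R′ t h ≡ false
  R′-leaf {t} {h} (refl , refl) = ≢true⇒≡false λ eq → avoid (R′-avoids t h eq) end
    where
    avoid : tail ≢ v × head ≢ v → tail ≡ v ⊎ head ≡ v → ⊥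
    avoid (t≢v , h≢v) (inj₁ t≡v) = t≢v t≡v
    avoid (t≢v , h≢v) (inj₂ h≡v) = h≢v h≡v

  unit-leaf : ∀ {t h} → t ≡ tail × h ≡ head → unit tail head t h ≡ 1ℚ
  unit-leaf (refl , refl) = unit-diag tail head

  indicator-split : ∀ t h → indicator R t h ≡ indicator R′ t h ℚ.+ 1ℚ ℚ.* unit tail head t h
  indicator-split t h with R t h in Rth
  ... | true with R-split t h Rth
  ...   | inj₁ R′th = trans (cong (1ℚ ℚ.+_) (sym (cong (1ℚ ℚ.*_) (unit-≢ λ eq → contradiction (trans (sym R′th) (R′-leaf eq)) λ ()))))
                            (cong (λ b → toℚᵇ b ℚ.+ 1ℚ ℚ.* unit tail head t h) (trans (sym R′th) (cong (_∧ (U′ t ∧ U′ h)) Rth)))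
  ...   | inj₂ eq = cong₂ (λ b x → toℚᵇ b ℚ.+ 1ℚ ℚ.* x) (trans (sym (R′-leaf eq)) (cong (_∧ (U′ t ∧ U′ h)) Rth)) (sym (unit-leaf eq))
  indicator-split t h | false = cong (λ x → 0ℚ ℚ.+ 1ℚ ℚ.* x) (sym (unit-supported R edge t h Rth))

  indicator-inflow : ∀ w → inflow (indicator R) w ≡ inflow (indicator R′) w ℚ.+ ind w head
  indicator-inflow w = begin
    inflow (indicator R) w
      ≡⟨ inflow-cong indicator-split w ⟩
    inflow (λ t h → indicator R′ t h ℚ.+ 1ℚ ℚ.* unit tail head t h) w
      ≡⟨ trans (sumFin-+ (λ t → indicator R′ t w) (λ t → 1ℚ ℚ.* unit tail head t w))
               (cong (inflow (indicator R′) w ℚ.+_) (sumFin-* 1ℚ (λ t → unit tail head t w))) ⟩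
    inflow (indicator R′) w ℚ.+ 1ℚ ℚ.* inflow (unit tail head) w
      ≡⟨ cong (inflow (indicator R′) w ℚ.+_) (trans (ℚₚ.*-identityˡ (inflow (unit tail head) w)) (inflow-unit tail head w)) ⟩
    inflow (indicator R′) w ℚ.+ ind w head ∎
    where open ≡-Reasoning

  inflow-at-v : {g : Weight m} → Supported R′ g → inflow g v ≡ 0ℚ
  inflow-at-v supp = trans (sumFin-cong λ t → supp t v (≢true⇒≡false λ eq → proj₂ (R′-avoids t v eq) refl)) (sumFin-0 {m})

  outflow-at-v : {g : Weight m} → Supported R′ g → outflow g v ≡ 0ℚ
  outflow-at-v supp = trans (sumFin-cong λ h → supp v h (≢true⇒≡false λ eq → proj₁ (R′-avoids v h eq) refl)) (sumFin-0 {m})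

  correction : ∀ w → w ≢ v → moved w ℚ.+ ρ ℚ.* (ind w head ℚ.- ind w tail) ≡ ind w head ℚ.+ c w
  correction w w≢v with end
  ... | inj₁ refl = trans (cong (λ x → moved′ ℚ.+ (1ℚ ℚ.- c v) ℚ.* (ind w head ℚ.- x)) (ind-≢ w≢v)) (ring₁ (c w) (c v) (ind w head))
    where
    moved′ = c w ℚ.+ c v ℚ.* ind w head
    ring₁ : ∀ x y z → x ℚ.+ y ℚ.* z ℚ.+ (1ℚ ℚ.- y) ℚ.* (z ℚ.- 0ℚ) ≡ z ℚ.+ x
    ring₁ = solve-∀ ℚ-ring
  ... | inj₂ refl = trans (cong (λ x → moved′ ℚ.+ c v ℚ.* (x ℚ.- ind w tail)) (ind-≢ w≢v))
                          (trans (ring₂ (c w) (c v) (ind w tail)) (cong (ℚ._+ c w) (sym (ind-≢ w≢v))))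
    where
    moved′ = c w ℚ.+ c v ℚ.* ind w tail
    ring₂ : ∀ x y z → x ℚ.+ y ℚ.* z ℚ.+ y ℚ.* (0ℚ ℚ.- z) ≡ 0ℚ ℚ.+ x
    ring₂ = solve-∀ ℚ-ring

  correction-v : ρ ℚ.* (ind v head ℚ.- ind v tail) ≡ ind v head ℚ.- 1ℚ ℚ.+ c v
  correction-v with end
  ... | inj₁ refl = trans (cong₂ (λ x y → (1ℚ ℚ.- c v) ℚ.* (x ℚ.- y)) (ind-≢ distinct) (ind-refl v))
                          (trans (ring₁ (c v)) (cong (λ x → x ℚ.- 1ℚ ℚ.+ c v) (sym (ind-≢ distinct))))
    where
    ring₁ : ∀ x → (1ℚ ℚ.- x) ℚ.* (0ℚ ℚ.- 1ℚ) ≡ 0ℚ ℚ.- 1ℚ ℚ.+ x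
    ring₁ = solve-∀ ℚ-ring
  ... | inj₂ refl = trans (cong₂ (λ x y → c v ℚ.* (x ℚ.- y)) (ind-refl v) (ind-≢ (distinct ∘ sym)))
                          (trans (ring₂ (c v)) (cong (λ x → x ℚ.- 1ℚ ℚ.+ c v) (sym (ind-refl v))))
    where
    ring₂ : ∀ x → x ℚ.* (1ℚ ℚ.- 0ℚ) ≡ 1ℚ ℚ.- 1ℚ ℚ.+ x
    ring₂ = solve-∀ ℚ-ring

  extend : UnitFlow R′ U′ moved → UnitFlow R U c
  extend flow = record { weight = g ; supported = supp ; positive = pos ; below-1 = below ; balance = bal }
    where
    open UnitFlow flow renaming (weight to g′; supported to supp′; positive to pos′; below-1 to below′; balance to bal′)
    g : Weight m
    g t h = g′ t h ℚ.+ ρ ℚ.* unit tail head t h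
    on-R′ : ∀ {t h} → R′ t h ≡ true → g t h ≡ g′ t h
    on-R′ {t} {h} eq = trans (cong (λ x → g′ t h ℚ.+ ρ ℚ.* x) (unit-≢ λ p → contradiction (trans (sym eq) (R′-leaf p)) λ ()))
      (trans (cong (g′ t h ℚ.+_) (ℚₚ.*-zeroʳ ρ)) (ℚₚ.+-identityʳ (g′ t h)))
    on-leaf : ∀ {t h} → t ≡ tail × h ≡ head → g t h ≡ ρ
    on-leaf {t} {h} p = trans (cong₂ (λ x y → x ℚ.+ ρ ℚ.* y) (supp′ t h (R′-leaf p)) (unit-leaf p))
      (trans (ℚₚ.+-identityˡ (ρ ℚ.* 1ℚ)) (ℚₚ.*-identityʳ ρ))
    supp : Supported R g
    supp t h eq = trans (cong₂ (λ x y → x ℚ.+ ρ ℚ.* y) (supp′ t h (cong (_∧ (U′ t ∧ U′ h)) eq)) (unit-supported R edge t h eq))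
      (trans (ℚₚ.+-identityˡ (ρ ℚ.* 0ℚ)) (ℚₚ.*-zeroʳ ρ))
    pos : ∀ t h → R t h ≡ true → 0ℚ ℚ.< g t h
    pos t h Rth with R-split t h Rth
    ... | inj₁ eq = subst (0ℚ ℚ.<_) (sym (on-R′ eq)) (pos′ t h eq)
    ... | inj₂ p  = subst (0ℚ ℚ.<_) (sym (on-leaf p)) 0<ρ
    below : ∀ t h → R t h ≡ true → g t h ℚ.< 1ℚ
    below t h Rth with R-split t h Rth
    ... | inj₁ eq = ≡-<-trans (on-R′ eq) (below′ t h eq)
    ... | inj₂ p  = ≡-<-trans (on-leaf p) ρ<1
    net-g : ∀ w → net g w ≡ net g′ w ℚ.+ ρ ℚ.* (ind w head ℚ.- ind w tail)
    net-g w = trans (net-+* g′ ρ (unit tail head) w) (cong (λ x → net g′ w ℚ.+ ρ ℚ.* x) (net-unit tail head w))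
    bal : ∀ w → U w ≡ true → net g w ≡ inflow (indicator R) w ℚ.- 1ℚ ℚ.+ c w
    bal w Uw with w ≟ v
    ... | no w≢v = begin
      net g w
        ≡⟨ net-g w ⟩
      net g′ w ℚ.+ ρ ℚ.* (ind w head ℚ.- ind w tail)
        ≡⟨ cong (ℚ._+ ρ ℚ.* (ind w head ℚ.- ind w tail)) (bal′ w (remove⁺ U Uw w≢v)) ⟩
      inflow (indicator R′) w ℚ.- 1ℚ ℚ.+ moved w ℚ.+ ρ ℚ.* (ind w head ℚ.- ind w tail)
        ≡⟨ ℚₚ.+-assoc (inflow (indicator R′) w ℚ.- 1ℚ) (moved w) (ρ ℚ.* (ind w head ℚ.- ind w tail)) ⟩
      inflow (indicator R′) w ℚ.- 1ℚ ℚ.+ (moved w ℚ.+ ρ ℚ.* (ind w head ℚ.- ind w tail))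
        ≡⟨ cong (inflow (indicator R′) w ℚ.- 1ℚ ℚ.+_) (correction w w≢v) ⟩
      inflow (indicator R′) w ℚ.- 1ℚ ℚ.+ (ind w head ℚ.+ c w)
        ≡⟨ regroup (inflow (indicator R′) w) (ind w head) (c w) ⟩
      inflow (indicator R′) w ℚ.+ ind w head ℚ.- 1ℚ ℚ.+ c w
        ≡⟨ cong (λ x → x ℚ.- 1ℚ ℚ.+ c w) (sym (indicator-inflow w)) ⟩
      inflow (indicator R) w ℚ.- 1ℚ ℚ.+ c w ∎
      where
      open ≡-Reasoning
      regroup : ∀ x y z → x ℚ.- 1ℚ ℚ.+ (y ℚ.+ z) ≡ x ℚ.+ y ℚ.- 1ℚ ℚ.+ z
      regroup = solve-∀ ℚ-ring
    ... | yes refl = begin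
      net g v
        ≡⟨ net-g v ⟩
      net g′ v ℚ.+ ρ ℚ.* (ind v head ℚ.- ind v tail)
        ≡⟨ cong₂ ℚ._+_ (cong₂ ℚ._-_ (inflow-at-v {g′} supp′) (outflow-at-v {g′} supp′)) correction-v ⟩
      0ℚ ℚ.- 0ℚ ℚ.+ (ind v head ℚ.- 1ℚ ℚ.+ c v)
        ≡⟨ regroup (ind v head) (c v) ⟩
      0ℚ ℚ.+ ind v head ℚ.- 1ℚ ℚ.+ c v
        ≡⟨ cong (λ x → x ℚ.+ ind v head ℚ.- 1ℚ ℚ.+ c v) (sym (inflow-at-v {indicator R′} λ t h eq → cong toℚᵇ eq)) ⟩
      inflow (indicator R′) v ℚ.+ ind v head ℚ.- 1ℚ ℚ.+ c v
        ≡⟨ cong (λ x → x ℚ.- 1ℚ ℚ.+ c v) (sym (indicator-inflow v)) ⟩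
      inflow (indicator R) v ℚ.- 1ℚ ℚ.+ c v ∎
      where
      open ≡-Reasoning
      regroup : ∀ x y → 0ℚ ℚ.- 0ℚ ℚ.+ (x ℚ.- 1ℚ ℚ.+ y) ≡ 0ℚ ℚ.+ x ℚ.- 1ℚ ℚ.+ y
      regroup = solve-∀ ℚ-ring

  moved-sum : sumOver U c ≡ 1ℚ → sumOver U′ moved ≡ 1ℚ
  moved-sum Σc≡1 = begin
    sumFin (λ w → toℚᵇ (U′ w) ℚ.* (c w ℚ.+ c v ℚ.* ind w other))
      ≡⟨ sumFin-cong (λ w → expand (toℚᵇ (U′ w)) (c w) (c v) (ind w other)) ⟩
    sumFin (λ w → toℚᵇ (U′ w) ℚ.* c w ℚ.+ c v ℚ.* (ind w other ℚ.* toℚᵇ (U′ w)))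
      ≡⟨ trans (sumFin-+ (λ w → toℚᵇ (U′ w) ℚ.* c w) (λ w → c v ℚ.* (ind w other ℚ.* toℚᵇ (U′ w))))
           (cong (sumOver U′ c ℚ.+_) (trans (sumFin-* (c v) (λ w → ind w other ℚ.* toℚᵇ (U′ w)))
             (cong (c v ℚ.*_) (trans (sumFin-ind other (toℚᵇ ∘ U′)) (cong toℚᵇ U′-other))))) ⟩
    sumOver U′ c ℚ.+ c v ℚ.* 1ℚ
      ≡⟨ trans (cong (sumOver U′ c ℚ.+_) (ℚₚ.*-identityʳ (c v))) (ℚₚ.+-comm (sumOver U′ c) (c v)) ⟩
    c v ℚ.+ sumOver U′ c
      ≡⟨ trans (sym (sumOver-remove U c v Uv)) Σc≡1 ⟩
    1ℚ ∎
    where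
    open ≡-Reasoning
    expand : ∀ a x y z → a ℚ.* (x ℚ.+ y ℚ.* z) ≡ a ℚ.* x ℚ.+ y ℚ.* (z ℚ.* a)
    expand = solve-∀ ℚ-ring

ind-≥0 : (a b : Fin m) → 0ℚ ℚ.≤ ind a b
ind-≥0 a b with a ≟ b
... | yes _ = ℚₚ.nonNegative⁻¹ 1ℚ
... | no _  = ℚₚ.≤-refl

-- Induction by stripping a vertex of degree at most 1. Its degree cannot be 0: the remaining
-- `suc k` vertices would then span `suc k` arrows, against sparsity.
unitFlow : ∀ k (U : Fin m → Bool) (R : Digraph m) → Sparse R → Inside R U → size R ≡ k → count U ≡ suc k →
           (c : Fin m → ℚ) → (∀ v → 0ℚ ℚ.< c v) → sumOver U c ≡ 1ℚ → UnitFlow R U c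
unitFlow {m} zero U R sparse inside size≡ count≡ c 0<c Σc = record
  { weight = λ _ _ → 0ℚ ; supported = λ _ _ _ → refl
  ; positive = λ t h Rth → none t h Rth ; below-1 = λ t h Rth → none t h Rth
  ; balance = bal }
  where
  none : ∀ {P : Set} t h → R t h ≡ true → P
  none t h Rth = contradiction (trans (sym Rth) (size≡0⇒none R size≡ t h)) λ ()
  bal : ∀ w → U w ≡ true → net {m} (λ _ _ → 0ℚ) w ≡ inflow (indicator R) w ℚ.- 1ℚ ℚ.+ c w
  bal w Uw = sym (begin
    inflow (indicator R) w ℚ.- 1ℚ ℚ.+ c w
      ≡⟨ cong₂ (λ x y → x ℚ.- 1ℚ ℚ.+ y) (trans (sumFin-cong λ t → cong toℚᵇ (size≡0⇒none R size≡ t w)) (sumFin-0 {m})) c≡1 ⟩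
    0ℚ
      ≡⟨ sym (cong₂ ℚ._-_ (sumFin-0 {m}) (sumFin-0 {m})) ⟩
    net {m} (λ _ _ → 0ℚ) w ∎)
    where
    open ≡-Reasoning
    -- Here `U` consists of `w` alone, which carries the whole charge, so the prescribed net is 0 -
    -- 1 + 1.
    c≡1 : c w ≡ 1ℚ
    c≡1 = trans (sym (trans (cong (c w ℚ.+_) (sumOver-none (remove U w) c
            (count≡0⇒none (remove U w) (ℕₚ.suc-injective (trans (sym (count-remove U w Uw)) count≡))))) (ℚₚ.+-identityʳ (c w))))
          (trans (sym (sumOver-remove U c w Uw)) Σc)
unitFlow {m} (suc k) U R sparse inside size≡ count≡ c 0<c Σc
  with low-degree R U (ℕₚ.≤-reflexive (trans (cong suc size≡) (sym count≡)))
... | v , Uv , deg≤1 = extend (unitFlow k U′ R′ (Sparse-mono (λ t h → proj₁ ∘ within⁻ R U′) sparse) (λ t h → proj₂ ∘ within⁻ R U′)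
        (ℕₚ.≤-antisym size′≤k k≤size′) count′ moved (λ w → 0<moved w) (moved-sum Σc))
  where
  count′ : count (remove U v) ≡ suc k
  count′ = ℕₚ.suc-injective (trans (sym (count-remove U v Uv)) count≡)
  rest = count≥1⇒∃ (remove U v) (ℕₚ.≤-trans (s≤s z≤n) (ℕₚ.≤-reflexive (sym count′)))
  size′≤k : size (within R (remove U v)) ≤ k
  size′≤k = ℕₚ.≤-pred (ℕₚ.≤-trans (sparse (remove U v) (proj₁ rest) (proj₂ rest)) (ℕₚ.≤-reflexive count′))
  bound : suc k ≤ size (within R (remove U v)) + degree R v
  bound = ℕₚ.≤-trans (ℕₚ.≤-reflexive (sym size≡)) (size-remove R U inside v)
  k≤size′ : k ≤ size (within R (remove U v))
  k≤size′ = ℕₚ.≤-pred (ℕₚ.≤-trans bound (ℕₚ.≤-trans (ℕₚ.+-monoʳ-≤ _ deg≤1) (ℕₚ.≤-reflexive (ℕₚ.+-comm _ 1))))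
  1≤deg : 1 ≤ degree R v
  1≤deg = ℕₚ.+-cancelˡ-≤ k 1 (degree R v) (ℕₚ.≤-trans (ℕₚ.≤-reflexive (ℕₚ.+-comm k 1)) (ℕₚ.≤-trans bound (ℕₚ.+-monoˡ-≤ (degree R v) size′≤k)))
  -- At least one other vertex is left, and it has a positive share of the total charge 1.
  cv<1 : c v ℚ.< 1ℚ
  cv<1 = ≡-<-trans (sym (ℚₚ.+-identityʳ (c v))) (ℚₚ.<-≤-trans (ℚₚ.+-monoʳ-< (c v) 0<rest)
    (ℚₚ.≤-reflexive (trans (sym (sumOver-remove U c v Uv)) Σc)))
    where
    0<rest : 0ℚ ℚ.< sumOver (remove U v) c
    0<rest = ℚₚ.<-≤-trans (0<c (proj₁ rest)) (≡-≤-trans (sym (ℚₚ.+-identityʳ (c (proj₁ rest))))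
      (ℚₚ.≤-trans (ℚₚ.+-monoʳ-≤ (c (proj₁ rest)) (sumOver-≥0 (remove (remove U v) (proj₁ rest)) 0<c))
        (ℚₚ.≤-reflexive (sym (sumOver-remove (remove U v) c (proj₁ rest) (proj₂ rest))))))
  open Extend R U inside v Uv (leaf R v (ℕₚ.≤-antisym deg≤1 1≤deg)) c (0<c v) cv<1
  0<moved : ∀ w → 0ℚ ℚ.< moved w
  0<moved w = ≡-<-trans (sym (ℚₚ.+-identityʳ 0ℚ))
    (ℚₚ.+-mono-<-≤ {0ℚ} {c w} {0ℚ} {c v ℚ.* ind w other} (0<c w) (0≤* (c v) (ind w other) (ℚₚ.<⇒≤ (0<c v)) (ind-≥0 w other)))

ℕ⇒ℚ-≥0 : ∀ k → 0ℚ ℚ.≤ ℕ⇒ℚ k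
ℕ⇒ℚ-≥0 zero    = ℚₚ.≤-refl
ℕ⇒ℚ-≥0 (suc k) = 0≤+ 1ℚ (ℕ⇒ℚ k) (ℚₚ.nonNegative⁻¹ 1ℚ) (ℕ⇒ℚ-≥0 k)

ℕ⇒ℚ-mono : ∀ {j k} → j ≤ k → ℕ⇒ℚ j ℚ.≤ ℕ⇒ℚ k
ℕ⇒ℚ-mono {k = k} z≤n = ℕ⇒ℚ-≥0 k
ℕ⇒ℚ-mono (s≤s j≤k)   = ℚₚ.+-monoʳ-≤ 1ℚ (ℕ⇒ℚ-mono j≤k)

ℕ⇒ℚ-suc-inverse : ∀ k → ∃ λ r → ℕ⇒ℚ (suc k) ℚ.* r ≡ 1ℚ × 0ℚ ℚ.< r
ℕ⇒ℚ-suc-inverse k = positive-inverse {ℕ⇒ℚ (suc k)} (ℕ⇒ℚ-≥0 (suc k)) λ eq → ℚₚ.<⇒≢ (ℚₚ.positive⁻¹ 1ℚ)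
  (ℚₚ.≤-antisym (ℚₚ.nonNegative⁻¹ 1ℚ) (ℚₚ.≤-trans (≡-≤-trans (sym (ℚₚ.+-identityʳ 1ℚ)) (ℚₚ.+-monoʳ-≤ 1ℚ (ℕ⇒ℚ-≥0 k))) (ℚₚ.≤-reflexive eq)))

inflow-indicator : (R : Digraph m) → ∀ w → inflow (indicator R) w ≡ ℕ⇒ℚ (indegree R w)
inflow-indicator R w = sumFin-count (λ t → R t w)

outflow-indicator : (R : Digraph m) → ∀ w → outflow (indicator R) w ≡ ℕ⇒ℚ (outdegree R w)
outflow-indicator R w = sumFin-count (R w)

uniform-sum : (U : Fin m → Bool) (r : ℚ) → ℕ⇒ℚ (count U) ℚ.* r ≡ 1ℚ → sumOver U (λ _ → r) ≡ 1ℚ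
uniform-sum U r eq = trans (sumFin-*ʳ r (toℚᵇ ∘ U)) (trans (cong (ℚ._* r) (sumFin-count U)) eq)

net-outside : {R : Digraph m} {U : Fin m → Bool} → Inside R U → {g : Weight m} → Supported R g → ∀ w → U w ≢ true → net g w ≡ 0ℚ
net-outside {m} inside supp w ¬Uw = cong₂ ℚ._-_
  (trans (sumFin-cong λ t → supp t w (≢true⇒≡false λ Rtw → ¬Uw (proj₂ (inside t w Rtw)))) (sumFin-0 {m}))
  (trans (sumFin-cong λ h → supp w h (≢true⇒≡false λ Rwh → ¬Uw (proj₁ (inside w h Rwh)))) (sumFin-0 {m}))

-- Facets are determined by their indegrees or by their outdegrees

module Determined {n : ℕ} {E : EdgeRule n} (tri : IsTriangulationOfBoundary E) where
  open Geometry tri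

  private
    N = suc n

  -- Acyclicity follows from `isClique` by `clique-sparse`; together with `spanning` it makes `R` a
  -- tree on `U`. The set `U` varies because the two pieces of a cut facet live on different vertex
  -- sets.
  record SpanningForest (R : Digraph N) (U : Fin N → Bool) : Set where
    field
      isClique : Clique E R
      inside   : Inside R U
      spanning : suc (size R) ≡ count U

  module _ {R : Digraph N} {U : Fin N → Bool} (sf : SpanningForest R U) where
    open SpanningForest sf

    uniformFlow : ∀ {r} → 0ℚ ℚ.< r → ℕ⇒ℚ (count U) ℚ.* r ≡ 1ℚ → UnitFlow R U (λ _ → r)
    uniformFlow {r} 0<r r-inverse = unitFlow (size R) U R (clique-sparse tri isClique) inside refl (sym spanning) (λ _ → r) (λ _ → 0<r)
      (uniform-sum U r r-inverse)

    -- The complementary weights 1 − g depend on outdegrees where g depends on indegrees.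
    complement : ∀ {r} → UnitFlow R U (λ _ → r) → Weight N
    complement f t h = indicator R t h ℚ.+ ℚ.- 1ℚ ℚ.* UnitFlow.weight f t h

    complement-supported : ∀ {r} (f : UnitFlow R U (λ _ → r)) → Supported R (complement f)
    complement-supported f t h eq = cong₂ (λ b x → toℚᵇ b ℚ.+ ℚ.- 1ℚ ℚ.* x) eq (UnitFlow.supported f t h eq)

    complement-positive : ∀ {r} (f : UnitFlow R U (λ _ → r)) → ∀ t h → R t h ≡ true → 0ℚ ℚ.< complement f t h
    complement-positive f t h eq = subst (0ℚ ℚ.<_) (sym (trans (cong (λ b → toℚᵇ b ℚ.+ ℚ.- 1ℚ ℚ.* x) eq) (tidy x)))
      (≡-<-trans (sym (ℚₚ.+-inverseʳ x)) (ℚₚ.+-monoˡ-< (ℚ.- x) (UnitFlow.below-1 f t h eq)))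
      where
      x = UnitFlow.weight f t h
      tidy : ∀ x → 1ℚ ℚ.+ ℚ.- 1ℚ ℚ.* x ≡ 1ℚ ℚ.- x
      tidy = solve-∀ ℚ-ring

    complement-balance : ∀ {r} (f : UnitFlow R U (λ _ → r)) → ∀ w → U w ≡ true → net (complement f) w ≡ 1ℚ ℚ.- r ℚ.- outflow (indicator R) w
    complement-balance {r} f w Uw = trans (net-+* (indicator R) (ℚ.- 1ℚ) (UnitFlow.weight f) w)
      (trans (cong (λ x → net (indicator R) w ℚ.+ ℚ.- 1ℚ ℚ.* x) (UnitFlow.balance f w Uw))
             (tidy (inflow (indicator R) w) (outflow (indicator R) w) r))
      where
      tidy : ∀ i o r → i ℚ.- o ℚ.+ ℚ.- 1ℚ ℚ.* (i ℚ.- 1ℚ ℚ.+ r) ≡ 1ℚ ℚ.- r ℚ.- o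
      tidy = solve-∀ ℚ-ring

  positive⇒nonneg : {R : Digraph N} {g : Weight N} → Supported R g → (∀ t h → R t h ≡ true → 0ℚ ℚ.< g t h) → Nonneg g
  positive⇒nonneg {R} supp pos t h with R t h in Rth
  ... | true  = ℚₚ.<⇒≤ (pos t h Rth)
  ... | false = ℚₚ.≤-reflexive (sym (supp t h Rth))

  -- By `unique` the two weightings coincide, and as they are positive exactly on the arrows of `R`
  -- and of `R′`, they reveal the digraphs.
  same-support : {R R′ : Digraph N} → Clique E R → Clique E R′ → {g g′ : Weight N} → Supported R g → Supported R′ g′ →
    (∀ t h → R t h ≡ true → 0ℚ ℚ.< g t h) → (∀ t h → R′ t h ≡ true → 0ℚ ℚ.< g′ t h) →
    (∀ w → net g w ≡ net g′ w) → ∀ t h → R t h ≡ R′ t h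
  same-support {R} {R′} cl cl′ {g} {g′} supp supp′ pos pos′ nets t h with R t h in Rth | R′ t h in R′th
  ... | true  | true  = refl
  ... | false | false = refl
  ... | true  | false = contradiction (trans (sym (supp′ t h R′th)) (sym (unique cl cl′ (positive⇒nonneg {R} supp pos) (positive⇒nonneg {R′} supp′ pos′) supp supp′ nets t h)))
                          (ℚₚ.<⇒≢ (pos t h Rth))
  ... | false | true  = contradiction (trans (sym (supp t h Rth)) (unique cl cl′ (positive⇒nonneg {R} supp pos) (positive⇒nonneg {R′} supp′ pos′) supp supp′ nets t h))
                          (ℚₚ.<⇒≢ (pos′ t h R′th))

  module _ {R R′ : Digraph N} {U : Fin N → Bool} (sf : SpanningForest R U) (sf′ : SpanningForest R′ U) where
    private
      module P  = SpanningForest sf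
      module P′ = SpanningForest sf′
      scale : ∃ λ r → ℕ⇒ℚ (count U) ℚ.* r ≡ 1ℚ × 0ℚ ℚ.< r
      scale = subst (λ k → ∃ λ r → ℕ⇒ℚ k ℚ.* r ≡ 1ℚ × 0ℚ ℚ.< r) P.spanning (ℕ⇒ℚ-suc-inverse (size R))

      balanced : {g g′ : Weight N} → Supported R g → Supported R′ g′ → (∀ w → U w ≡ true → net g w ≡ net g′ w) → ∀ w → net g w ≡ net g′ w
      balanced {g} {g′} supp supp′ eq w with U w Boolₚ.≟ true
      ... | yes Uw = eq w Uw
      ... | no ¬Uw = trans (net-outside P.inside {g} supp w ¬Uw) (sym (net-outside P′.inside {g′} supp′ w ¬Uw))

    -- With the charge 1/`count U` at every vertex, the nets depend on the digraph only through its
    -- indegrees. Equal indegrees thus give positive weightings of one and the same vector.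
    determined-by-indegrees : (∀ w → U w ≡ true → indegree R w ≡ indegree R′ w) → ∀ t h → R t h ≡ R′ t h
    determined-by-indegrees eq with scale
    ... | r , r-inverse , 0<r = same-support P.isClique P′.isClique φ.supported φ′.supported φ.positive φ′.positive
      (balanced φ.supported φ′.supported λ w Uw → trans (φ.balance w Uw) (trans (cong (λ x → x ℚ.- 1ℚ ℚ.+ r)
        (trans (inflow-indicator R w) (trans (cong ℕ⇒ℚ (eq w Uw)) (sym (inflow-indicator R′ w))))) (sym (φ′.balance w Uw))))
      where
      module φ  = UnitFlow (uniformFlow sf 0<r r-inverse)
      module φ′ = UnitFlow (uniformFlow sf′ 0<r r-inverse)

    determined-by-outdegrees : (∀ w → U w ≡ true → outdegree R w ≡ outdegree R′ w) → ∀ t h → R t h ≡ R′ t h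
    determined-by-outdegrees eq with scale
    ... | r , r-inverse , 0<r = same-support P.isClique P′.isClique (complement-supported sf φ) (complement-supported sf′ φ′)
      (complement-positive sf φ) (complement-positive sf′ φ′)
      (balanced (complement-supported sf φ) (complement-supported sf′ φ′) λ w Uw → trans (complement-balance sf φ w Uw)
        (trans (cong (λ x → 1ℚ ℚ.- r ℚ.- x) (trans (outflow-indicator R w) (trans (cong ℕ⇒ℚ (eq w Uw)) (sym (outflow-indicator R′ w)))))
               (sym (complement-balance sf′ φ′ w Uw))))
      where
      φ  = uniformFlow sf 0<r r-inverse
      φ′ = uniformFlow sf′ 0<r r-inverse

-- Facets with prescribed indegrees

member-allArrows : ∀ {n} (t h : Fin (suc n)) → member (allArrows {n}) t h ≡ not ⌊ t ≟ h ⌋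
member-allArrows {n} t h = trans (cong (λ v → lookup v h) (Vecₚ.lookup∘tabulate (λ t → Vec.tabulate (λ h → not ⌊ t ≟ h ⌋)) t))
  (Vecₚ.lookup∘tabulate (λ h → not ⌊ t ≟ h ⌋) h)

-- The boundary point with coordinates proportional to y v − 1 + 1/(n+1): its carrier must have indegrees y,
-- because its arrows carry weight less than 1 each.
module Point {n : ℕ} (y : Fin (suc n) → ℕ) (Σy : sumℕ y ≡ n) (1≤n : 1 ≤ n)
             (r : ℚ) (r-inverse : ℕ⇒ℚ (suc n) ℚ.* r ≡ 1ℚ) (0<r : 0ℚ ℚ.< r) where

  private
    N = suc n

  1-r≥0 : 0ℚ ℚ.≤ 1ℚ ℚ.- r
  1-r≥0 = ≡-≤-trans (sym (ℚₚ.+-inverseʳ r)) (ℚₚ.+-monoˡ-≤ (ℚ.- r) r≤1)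
    where
    r≤1 : r ℚ.≤ 1ℚ
    r≤1 = ≡-≤-trans (sym (ℚₚ.+-identityʳ r)) (ℚₚ.≤-trans
      (ℚₚ.+-monoʳ-≤ r (0≤* (ℕ⇒ℚ n) r (ℕ⇒ℚ-≥0 n) (ℚₚ.<⇒≤ 0<r))) (ℚₚ.≤-reflexive (trans (collect r (ℕ⇒ℚ n)) r-inverse)))
      where
      collect : ∀ r x → r ℚ.+ x ℚ.* r ≡ (1ℚ ℚ.+ x) ℚ.* r
      collect = solve-∀ ℚ-ring

  -- `demand` and `supply` are the positive and the negative part of `charge`; the sign is decided
  -- by whether `y v` is zero, since 0 < r ≤ 1.
  supply demand charge : Fin N → ℚ
  supply v with y v
  ... | zero  = 1ℚ ℚ.- r
  ... | suc _ = 0ℚ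
  demand v with y v
  ... | zero  = 0ℚ
  ... | suc k = ℕ⇒ℚ k ℚ.+ r
  charge v = ℕ⇒ℚ (y v) ℚ.+ (r ℚ.- 1ℚ)

  -- The functional that supports the point: its value at an arrow is at most 1, and it is 1 exactly
  -- for arrows from a vertex with `y` zero to one with `y` positive, the only arrows used by `g`.
  level : Fin N → ℚ
  level v with y v
  ... | zero  = 0ℚ
  ... | suc _ = 1ℚ

  demand-supply : ∀ v → demand v ℚ.- supply v ≡ charge v
  demand-supply v with y v
  ... | zero  = ring₀ r
    where
    ring₀ : ∀ r → 0ℚ ℚ.- (1ℚ ℚ.- r) ≡ 0ℚ ℚ.+ (r ℚ.- 1ℚ)
    ring₀ = solve-∀ ℚ-ring
  ... | suc k = ring₁ (ℕ⇒ℚ k) r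
    where
    ring₁ : ∀ x r → x ℚ.+ r ℚ.- 0ℚ ≡ 1ℚ ℚ.+ x ℚ.+ (r ℚ.- 1ℚ)
    ring₁ = solve-∀ ℚ-ring

  supply≥0 : ∀ v → 0ℚ ℚ.≤ supply v
  supply≥0 v with y v
  ... | zero  = 1-r≥0
  ... | suc _ = ℚₚ.≤-refl

  demand≥0 : ∀ v → 0ℚ ℚ.≤ demand v
  demand≥0 v with y v
  ... | zero  = ℚₚ.≤-refl
  ... | suc k = 0≤+ (ℕ⇒ℚ k) r (ℕ⇒ℚ-≥0 k) (ℚₚ.<⇒≤ 0<r)

  Σconst : ∀ k (x : ℚ) → sumFin {k} (λ _ → x) ≡ ℕ⇒ℚ k ℚ.* x
  Σconst zero    x = sym (ℚₚ.*-zeroˡ x)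
  Σconst (suc k) x = trans (cong (x ℚ.+_) (Σconst k x)) (collect x (ℕ⇒ℚ k))
    where
    collect : ∀ r x → r ℚ.+ x ℚ.* r ≡ (1ℚ ℚ.+ x) ℚ.* r
    collect = solve-∀ ℚ-ring

  Σcharge : sumFin charge ≡ 0ℚ
  Σcharge = begin
    sumFin charge
      ≡⟨ sumFin-+ (ℕ⇒ℚ ∘ y) (λ _ → r ℚ.- 1ℚ) ⟩
    sumFin (ℕ⇒ℚ ∘ y) ℚ.+ sumFin {N} (λ _ → r ℚ.- 1ℚ)
      ≡⟨ cong₂ ℚ._+_ (trans (sumFin-ℕ⇒ℚ y) (cong ℕ⇒ℚ Σy)) (Σconst N (r ℚ.- 1ℚ)) ⟩
    ℕ⇒ℚ n ℚ.+ (1ℚ ℚ.+ ℕ⇒ℚ n) ℚ.* (r ℚ.- 1ℚ)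
      ≡⟨ expand (ℕ⇒ℚ n) r ⟩
    (1ℚ ℚ.+ ℕ⇒ℚ n) ℚ.* r ℚ.- 1ℚ
      ≡⟨ trans (cong (ℚ._- 1ℚ) r-inverse) (ℚₚ.+-inverseʳ 1ℚ) ⟩
    0ℚ ∎
    where
    open ≡-Reasoning
    expand : ∀ x r → x ℚ.+ (1ℚ ℚ.+ x) ℚ.* (r ℚ.- 1ℚ) ≡ (1ℚ ℚ.+ x) ℚ.* r ℚ.- 1ℚ
    expand = solve-∀ ℚ-ring

  s : ℚ
  s = sumFin demand

  Σsupply : sumFin supply ≡ s
  Σsupply = begin
    sumFin supply
      ≡⟨ cancel (sumFin supply) s ⟩
    s ℚ.- (s ℚ.- sumFin supply)
      ≡⟨ cong (λ x → s ℚ.- x) (trans (sym (sumFin-minus demand supply)) (trans (sumFin-cong demand-supply) Σcharge)) ⟩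
    s ℚ.- 0ℚ
      ≡⟨ ℚₚ.+-identityʳ s ⟩
    s ∎
    where
    open ≡-Reasoning
    cancel : ∀ a b → a ≡ b ℚ.- (b ℚ.- a)
    cancel = solve-∀ ℚ-ring

  has-head : ∃ λ v → 1 ≤ y v
  has-head with Finₚ.any? (λ v → 1 ℕₚ.≤? y v)
  ... | yes found = found
  ... | no none = contradiction (ℕₚ.≤-trans 1≤n (ℕₚ.≤-reflexive (trans (sym Σy)
    (trans (sumℕ-cong λ v → ℕₚ.n<1⇒n≡0 (ℕₚ.≰⇒> λ le → none (v , le))) (sumℕ-0 {N}))))) λ ()

  has-tail : ∃ λ v → y v ≡ 0
  has-tail with Finₚ.any? (λ v → y v ℕₚ.≟ 0)
  ... | yes found = found
  ... | no none = contradiction (ℕₚ.≤-trans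
    (ℕₚ.≤-trans (ℕₚ.≤-reflexive (sym (count-true {N}))) (sumℕ-mono λ v → ℕₚ.n≢0⇒n>0 λ eq → none (v , eq))) (ℕₚ.≤-reflexive Σy)) ℕₚ.1+n≰n

  s≢0 : s ≢ 0ℚ
  s≢0 s≡0 = ℚₚ.<⇒≢ (positive (proj₁ has-head) (proj₂ has-head)) (sym (sumFin-≡0 demand≥0 s≡0 (proj₁ has-head)))
    where
    positive : ∀ v → 1 ≤ y v → 0ℚ ℚ.< demand v
    positive v 1≤ with y v
    ... | suc k = ℚₚ.<-≤-trans 0<r (≡-≤-trans (sym (ℚₚ.+-identityˡ r)) (ℚₚ.+-monoˡ-≤ r (ℕ⇒ℚ-≥0 k)))

  module Scaled (q : ℚ) (q-inverse : s ℚ.* q ≡ 1ℚ) (0<q : 0ℚ ℚ.< q) where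

    -- A product transport plan: every tail serves every head in proportion to its demand. As both
    -- factors sum to 1, the inflows and outflows are the factors themselves.
    g : Weight N
    g t h = q ℚ.* supply t ℚ.* (q ℚ.* demand h)

    g≥0 : Nonneg g
    g≥0 t h = 0≤* (q ℚ.* supply t) (q ℚ.* demand h) (0≤* q (supply t) (ℚₚ.<⇒≤ 0<q) (supply≥0 t)) (0≤* q (demand h) (ℚₚ.<⇒≤ 0<q) (demand≥0 h))

    Σq : ∀ (φ : Fin N → ℚ) → sumFin φ ≡ s → sumFin (λ v → q ℚ.* φ v) ≡ 1ℚ
    Σq φ eq = trans (sumFin-* q φ) (trans (cong (q ℚ.*_) eq) (trans (ℚₚ.*-comm q s) q-inverse))

    inflow-g : ∀ w → inflow g w ≡ q ℚ.* demand w
    inflow-g w = trans (sumFin-*ʳ (q ℚ.* demand w) (λ t → q ℚ.* supply t))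
      (trans (cong (ℚ._* (q ℚ.* demand w)) (Σq supply Σsupply)) (ℚₚ.*-identityˡ (q ℚ.* demand w)))

    outflow-g : ∀ w → outflow g w ≡ q ℚ.* supply w
    outflow-g w = trans (sumFin-* (q ℚ.* supply w) (λ h → q ℚ.* demand h))
      (trans (cong (q ℚ.* supply w ℚ.*_) (Σq demand refl)) (ℚₚ.*-identityʳ (q ℚ.* supply w)))

    net-g : ∀ w → net g w ≡ q ℚ.* charge w
    net-g w = trans (cong₂ ℚ._-_ (inflow-g w) (outflow-g w)) (trans (factor q (demand w) (supply w)) (cong (q ℚ.*_) (demand-supply w)))
      where
      factor : ∀ q a b → q ℚ.* a ℚ.- q ℚ.* b ≡ q ℚ.* (a ℚ.- b)
      factor = solve-∀ ℚ-ring

    Σg : sumFin2 g ≡ 1ℚ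
    Σg = trans (total≡Σinflow g) (trans (sumFin-cong inflow-g) (Σq demand refl))

    g-diagonal : ∀ v → g v v ≡ 0ℚ
    g-diagonal v with y v
    ... | zero  = ring₀ q (1ℚ ℚ.- r)
      where
      ring₀ : ∀ q x → q ℚ.* x ℚ.* (q ℚ.* 0ℚ) ≡ 0ℚ
      ring₀ = solve-∀ ℚ-ring
    ... | suc k = ring₁ q (ℕ⇒ℚ k ℚ.+ r)
      where
      ring₁ : ∀ q x → q ℚ.* 0ℚ ℚ.* (q ℚ.* x) ≡ 0ℚ
      ring₁ = solve-∀ ℚ-ring

    inP : InP {n} (net g)
    inP = g , g≥0 , supp , Σg , λ k → sym (sumFin2-arrowVec g k)
      where
      supp : ∀ t h → member (allArrows {n}) t h ≡ false → g t h ≡ 0ℚ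
      supp t h eq = diagonal (≟-true⁻ (Boolₚ.¬-not λ neq → contradiction (trans (sym (trans (member-allArrows t h) (cong not neq))) eq) λ ()))
        where
        diagonal : t ≡ h → g t h ≡ 0ℚ
        diagonal refl = g-diagonal t

    level-gap : ∀ t h → g t h ℚ.* (level h ℚ.- level t) ≡ g t h
    level-gap t h with y t | y h
    ... | zero  | suc k = trans (cong (x ℚ.*_) (ℚₚ.+-identityʳ 1ℚ)) (ℚₚ.*-identityʳ x)
      where x = q ℚ.* (1ℚ ℚ.- r) ℚ.* (q ℚ.* (ℕ⇒ℚ k ℚ.+ r))
    ... | zero  | zero  = ring q (1ℚ ℚ.- r) (0ℚ ℚ.- 0ℚ)
      where
      ring : ∀ q x y → q ℚ.* x ℚ.* (q ℚ.* 0ℚ) ℚ.* y ≡ q ℚ.* x ℚ.* (q ℚ.* 0ℚ)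
      ring = solve-∀ ℚ-ring
    ... | suc j | zero  = ring q (0ℚ ℚ.- 1ℚ)
      where
      ring : ∀ q y → q ℚ.* 0ℚ ℚ.* (q ℚ.* 0ℚ) ℚ.* y ≡ q ℚ.* 0ℚ ℚ.* (q ℚ.* 0ℚ)
      ring = solve-∀ ℚ-ring
    ... | suc j | suc k = ring q (ℕ⇒ℚ k ℚ.+ r) (1ℚ ℚ.- 1ℚ)
      where
      ring : ∀ q x y → q ℚ.* 0ℚ ℚ.* (q ℚ.* x) ℚ.* y ≡ q ℚ.* 0ℚ ℚ.* (q ℚ.* x)
      ring = solve-∀ ℚ-ring

    dot-level : dot level (net g) ≡ 1ℚ
    dot-level = trans (dot-net level g) (trans (sumFin2-cong level-gap) Σg)

    level-gap≤1 : ∀ t h → level h ℚ.- level t ℚ.≤ 1ℚ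
    level-gap≤1 t h with y t | y h
    ... | zero  | zero  = ℚₚ.nonNegative⁻¹ 1ℚ
    ... | zero  | suc _ = ℚₚ.≤-refl
    ... | suc _ | zero  = ℚₚ.≤-trans (ℚₚ.nonPositive⁻¹ (ℚ.- 1ℚ)) (ℚₚ.nonNegative⁻¹ 1ℚ)
    ... | suc _ | suc _ = ℚₚ.nonNegative⁻¹ 1ℚ

    level-gap<1 : ∀ t h → 1 ≤ y t → y h ≡ 0 → t ≢ h × level h ℚ.- level t ℚ.< 1ℚ
    level-gap<1 t h 1≤yt yh≡0 = (λ { refl → contradiction (ℕₚ.≤-trans 1≤yt (ℕₚ.≤-reflexive yh≡0)) λ () }) , gap
      where
      gap : level h ℚ.- level t ℚ.< 1ℚ
      gap with y t | y h
      gap | suc _ | zero = ℚₚ.<-trans (ℚₚ.negative⁻¹ (ℚ.- 1ℚ)) (ℚₚ.positive⁻¹ 1ℚ)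

    inBoundary : InBoundary {n} (net g)
    inBoundary = inP , level ,
      (λ t h t≢h → ≡-≤-trans (dot-arrowVec level t h) (ℚₚ.≤-trans (level-gap≤1 t h) (ℚₚ.≤-reflexive (sym dot-level)))) ,
      -- An arrow from a vertex with `y` positive to one with `y` zero has level -1, so the
      -- supporting face is proper.
      proj₁ has-head , proj₁ has-tail , proj₁ strict ,
      ≡-<-trans (dot-arrowVec level (proj₁ has-head) (proj₁ has-tail)) (ℚₚ.<-≤-trans (proj₂ strict) (ℚₚ.≤-reflexive (sym dot-level)))
      where
      strict = level-gap<1 (proj₁ has-head) (proj₁ has-tail) (proj₂ has-head) (proj₂ has-tail)

    s*x : ∀ v → s ℚ.* net g v ≡ charge v
    s*x v = trans (cong (s ℚ.*_) (net-g v)) (trans (sym (ℚₚ.*-assoc s q (charge v)))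
      (trans (cong (ℚ._* charge v) q-inverse) (ℚₚ.*-identityˡ (charge v))))

  boundary-point : ∃ λ x → InBoundary {n} x × ∃ λ s → 0ℚ ℚ.≤ s × (∀ v → s ℚ.* x v ≡ charge v)
  boundary-point with positive-inverse (sumFin-≥0 demand≥0) s≢0
  ... | q , q-inverse , 0<q = net g , inBoundary , s , sumFin-≥0 demand≥0 , s*x
    where open Scaled q q-inverse 0<q

module _ {n : ℕ} {E : EdgeRule n} (tri : IsTriangulationOfBoundary E) where
  open Geometry tri

  private
    N = suc n

  size≤n : {R : Digraph N} → Clique E R → size R ≤ n
  size≤n {R} cl = ℕₚ.≤-pred (ℕₚ.≤-trans (s≤s (size-mono {R = R} λ t h Rth → within⁺ R (λ _ → true) Rth refl refl))
    (ℕₚ.≤-trans (clique-sparse tri cl (λ _ → true) zero refl) (ℕₚ.≤-reflexive (count-true {N}))))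

  module _ (1≤n : 1 ≤ n) (y : Fin N → ℕ) (Σy : sumℕ y ≡ n) where

    indegrees-of-carrier : (r : ℚ) → 0ℚ ℚ.< r → {R : Digraph N} → Clique E R → (μ : Weight N) → Nonneg μ → Supported R μ →
      (∀ w → net μ w ≡ ℕ⇒ℚ (y w) ℚ.+ (r ℚ.- 1ℚ)) → ∀ v → y v ≤ indegree R v
    indegrees-of-carrier r 0<r {R} cl μ 0≤μ supp nets v = bound (y v) refl
      where
      -- A vertex with inflow 0 has outflow 1 - y t - r, so no arrow can carry more than 1.
      outflow≤1 : ∀ t → outflow μ t ℚ.≤ 1ℚ
      outflow≤1 t with inflow≡0⊎outflow≡0 cl {μ} supp t
      ... | inj₂ o≡0 = ≡-≤-trans o≡0 (ℚₚ.nonNegative⁻¹ 1ℚ)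
      ... | inj₁ i≡0 = ≡-≤-trans (trans (rewrite-out (outflow μ t)) (cong (ℚ.-_) (trans (cong (ℚ._- outflow μ t) (sym i≡0)) (nets t))))
        (ℚₚ.≤-trans (ℚₚ.≤-reflexive (tidy (ℕ⇒ℚ (y t)) r))
          (ℚₚ.≤-trans (ℚₚ.+-monoʳ-≤ 1ℚ (ℚₚ.neg-antimono-≤ (0≤+ (ℕ⇒ℚ (y t)) r (ℕ⇒ℚ-≥0 (y t)) (ℚₚ.<⇒≤ 0<r)))) (ℚₚ.≤-reflexive (ℚₚ.+-identityʳ 1ℚ))))
        where
        rewrite-out : ∀ o → o ≡ ℚ.- (0ℚ ℚ.- o)
        rewrite-out = solve-∀ ℚ-ring
        tidy : ∀ x r → ℚ.- (x ℚ.+ (r ℚ.- 1ℚ)) ≡ 1ℚ ℚ.+ ℚ.- (x ℚ.+ r)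
        tidy = solve-∀ ℚ-ring
      μ≤ : ∀ t → μ t v ℚ.≤ toℚᵇ (R t v)
      μ≤ t with R t v in Rtv
      ... | true  = ℚₚ.≤-trans (sumFin-≥term (0≤μ t) v) (outflow≤1 t)
      ... | false = ℚₚ.≤-reflexive (supp t v Rtv)
      inflow≤ : inflow μ v ℚ.≤ ℕ⇒ℚ (indegree R v)
      inflow≤ = ℚₚ.≤-trans (sumFin-mono μ≤) (ℚₚ.≤-reflexive (inflow-indicator R v))
      net≤ : net μ v ℚ.≤ inflow μ v
      net≤ = ℚₚ.≤-trans (ℚₚ.+-monoʳ-≤ (inflow μ v) (ℚₚ.neg-antimono-≤ (sumFin-≥0 (0≤μ v)))) (ℚₚ.≤-reflexive (ℚₚ.+-identityʳ (inflow μ v)))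
      bound : ∀ k → y v ≡ k → k ≤ indegree R v
      bound zero    eq = z≤n
      -- Integrality: the net at `v` is k + r with r > 0 and is at most the indegree, which
      -- therefore exceeds k.
      bound (suc k) eq = ℕₚ.≰⇒> λ le → ℚₚ.<-irrefl refl (ℚₚ.<-≤-trans small (ℚₚ.≤-trans net≤ (ℚₚ.≤-trans inflow≤ (ℕ⇒ℚ-mono le))))
        where
        small : ℕ⇒ℚ k ℚ.< net μ v
        small = ≡-<-trans (sym (ℚₚ.+-identityʳ (ℕ⇒ℚ k))) (ℚₚ.<-≤-trans (ℚₚ.+-monoʳ-< (ℕ⇒ℚ k) 0<r)
          (ℚₚ.≤-reflexive (trans (tidy (ℕ⇒ℚ k) r) (trans (cong (λ j → ℕ⇒ℚ j ℚ.+ (r ℚ.- 1ℚ)) (sym eq)) (sym (nets v))))))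
          where
          tidy : ∀ x r → x ℚ.+ r ≡ 1ℚ ℚ.+ x ℚ.+ (r ℚ.- 1ℚ)
          tidy = solve-∀ ℚ-ring

    FacetWithIndegrees : Set
    FacetWithIndegrees = Σ (ArrowSet n) λ S → IsFace E S × (∀ v → indegree (member S) v ≡ y v)

    carrier : (r : ℚ) → 0ℚ ℚ.< r → (x : Pt n) (s : ℚ) → 0ℚ ℚ.≤ s → (∀ v → s ℚ.* x v ≡ ℕ⇒ℚ (y v) ℚ.+ (r ℚ.- 1ℚ)) →
      (Σ (ArrowSet n) λ S → IsFace E S × InConv S x) → FacetWithIndegrees
    carrier r 0<r x s 0≤s s*x (S , face , weights , weights≥0 , supp , _ , point) = S , face , λ v → sym (sumℕ-≡⇒≡ y≤ Σindegree v)
      where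
      cl = IsFace⇒Clique S face
      y≤ : ∀ v → y v ≤ indegree (member S) v
      y≤ = indegrees-of-carrier r 0<r cl (λ t h → s ℚ.* weights t h) (λ t h → 0≤* s (weights t h) 0≤s (weights≥0 t h))
        (λ t h eq → trans (cong (s ℚ.*_) (supp t h eq)) (ℚₚ.*-zeroʳ s))
        (λ w → trans (net-* s weights w) (trans (cong (s ℚ.*_) (trans (sym (sumFin2-arrowVec weights w)) (sym (point w)))) (s*x w)))
      -- A face has at most n arrows while `y` sums to n, so none of the inequalities `y≤` can be
      -- strict.
      Σindegree : sumℕ (indegree (member S)) ≤ sumℕ y
      Σindegree = ℕₚ.≤-trans (ℕₚ.≤-reflexive (sym (size≡Σindegree (member S)))) (ℕₚ.≤-trans (size≤n cl) (ℕₚ.≤-reflexive (sym Σy)))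

    facet-with-indegrees : FacetWithIndegrees
    facet-with-indegrees = at-scale (ℕ⇒ℚ-suc-inverse n)
      where
      at-scale : (∃ λ r → ℕ⇒ℚ N ℚ.* r ≡ 1ℚ × 0ℚ ℚ.< r) → FacetWithIndegrees
      at-scale (r , r-inverse , 0<r) = at-point (Point.boundary-point y Σy 1≤n r r-inverse 0<r)
        where
        at-point : (∃ λ x → InBoundary {n} x × ∃ λ s → 0ℚ ℚ.≤ s × (∀ v → s ℚ.* x v ≡ ℕ⇒ℚ (y v) ℚ.+ (r ℚ.- 1ℚ))) → FacetWithIndegrees
        at-point (x , x∈∂P , s , 0≤s , s*x) = carrier r 0<r x s 0≤s s*x (proj₁ (proj₂ (proj₂ tri)) x x∈∂P)

-- Extremal vertices and order patterns of four vertices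

least : ∀ {m} {P : Fin m → Set} → (∀ i → Dec (P i)) → ∃ P → ∃ λ i → P i × (∀ j → P j → i Fin.≤ j)
least {suc m} P? (i , Pi) with P? zero
... | yes P0 = zero , P0 , λ _ _ → z≤n
least {suc m} P? (zero , Pi)  | no ¬P0 = contradiction Pi ¬P0
least {suc m} P? (suc i , Pi) | no ¬P0 with least (P? ∘ suc) (i , Pi)
... | k , Pk , min = suc k , Pk , λ { zero P0 → contradiction P0 ¬P0 ; (suc j) Pj → s≤s (min j Pj) }

greatest : ∀ {m} {P : Fin m → Set} → (∀ i → Dec (P i)) → ∃ P → ∃ λ i → P i × (∀ j → P j → j Fin.≤ i)
greatest {suc m} P? (i , Pi) with Finₚ.any? (P? ∘ suc)
... | yes found with greatest (P? ∘ suc) found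
...   | k , Pk , max = suc k , Pk , λ { zero _ → z≤n ; (suc j) Pj → s≤s (max j Pj) }
greatest {suc m} P? (zero , P0)  | no none = zero , P0 , λ { zero _ → z≤n ; (suc j) Pj → contradiction (j , Pj) none }
greatest {suc m} P? (suc i , Pi) | no none = contradiction (i , Pi) none

next : ∀ {m} {v w : Fin m} → v Fin.< w → ∃ λ (u : Fin m) → toℕ u ≡ suc (toℕ v)
next {v = v} {w} v<w = fromℕ< v+1<m , Finₚ.toℕ-fromℕ< v+1<m
  where v+1<m = ℕₚ.≤-<-trans v<w (Finₚ.toℕ<n w)

Increasing : ∀ {m} → (Fin 4 → Fin m) → Set
Increasing p = ∀ {a b} → a Fin.< b → p a Fin.< p b

quad-increasing : ∀ {m} {p₁ p₂ p₃ p₄ : Fin m} → p₁ Fin.< p₂ → p₂ Fin.< p₃ → p₃ Fin.< p₄ → Increasing (quad p₁ p₂ p₃ p₄)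
quad-increasing l₁ l₂ l₃ {zero}           {suc zero}             _ = l₁
quad-increasing l₁ l₂ l₃ {zero}           {suc (suc zero)}       _ = ℕₚ.<-trans l₁ l₂
quad-increasing l₁ l₂ l₃ {zero}           {suc (suc (suc zero))} _ = ℕₚ.<-trans l₁ (ℕₚ.<-trans l₂ l₃)
quad-increasing l₁ l₂ l₃ {suc zero}       {suc (suc zero)}       _ = l₂
quad-increasing l₁ l₂ l₃ {suc zero}       {suc (suc (suc zero))} _ = ℕₚ.<-trans l₂ l₃
quad-increasing l₁ l₂ l₃ {suc (suc zero)} {suc (suc (suc zero))} _ = l₃
quad-increasing l₁ l₂ l₃ {suc a}          {suc zero} (s≤s ())
quad-increasing l₁ l₂ l₃ {suc (suc a)}    {suc (suc zero)} (s≤s (s≤s ()))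
quad-increasing l₁ l₂ l₃ {suc (suc (suc a))} {suc (suc (suc zero))} (s≤s (s≤s (s≤s ())))

<⇒<ᵇ-true : ∀ {a b} → a < b → (a <ᵇ b) ≡ true
<⇒<ᵇ-true a<b = Equivalence.to Boolₚ.T-≡ (ℕₚ.<⇒<ᵇ a<b)

≮⇒<ᵇ-false : ∀ {a b} → ¬ a < b → (a <ᵇ b) ≡ false
≮⇒<ᵇ-false {a} {b} a≮b = ≢true⇒≡false λ eq → a≮b (ℕₚ.<ᵇ⇒< a b (Equivalence.from Boolₚ.T-≡ eq))

<ᵇ-true⇒< : ∀ {a b} → (a <ᵇ b) ≡ true → a < b
<ᵇ-true⇒< {a} {b} eq = ℕₚ.<ᵇ⇒< a b (Equivalence.from Boolₚ.T-≡ eq)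

increasing-pattern : ∀ {m} {p : Fin 4 → Fin m} → Increasing p → ∀ a b → (toℕ (p a) <ᵇ toℕ (p b)) ≡ (toℕ a <ᵇ toℕ b)
increasing-pattern {p = p} inc a b with ℕₚ.<-cmp (toℕ a) (toℕ b)
... | tri< a<b _ _ = trans (<⇒<ᵇ-true (inc a<b)) (sym (<⇒<ᵇ-true a<b))
... | tri> a≮b _ b<a = trans (≮⇒<ᵇ-false (ℕₚ.<-asym (inc b<a))) (sym (≮⇒<ᵇ-false a≮b))
... | tri≈ a≮b a≡b _ = trans (≮⇒<ᵇ-false (λ l → ℕₚ.<-irrefl (cong (toℕ ∘ p) (Finₚ.toℕ-injective a≡b)) l)) (sym (≮⇒<ᵇ-false a≮b))

quad-∘ : {A B : Set} (p : A → B) (i j k l : A) → ∀ a → quad (p i) (p j) (p k) (p l) a ≡ p (quad i j k l a)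
quad-∘ p i j k l zero = refl
quad-∘ p i j k l (suc zero) = refl
quad-∘ p i j k l (suc (suc zero)) = refl
quad-∘ p i j k l (suc (suc (suc zero))) = refl

increasing-injective : ∀ {m} {p : Fin 4 → Fin m} → Increasing p → ∀ {i j} → i ≢ j → p i ≢ p j
increasing-injective {p = p} inc {i} {j} i≢j pi≡pj with ℕₚ.<-cmp (toℕ i) (toℕ j)
... | tri< i<j _ _ = ℕₚ.<-irrefl (cong toℕ pi≡pj) (inc i<j)
... | tri≈ _ i≡j _ = i≢j (Finₚ.toℕ-injective i≡j)
... | tri> _ _ j<i = ℕₚ.<-irrefl (cong toℕ (sym pi≡pj)) (inc j<i)

-- Arrows are given by positions in an increasing quadruple, so that a single pair found in a facet
-- decides the edge rule for every pair of its type. This turns observations about one facet into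
-- hypotheses such as `Crosses`.
uniform-transfer : ∀ {n} {E : EdgeRule n} → Uniform E → {p p′ : Fin 4 → Fin (suc n)} → Increasing p → Increasing p′ →
  ∀ i j k l → i ≢ j → k ≢ l → E (p i) (p j) (p k) (p l) ≡ E (p′ i) (p′ j) (p′ k) (p′ l)
uniform-transfer uniform {p} {p′} inc inc′ i j k l i≢j k≢l =
  uniform _ _ _ _ _ _ _ _ (inj i≢j) (inj k≢l) (inj′ i≢j) (inj′ k≢l) λ a b →
    trans (cong₂ (λ x y → toℕ x <ᵇ toℕ y) (quad-∘ p i j k l a) (quad-∘ p i j k l b))
      (trans (trans (increasing-pattern inc _ _) (sym (increasing-pattern inc′ _ _)))
        (sym (cong₂ (λ x y → toℕ x <ᵇ toℕ y) (quad-∘ p′ i j k l a) (quad-∘ p′ i j k l b))))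
  where
  inj  = increasing-injective inc
  inj′ = increasing-injective inc′

-- Excluded pairs of arrows and the gap of a face

module Rules {n : ℕ} (1≤n : 1 ≤ n) {E : EdgeRule n} (symmetric : Symmetric E) (uniform : Uniform E)
             (tri : IsTriangulationOfBoundary E) (simion : InSimionClass E)
             (THTH-nests : Nests E T H T H) (HTHT-not : DoesNotNest E H T H T) where
  open Geometry tri

  private
    N = suc n

  pair : (a b c d : Fin N) → Digraph N
  pair a b c d t h = (⌊ t ≟ a ⌋ ∧ ⌊ h ≟ b ⌋) ∨ (⌊ t ≟ c ⌋ ∧ ⌊ h ≟ d ⌋)

  pair⁻ : ∀ {a b c d t h} → pair a b c d t h ≡ true → (t ≡ a × h ≡ b) ⊎ (t ≡ c × h ≡ d)
  pair⁻ {a} {b} {c} {d} {t} {h} eq with t ≟ a | h ≟ b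
  ... | yes p | yes q = inj₁ (p , q)
  ... | yes _ | no _  = let p , q = ∧-true⁻ {⌊ t ≟ c ⌋} eq in inj₂ (≟-true⁻ p , ≟-true⁻ q)
  ... | no _  | yes _ = let p , q = ∧-true⁻ {⌊ t ≟ c ⌋} eq in inj₂ (≟-true⁻ p , ≟-true⁻ q)
  ... | no _  | no _  = let p , q = ∧-true⁻ {⌊ t ≟ c ⌋} eq in inj₂ (≟-true⁻ p , ≟-true⁻ q)

  pair-first : ∀ a b c d → pair a b c d a b ≡ true
  pair-first a b c d rewrite ≟-refl a | ≟-refl b = refl

  pair-second : ∀ a b c d → pair a b c d c d ≡ true
  pair-second a b c d rewrite ≟-refl c | ≟-refl d = Boolₚ.∨-zeroʳ (⌊ c ≟ a ⌋ ∧ ⌊ d ≟ b ⌋)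

  pair-clique : ∀ {a b c d} → a ≢ b → c ≢ d → E a b c d ≡ true → Clique E (pair a b c d)
  pair-clique {a} {b} {c} {d} a≢b c≢d Eabcd = clique
    (λ {t} {h} eq t≡h → loop (pair⁻ {a} {b} {c} {d} eq) t≡h)
    (λ {t₁} {h₁} {t₂} {h₂} eq₁ eq₂ → adj (pair⁻ {a} {b} {c} {d} eq₁) (pair⁻ {a} {b} {c} {d} eq₂))
    where
    loop : ∀ {t h} → (t ≡ a × h ≡ b) ⊎ (t ≡ c × h ≡ d) → t ≢ h
    loop (inj₁ (refl , refl)) = a≢b
    loop (inj₂ (refl , refl)) = c≢d
    adj : ∀ {t₁ h₁ t₂ h₂} → (t₁ ≡ a × h₁ ≡ b) ⊎ (t₁ ≡ c × h₁ ≡ d) → (t₂ ≡ a × h₂ ≡ b) ⊎ (t₂ ≡ c × h₂ ≡ d) →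
          ¬ (t₁ ≡ t₂ × h₁ ≡ h₂) → E t₁ h₁ t₂ h₂ ≡ true
    adj (inj₁ (refl , refl)) (inj₁ (refl , refl)) ≢ = contradiction (refl , refl) ≢
    adj (inj₁ (refl , refl)) (inj₂ (refl , refl)) ≢ = Eabcd
    adj (inj₂ (refl , refl)) (inj₁ (refl , refl)) ≢ = trans (symmetric c d a b) Eabcd
    adj (inj₂ (refl , refl)) (inj₂ (refl , refl)) ≢ = contradiction (refl , refl) ≢

  -- The segments [a→b, c→d] and [a→d, c→b] share their midpoint, so they are not both edges.
  exchange : {R : Digraph N} → Clique E R → ∀ {a b c d} → R a b ≡ true → R c d ≡ true →
             a ≢ c → b ≢ d → a ≢ d → c ≢ b → E a d c b ≡ true → ⊥
  exchange {R} cl {a} {b} {c} {d} Rab Rcd a≢c b≢d a≢d c≢b Eadcb = ℚₚ.1≢0 (begin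
    1ℚ
      ≡⟨ sym (ℚₚ.+-identityʳ 1ℚ) ⟩
    1ℚ ℚ.+ 0ℚ
      ≡⟨ sym (cong₂ ℚ._+_ (unit-diag a b) (unit-≢ {a = c} {d} {a} {b} (a≢c ∘ proj₁))) ⟩
    unit a b a b ℚ.+ unit c d a b
      ≡⟨ unique cl (pair-clique a≢d c≢b Eadcb) {λ t h → unit a b t h ℚ.+ unit c d t h} {λ t h → unit a d t h ℚ.+ unit c b t h}
           (λ t h → 0≤+ (unit a b t h) (unit c d t h) (unit-≥0 a b t h) (unit-≥0 c d t h))
           (λ t h → 0≤+ (unit a d t h) (unit c b t h) (unit-≥0 a d t h) (unit-≥0 c b t h))
           (λ t h eq → cong₂ ℚ._+_ (unit-supported R Rab t h eq) (unit-supported R Rcd t h eq))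
           (λ t h eq → cong₂ ℚ._+_ (unit-supported (pair a d c b) (pair-first a d c b) t h eq) (unit-supported (pair a d c b) (pair-second a d c b) t h eq))
           nets a b ⟩
    unit a d a b ℚ.+ unit c b a b
      ≡⟨ cong₂ ℚ._+_ (unit-≢ {a = a} {d} {a} {b} (b≢d ∘ proj₂)) (unit-≢ {a = c} {b} {a} {b} (a≢c ∘ proj₁)) ⟩
    0ℚ ∎)
    where
    open ≡-Reasoning
    net-two : ∀ a b c d w → net (λ t h → unit a b t h ℚ.+ unit c d t h) w ≡ ind w b ℚ.- ind w a ℚ.+ (ind w d ℚ.- ind w c)
    net-two a b c d w = trans (net-cong (λ t h → cong (unit a b t h ℚ.+_) (sym (ℚₚ.*-identityˡ (unit c d t h)))) w)
      (trans (net-+* (unit a b) 1ℚ (unit c d) w)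
        (cong₂ ℚ._+_ (net-unit a b w) (trans (ℚₚ.*-identityˡ (net (unit c d) w)) (net-unit c d w))))
    nets : ∀ w → net (λ t h → unit a b t h ℚ.+ unit c d t h) w ≡ net (λ t h → unit a d t h ℚ.+ unit c b t h) w
    nets w = trans (net-two a b c d w) (trans (swap (ind w a) (ind w b) (ind w c) (ind w d)) (sym (net-two a d c b w)))
      where
      swap : ∀ a b c d → b ℚ.- a ℚ.+ (d ℚ.- c) ≡ d ℚ.- a ℚ.+ (b ℚ.- c)
      swap = solve-∀ ℚ-ring

  <⇒≢ : ∀ {a b : Fin N} → a Fin.< b → a ≢ b
  <⇒≢ a<b refl = ℕₚ.<-irrefl refl a<b

  -- The crossing and the nesting pair match the same two tails with the same two heads, so they
  -- have a common midpoint and only one of them can be an edge.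
  cross-TTHH : {R : Digraph N} → Clique E R → Nests E T T H H →
    ∀ {p₁ p₂ p₃ p₄} → p₁ Fin.< p₂ → p₂ Fin.< p₃ → p₃ Fin.< p₄ → R p₁ p₃ ≡ true → R p₂ p₄ ≡ true → ⊥
  cross-TTHH cl nests l₁ l₂ l₃ R₁₃ R₂₄ = exchange cl R₁₃ R₂₄ (<⇒≢ l₁) (<⇒≢ l₃) (<⇒≢ (ℕₚ.<-trans l₁ (ℕₚ.<-trans l₂ l₃))) (<⇒≢ l₂)
    (nests _ _ _ _ l₁ l₂ l₃)

  cross-HHTT : {R : Digraph N} → Clique E R → Nests E H H T T →
    ∀ {p₁ p₂ p₃ p₄} → p₁ Fin.< p₂ → p₂ Fin.< p₃ → p₃ Fin.< p₄ → R p₃ p₁ ≡ true → R p₄ p₂ ≡ true → ⊥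
  cross-HHTT cl nests l₁ l₂ l₃ R₃₁ R₄₂ = exchange cl R₄₂ R₃₁ (<⇒≢ l₃ ∘ sym) (<⇒≢ l₁ ∘ sym) (<⇒≢ (ℕₚ.<-trans l₁ (ℕₚ.<-trans l₂ l₃)) ∘ sym) (<⇒≢ l₂ ∘ sym)
    (nests _ _ _ _ l₁ l₂ l₃)

  -- If the arrow t′→h′ ended before t, the two would be disjoint of type `THTH`, and the nesting
  -- pair t′→h, t→h′ would be an edge with the same midpoint. Consequently every forward tail lies
  -- to the left of every forward head.
  forward-overlap : {R : Digraph N} → Clique E R → ∀ {t h t′ h′} → R t h ≡ true → R t′ h′ ≡ true → t Fin.< h → t′ Fin.< h′ → t Fin.< h′
  forward-overlap cl {t} {h} {t′} {h′} Rth Rt′h′ t<h t′<h′ with ℕₚ.<-cmp (toℕ t) (toℕ h′)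
  ... | tri< t<h′ _ _ = t<h′
  ... | tri≈ _ t≡h′ _ with refl ← Finₚ.toℕ-injective t≡h′ = ⊥-elim (bipartite cl Rt′h′ Rth)
  ... | tri> _ _ h′<t = ⊥-elim (exchange cl Rt′h′ Rth (<⇒≢ (ℕₚ.<-trans t′<h′ h′<t)) (<⇒≢ (ℕₚ.<-trans h′<t t<h))
    (<⇒≢ (ℕₚ.<-trans t′<h′ (ℕₚ.<-trans h′<t t<h))) (<⇒≢ h′<t ∘ sym) (THTH-nests _ _ _ _ t′<h′ h′<t t<h))

  no-forward-inside-backward : {R : Digraph N} → Clique E R → ∀ {a b t h} → R a b ≡ true → R t h ≡ true → h Fin.< a → a Fin.< b → b Fin.< t → ⊥
  no-forward-inside-backward cl Rab Rth h<a a<b b<t = contradiction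
    (trans (sym (adjacent cl Rth Rab λ { (_ , refl) → ℕₚ.<-asym h<a a<b })) (HTHT-not _ _ _ _ h<a a<b b<t)) λ ()

  module Gap {R : Digraph N} (cl : Clique E R) where

    Backward-over : Fin N → Fin N → Fin N → Set
    Backward-over v t h = R t h ≡ true × h Fin.< v × v Fin.< t

    backward-over? : ∀ v → Dec (∃₂ (Backward-over v))
    backward-over? v = Finₚ.any? λ t → Finₚ.any? λ h → (R t h Boolₚ.≟ true) ×-dec ((h Fin.<? v) ×-dec (v Fin.<? t))

    -- Of the possible positions of `t`, bipartiteness excludes `b`, and the ban on nested pairs of
    -- type `HTHT` excludes those beyond `b`. What remains is a crossing pair of type `HTTH`,
    -- present in the face and hence an edge.
    HTTH-instance : ∀ {a b t h} → R a b ≡ true → a Fin.< b → Backward-over a t h → Crosses E H T T H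
    HTTH-instance {a} {b} {t} {h} Rab a<b (Rth , h<a , a<t) p₁ p₂ p₃ p₄ l₁ l₂ l₃ with ℕₚ.<-cmp (toℕ t) (toℕ b)
    ... | tri≈ _ t≡b _ with refl ← Finₚ.toℕ-injective t≡b = ⊥-elim (bipartite cl Rab Rth)
    ... | tri> _ _ b<t = ⊥-elim (no-forward-inside-backward cl Rab Rth h<a a<b b<t)
    ... | tri< t<b _ _ = trans
      (uniform-transfer uniform (quad-increasing l₁ l₂ l₃) (quad-increasing h<a a<t t<b) (suc (suc zero)) zero (suc zero) (suc (suc (suc zero))) (λ ()) (λ ()))
      (adjacent cl Rth Rab λ { (refl , _) → ℕₚ.<-irrefl refl a<t })

    THHT-instance : ∀ {a b t h} → R a b ≡ true → a Fin.< b → Backward-over b t h → Crosses E T H H T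
    THHT-instance {a} {b} {t} {h} Rab a<b (Rth , h<b , b<t) p₁ p₂ p₃ p₄ l₁ l₂ l₃ with ℕₚ.<-cmp (toℕ h) (toℕ a)
    ... | tri≈ _ h≡a _ with refl ← Finₚ.toℕ-injective h≡a = ⊥-elim (bipartite cl Rth Rab)
    ... | tri< h<a _ _ = ⊥-elim (no-forward-inside-backward cl Rab Rth h<a a<b b<t)
    ... | tri> _ _ a<h = trans
      (uniform-transfer uniform (quad-increasing l₁ l₂ l₃) (quad-increasing a<h h<b b<t) zero (suc (suc zero)) (suc (suc (suc zero))) (suc zero) (λ ()) (λ ()))
      (adjacent cl Rab Rth λ { (_ , refl) → ℕₚ.<-irrefl refl h<b })

    -- The gap lies immediately before the vertex `G`, which is the first vertex of the right side.
    record IsGap (G : Fin N) : Set where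
      field
        forward-crosses  : ∀ {t h} → R t h ≡ true → t Fin.< h → t Fin.< G × G Fin.≤ h
        backward-avoids  : ∀ {t h} → R t h ≡ true → h Fin.< t → t Fin.< G ⊎ G Fin.≤ h

    -- All forward tails are at most `t*` and all forward heads at least `h*`, so every cut between
    -- these two is crossed by all forward arrows; only backward arrows can obstruct. The cut right
    -- after `t*` works if no backward arrow spans `t*`, the cut right before `h*` if none spans
    -- `h*`. If both fail, the obstructing arrows witness that `THHT` and `HTTH` cross.
    gap : (∃₂ λ t h → R t h ≡ true × t Fin.< h) → ∃ IsGap
    gap (t₀ , h₀ , R₀ , t₀<h₀) = search (backward-over? t*) (backward-over? h*)
      where
      last-tail = greatest (λ t → Finₚ.any? λ h → (R t h Boolₚ.≟ true) ×-dec (t Fin.<? h)) (t₀ , h₀ , R₀ , t₀<h₀)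
      first-head = least (λ h → Finₚ.any? λ t → (R t h Boolₚ.≟ true) ×-dec (t Fin.<? h)) (h₀ , t₀ , R₀ , t₀<h₀)
      t* h* h′ t′ : Fin N
      t* = proj₁ last-tail
      h* = proj₁ first-head
      h′ = proj₁ (proj₁ (proj₂ last-tail))
      t′ = proj₁ (proj₁ (proj₂ first-head))
      Rt*h′ : R t* h′ ≡ true
      Rt*h′ = proj₁ (proj₂ (proj₁ (proj₂ last-tail)))
      t*<h′ : t* Fin.< h′
      t*<h′ = proj₂ (proj₂ (proj₁ (proj₂ last-tail)))
      Rt′h* : R t′ h* ≡ true
      Rt′h* = proj₁ (proj₂ (proj₁ (proj₂ first-head)))
      t′<h* : t′ Fin.< h*
      t′<h* = proj₂ (proj₂ (proj₁ (proj₂ first-head)))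
      t≤t* : ∀ {t h} → R t h ≡ true → t Fin.< h → t Fin.≤ t*
      t≤t* Rth t<h = proj₂ (proj₂ last-tail) _ (_ , Rth , t<h)
      h*≤h : ∀ {t h} → R t h ≡ true → t Fin.< h → h* Fin.≤ h
      h*≤h Rth t<h = proj₂ (proj₂ first-head) _ (_ , Rth , t<h)
      t*<h* : t* Fin.< h*
      t*<h* = forward-overlap cl Rt*h′ Rt′h* t*<h′ t′<h*
      ≢t* : ∀ {t h} → R t h ≡ true → toℕ h ≢ toℕ t*
      ≢t* Rth eq with refl ← Finₚ.toℕ-injective eq = bipartite cl Rth Rt*h′
      ≢h* : ∀ {t h} → R t h ≡ true → toℕ t ≢ toℕ h*
      ≢h* Rth eq with refl ← Finₚ.toℕ-injective eq = bipartite cl Rt′h* Rth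

      after : ∀ {v} → t* Fin.≤ v → v Fin.< h* → (∀ {t h} → R t h ≡ true → h Fin.≤ v → v Fin.< t → ⊥) → ∃ IsGap
      after {v} t*≤v v<h* none with next v<h*
      ... | G , G≡ = G , record
        { forward-crosses = λ Rth t<h → subst (_ <_) (sym G≡) (s≤s (ℕₚ.≤-trans (t≤t* Rth t<h) t*≤v)) ,
                                        subst (_≤ _) (sym G≡) (ℕₚ.<-≤-trans v<h* (h*≤h Rth t<h))
        ; backward-avoids = avoids }
        where
        avoids : ∀ {t h} → R t h ≡ true → h Fin.< t → t Fin.< G ⊎ G Fin.≤ h
        avoids {t} {h} Rth h<t with toℕ t ℕₚ.≤? toℕ v | toℕ h ℕₚ.≤? toℕ v
        ... | yes t≤v | _       = inj₁ (subst (_ <_) (sym G≡) (s≤s t≤v))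
        ... | no _    | no h≰v  = inj₂ (subst (_≤ _) (sym G≡) (ℕₚ.≰⇒> h≰v))
        ... | no t≰v  | yes h≤v = ⊥-elim (none Rth h≤v (ℕₚ.≰⇒> t≰v))

      at-h* : ¬ ∃₂ (Backward-over h*) → ∃ IsGap
      at-h* none = h* , record
        { forward-crosses = λ Rth t<h → forward-overlap cl Rth Rt′h* t<h t′<h* , h*≤h Rth t<h
        ; backward-avoids = avoids }
        where
        avoids : ∀ {t h} → R t h ≡ true → h Fin.< t → t Fin.< h* ⊎ h* Fin.≤ h
        avoids {t} {h} Rth h<t with toℕ t ℕₚ.<? toℕ h* | toℕ h ℕₚ.<? toℕ h*
        ... | yes t<h* | _        = inj₁ t<h*
        ... | no _     | no h≮h*  = inj₂ (ℕₚ.≮⇒≥ h≮h*)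
        ... | no t≮h*  | yes h<h* = ⊥-elim (none (t , h , Rth , h<h* , ℕₚ.≤∧≢⇒< (ℕₚ.≮⇒≥ t≮h*) (≢h* Rth ∘ sym)))

      -- Here both mixed types cross, so the class hypothesis makes the pure types nest. Then t*→h* is an arrow,
      -- which no backward arrow spans, and backward arrows over t* do not chain with later ones.
      both-cross : Crosses E T H H T → Crosses E H T T H → ∃ IsGap
      both-cross THHT HTTH = locate (Finₚ.any? over?)
        where
        nests = proj₂ simion (THHT , HTTH)
        Rt*h* : R t* h* ≡ true
        Rt*h* with ℕₚ.<-cmp (toℕ t′) (toℕ t*) | ℕₚ.<-cmp (toℕ h*) (toℕ h′)
        ... | tri≈ _ t′≡t* _ | _ = subst (λ t → R t h* ≡ true) (Finₚ.toℕ-injective t′≡t*) Rt′h*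
        ... | tri> t′≮t* t′≢t* _ | _ = contradiction (ℕₚ.≤∧≢⇒< (t≤t* Rt′h* t′<h*) t′≢t*) t′≮t*
        ... | tri< _ _ _ | tri≈ _ h*≡h′ _ = subst (λ h → R t* h ≡ true) (sym (Finₚ.toℕ-injective h*≡h′)) Rt*h′
        ... | tri< _ _ _ | tri> h*≮h′ h*≢h′ _ = contradiction (ℕₚ.≤∧≢⇒< (h*≤h Rt*h′ t*<h′) h*≢h′) h*≮h′
        ... | tri< t′<t* _ _ | tri< h*<h′ _ _ = ⊥-elim (cross-TTHH cl (proj₁ nests) t′<t* t*<h* h*<h′ Rt′h* Rt*h′)
        Over : Fin N → Set
        Over t = t Fin.< h* × (∃ λ h → Backward-over t* t h)
        over? : ∀ t → Dec (Over t)
        over? t = (t Fin.<? h*) ×-dec Finₚ.any? λ h → (R t h Boolₚ.≟ true) ×-dec ((h Fin.<? t*) ×-dec (t* Fin.<? t))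
        below-h* : ∀ {t h} → Backward-over t* t h → t Fin.< h*
        below-h* {t} (Rth , h<t* , t*<t) with ℕₚ.<-cmp (toℕ t) (toℕ h*)
        ... | tri< t<h* _ _ = t<h*
        ... | tri≈ _ t≡h* _ = contradiction t≡h* (≢h* Rth)
        ... | tri> _ _ h*<t = ⊥-elim (no-forward-inside-backward cl Rt*h* Rth h<t* t*<h* h*<t)
        locate : Dec (∃ Over) → ∃ IsGap
        locate (no none) = after ℕₚ.≤-refl t*<h* λ Rth h≤t* t*<t →
          let over = Rth , ℕₚ.≤∧≢⇒< h≤t* (≢t* Rth) , t*<t in none (_ , below-h* over , _ , over)
        locate (yes found) with greatest over? found
        -- The cut goes right after the last tail `v` of a backward arrow v→g over `t*`. A backward
        -- arrow across this cut that also spans `t*` has a later tail, against maximality; any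
        -- other starts beyond `v`, ends between `t*` and `v`, and crosses v→g as type `HHTT`.
        ... | v , (v<h* , g , Rvg , g<t* , t*<v) , max = after (ℕₚ.<⇒≤ t*<v) v<h* blocked
          where
          blocked : ∀ {t h} → R t h ≡ true → h Fin.≤ v → v Fin.< t → ⊥
          blocked {t} {h} Rth h≤v v<t with ℕₚ.<-cmp (toℕ h) (toℕ t*)
          ... | tri< h<t* _ _ = let over = Rth , h<t* , ℕₚ.<-trans t*<v v<t in
            ℕₚ.<⇒≱ v<t (max t (below-h* over , h , over))
          ... | tri≈ _ h≡t* _ = ≢t* Rth h≡t*
          ... | tri> _ _ t*<h with ℕₚ.<-cmp (toℕ h) (toℕ v)
          ...   | tri< h<v _ _ = cross-HHTT cl (proj₂ nests) (ℕₚ.<-trans g<t* t*<h) h<v v<t Rvg Rth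
          ...   | tri≈ _ h≡v _ with refl ← Finₚ.toℕ-injective h≡v = bipartite cl Rth Rvg
          ...   | tri> h≮v _ v<h = ℕₚ.<⇒≱ v<h h≤v

      search : Dec (∃₂ (Backward-over t*)) → Dec (∃₂ (Backward-over h*)) → ∃ IsGap
      search (no none) _ = after ℕₚ.≤-refl t*<h* λ Rth h≤t* t*<t → none (_ , _ , Rth , ℕₚ.≤∧≢⇒< h≤t* (≢t* Rth) , t*<t)
      search (yes _) (no none) = at-h* none
      search (yes (_ , _ , over-t*)) (yes (_ , _ , over-h*)) =
        both-cross (THHT-instance Rt′h* t′<h* over-h*) (HTTH-instance Rt*h′ t*<h′ over-t*)

-- Łukasiewicz words

inc : List ℕ → List ℕ
inc []       = []
inc (x ∷ xs) = suc x ∷ xs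

-- Every nonempty suffix has a sum smaller than its length: the usual Łukasiewicz condition, read
-- from the right.
Łukasiewicz : List ℕ → Set
Łukasiewicz []       = ⊤
Łukasiewicz (x ∷ xs) = ∑ (x ∷ xs) ≤ length xs × Łukasiewicz xs

-- The second argument is the deficit, length minus sum. Dropping a leading 0 lowers it by one, and
-- decreasing the first letter raises it by one.
words : ℕ → ℕ → List (List ℕ)
words zero    zero    = [] ∷ []
words (suc s) zero    = []
words zero    (suc c) = map (0 ∷_) (words zero c)
words (suc s) (suc c) = map (0 ∷_) (words (suc s) c) ++ map inc (words s (suc (suc c)))

-- For c > 0 this is the ballot number c/(2s + c) · binom(2s + c, s), the coefficient of x^s in the
-- c-th power of the Catalan series.
ballot : ℕ → ℕ → ℕ
ballot zero    zero    = 1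
ballot (suc s) zero    = 0
ballot zero    (suc c) = ballot zero c
ballot (suc s) (suc c) = ballot (suc s) c + ballot s (suc (suc c))

length-words : ∀ s c → length (words s c) ≡ ballot s c
length-words zero    zero    = refl
length-words (suc s) zero    = refl
length-words zero    (suc c) = trans (Listₚ.length-map (0 ∷_) (words zero c)) (length-words zero c)
length-words (suc s) (suc c) = trans (Listₚ.length-++ (map (0 ∷_) (words (suc s) c)))
  (cong₂ _+_ (trans (Listₚ.length-map (0 ∷_) (words (suc s) c)) (length-words (suc s) c))
             (trans (Listₚ.length-map inc (words s (suc (suc c)))) (length-words s (suc (suc c)))))

∈-words : ∀ s c l → Łukasiewicz l → ∑ l ≡ s → length l ≡ s + c → l ∈ words s c
∈-words zero zero [] _ _ _ = here refl
∈-words zero (suc c) (zero ∷ l) (_ , łl) sum≡ len≡ = ∈ₚ.∈-map⁺ (0 ∷_) (∈-words zero c l łl sum≡ (ℕₚ.suc-injective len≡))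
∈-words (suc s) zero (x ∷ l) (le , _) sum≡ len≡ = contradiction (ℕₚ.≤-trans (ℕₚ.≤-reflexive (sym sum≡)) le)
  (ℕₚ.<⇒≱ (ℕₚ.≤-reflexive (trans len≡ (ℕₚ.+-identityʳ (suc s)))))
∈-words (suc s) (suc c) (zero ∷ l) (_ , łl) sum≡ len≡ = ∈ₚ.∈-++⁺ˡ (∈ₚ.∈-map⁺ (0 ∷_)
  (∈-words (suc s) c l łl sum≡ (ℕₚ.suc-injective (trans len≡ (ℕₚ.+-suc (suc s) c)))))
∈-words (suc s) (suc c) (suc x ∷ l) (le , łl) sum≡ len≡ = ∈ₚ.∈-++⁺ʳ (map (0 ∷_) (words (suc s) c)) (∈ₚ.∈-map⁺ inc
  (∈-words s (suc (suc c)) (x ∷ l) (ℕₚ.<⇒≤ le , łl) (ℕₚ.suc-injective sum≡) (trans len≡ (sym (ℕₚ.+-suc s (suc c))))))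

-- The compositions of k + 1 rather than of k, so that their number is 2^k without an exception at
-- zero.
compositions : ℕ → List (List ℕ)
compositions zero    = (1 ∷ []) ∷ []
compositions (suc k) = map (1 ∷_) (compositions k) ++ map inc (compositions k)

length-compositions : ∀ k → length (compositions k) ≡ 2 ^ k
length-compositions zero    = refl
length-compositions (suc k) = trans (Listₚ.length-++ (map (1 ∷_) (compositions k)))
  (cong₂ _+_ (trans (Listₚ.length-map (1 ∷_) (compositions k)) (length-compositions k))
    (trans (Listₚ.length-map inc (compositions k)) (trans (length-compositions k) (sym (ℕₚ.+-identityʳ (2 ^ k))))))

∈-compositions : ∀ k l → All (1 ≤_) l → ∑ l ≡ suc k → l ∈ compositions k
∈-compositions k (zero ∷ l) (() ∷ _) _
∈-compositions zero (suc zero ∷ []) _ _ = here refl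
∈-compositions zero (suc zero ∷ zero ∷ l) (_ ∷ () ∷ _) _
∈-compositions zero (suc zero ∷ suc y ∷ l) _ ()
∈-compositions zero (suc (suc x) ∷ l) _ ()
∈-compositions (suc k) (suc zero ∷ l) (_ ∷ pos) sum≡ = ∈ₚ.∈-++⁺ˡ (∈ₚ.∈-map⁺ (1 ∷_) (∈-compositions k l pos (ℕₚ.suc-injective sum≡)))
∈-compositions (suc k) (suc (suc x) ∷ l) (_ ∷ pos) sum≡ = ∈ₚ.∈-++⁺ʳ (map (1 ∷_) (compositions k))
  (∈ₚ.∈-map⁺ inc (∈-compositions k (suc x ∷ l) (s≤s z≤n ∷ pos) (ℕₚ.suc-injective sum≡)))

-- Weak compositions

incᵛ : ∀ {p} → Vec ℕ (suc p) → Vec ℕ (suc p)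
incᵛ (x Vec.∷ xs) = suc x Vec.∷ xs

weakCompositions : ℕ → (p : ℕ) → List (Vec ℕ p)
weakCompositions zero    zero    = Vec.[] ∷ []
weakCompositions (suc s) zero    = []
weakCompositions zero    (suc p) = map (0 Vec.∷_) (weakCompositions zero p)
weakCompositions (suc s) (suc p) = map (0 Vec.∷_) (weakCompositions (suc s) p) ++ map incᵛ (weakCompositions s (suc p))

-- For p > 0 this is binom(s + p - 1, s).
multichoose : ℕ → ℕ → ℕ
multichoose zero    zero    = 1
multichoose (suc s) zero    = 0
multichoose zero    (suc p) = multichoose zero p
multichoose (suc s) (suc p) = multichoose (suc s) p + multichoose s (suc p)

length-weakCompositions : ∀ s p → length (weakCompositions s p) ≡ multichoose s p
length-weakCompositions zero    zero    = refl
length-weakCompositions (suc s) zero    = refl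
length-weakCompositions zero    (suc p) = trans (Listₚ.length-map (0 Vec.∷_) (weakCompositions zero p)) (length-weakCompositions zero p)
length-weakCompositions (suc s) (suc p) = trans (Listₚ.length-++ (map (0 Vec.∷_) (weakCompositions (suc s) p)))
  (cong₂ _+_ (trans (Listₚ.length-map (0 Vec.∷_) (weakCompositions (suc s) p)) (length-weakCompositions (suc s) p))
             (trans (Listₚ.length-map incᵛ (weakCompositions s (suc p))) (length-weakCompositions s (suc p))))

weakCompositions-sum : ∀ s p {v} → v ∈ weakCompositions s p → sumℕ (lookup v) ≡ s
weakCompositions-sum zero zero (here refl) = refl
weakCompositions-sum zero (suc p) v∈ with ∈ₚ.∈-map⁻ (0 Vec.∷_) v∈
... | u , u∈ , refl = weakCompositions-sum zero p u∈
weakCompositions-sum (suc s) (suc p) v∈ with ∈ₚ.∈-++⁻ (map (0 Vec.∷_) (weakCompositions (suc s) p)) v∈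
... | inj₁ v∈₁ with ∈ₚ.∈-map⁻ (0 Vec.∷_) v∈₁
...   | u , u∈ , refl = weakCompositions-sum (suc s) p u∈
weakCompositions-sum (suc s) (suc p) v∈ | inj₂ v∈₂ with ∈ₚ.∈-map⁻ incᵛ v∈₂
...   | x Vec.∷ u , u∈ , refl = cong suc (weakCompositions-sum s (suc p) u∈)

weakCompositions-unique : ∀ s p → Unique (weakCompositions s p)
weakCompositions-unique zero    zero    = [] ∷ []
weakCompositions-unique (suc s) zero    = []
weakCompositions-unique zero    (suc p) = Uniqueₚ.map⁺ (λ { refl → refl }) (weakCompositions-unique zero p)
weakCompositions-unique (suc s) (suc p) = Uniqueₚ.++⁺ (Uniqueₚ.map⁺ (λ { refl → refl }) (weakCompositions-unique (suc s) p))
  (Uniqueₚ.map⁺ incᵛ-injective (weakCompositions-unique s (suc p))) disjoint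
  where
  incᵛ-injective : ∀ {p} {u v : Vec ℕ (suc p)} → incᵛ u ≡ incᵛ v → u ≡ v
  incᵛ-injective {u = _ Vec.∷ _} {_ Vec.∷ _} refl = refl
  disjoint : ∀ {v} → v ∈ map (0 Vec.∷_) (weakCompositions (suc s) p) × v ∈ map incᵛ (weakCompositions s (suc p)) → ⊥
  disjoint (v∈₁ , v∈₂) with ∈ₚ.∈-map⁻ (0 Vec.∷_) v∈₁ | ∈ₚ.∈-map⁻ incᵛ v∈₂
  ... | u , _ , refl | (x Vec.∷ u′) , _ , ()

-- Injections and covers

-- Codes form a relation and not a function because the code of a facet is read off along a gap that
-- is only known to exist. It suffices that no two elements share a code.
pigeonhole : {A B : Set} (Code : A → B → Set) → (∀ {x x′ b} → Code x b → Code x′ b → x ≡ x′) →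
  ∀ {xs} → Unique xs → ∀ ys → (∀ {x} → x ∈ xs → ∃ λ b → b ∈ ys × Code x b) → length xs ≤ length ys
pigeonhole Code inj {[]} _ ys code = z≤n
pigeonhole {B = B} Code inj {x ∷ xs} (x∉xs ∷ xs!) ys code with code (here refl)
... | b , b∈ys , xb with ∈ₚ.∈-∃++ b∈ys
...   | ys₁ , ys₂ , refl = ℕₚ.≤-trans (s≤s (pigeonhole Code inj xs! (ys₁ ++ ys₂) code′))
    (ℕₚ.≤-reflexive (trans (cong suc (Listₚ.length-++ ys₁)) (trans (sym (ℕₚ.+-suc (length ys₁) (length ys₂))) (sym (Listₚ.length-++ ys₁)))))
  where
  avoid : ∀ {b′} → b′ ≢ b → b′ ∈ ys₁ ++ b ∷ ys₂ → b′ ∈ ys₁ ++ ys₂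
  avoid b′≢b b′∈ with ∈ₚ.∈-++⁻ ys₁ b′∈
  ... | inj₁ ∈₁ = ∈ₚ.∈-++⁺ˡ ∈₁
  ... | inj₂ (here b′≡b) = contradiction b′≡b b′≢b
  ... | inj₂ (there ∈₂) = ∈ₚ.∈-++⁺ʳ ys₁ ∈₂
  code′ : ∀ {x′} → x′ ∈ xs → ∃ λ b → b ∈ ys₁ ++ ys₂ × Code x′ b
  code′ x′∈xs with code (there x′∈xs)
  ... | b′ , b′∈ , x′b′ = b′ , avoid (λ { refl → All.lookup x∉xs x′∈xs (inj xb x′b′) }) b′∈ , x′b′

length-filterᵇ-cover : {A : Set} (p : A → Bool) {k : ℕ} (q : Fin k → A → Bool) → (∀ x → p x ≡ true → ∃ λ i → q i x ≡ true) →
  ∀ xs → length (filterᵇ p xs) ≤ sumℕ (λ i → length (filterᵇ (q i) xs))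
length-filterᵇ-cover p q cover [] = z≤n
length-filterᵇ-cover p {k} q cover (x ∷ xs) with p x in px
... | true  = ℕₚ.≤-trans (ℕₚ.+-mono-≤ head-covered (length-filterᵇ-cover p q cover xs)) (ℕₚ.≤-reflexive (unfold x xs))
  where
  head-covered : 1 ≤ sumℕ (λ i → toℕᵇ (q i x))
  head-covered = let i , qix = cover x px in count-≥1 (λ i → q i x) i qix
  step : ∀ i x xs → toℕᵇ (q i x) + length (filterᵇ (q i) xs) ≡ length (filterᵇ (q i) (x ∷ xs))
  step i x xs with q i x
  ... | true  = refl
  ... | false = refl
  unfold : ∀ x xs → sumℕ (λ i → toℕᵇ (q i x)) + sumℕ (λ i → length (filterᵇ (q i) xs)) ≡ sumℕ (λ i → length (filterᵇ (q i) (x ∷ xs)))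
  unfold x xs = trans (sym (sumℕ-+ (λ i → toℕᵇ (q i x)) (λ i → length (filterᵇ (q i) xs)))) (sumℕ-cong λ i → step i x xs)
... | false = ℕₚ.≤-trans (length-filterᵇ-cover p q cover xs) (sumℕ-mono λ i → grow i)
  where
  grow : ∀ i → length (filterᵇ (q i) xs) ≤ length (filterᵇ (q i) (x ∷ xs))
  grow i with q i x
  ... | true  = ℕₚ.n≤1+n _
  ... | false = ℕₚ.≤-refl

-- Ballot numbers

multichoose-0 : ∀ p → multichoose 0 p ≡ 1
multichoose-0 zero    = refl
multichoose-0 (suc p) = multichoose-0 p

multichoose-1 : ∀ s → multichoose s 1 ≡ 1
multichoose-1 zero    = refl
multichoose-1 (suc s) = multichoose-1 s

ballot-0 : ∀ c → ballot 0 c ≡ 1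
ballot-0 zero    = refl
ballot-0 (suc c) = ballot-0 c

multichoose-sym : ∀ s p → multichoose s (suc p) ≡ multichoose p (suc s)
multichoose-sym zero    p       = trans (multichoose-0 (suc p)) (sym (multichoose-1 p))
multichoose-sym (suc s) zero    = trans (multichoose-1 s) (sym (multichoose-0 (suc s)))
multichoose-sym (suc s) (suc p) = trans (cong₂ _+_ (multichoose-sym (suc s) p) (multichoose-sym s (suc p))) (ℕₚ.+-comm (multichoose p (suc (suc s))) _)

-- The reflection principle, ballot (s+1) c = binom(2s+c+1, s+1) - binom(2s+c+1, s), with the
-- subtraction moved to the other side. For c = 0 it is the symmetry of the binomial coefficients.
ballot-reflection : ∀ s c → ballot (suc s) c + multichoose s (suc (suc (s + c))) ≡ multichoose (suc s) (suc (s + c))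
ballot-reflection s zero = trans (multichoose-sym s (suc (s + 0))) (cong₂ multichoose (cong suc (ℕₚ.+-identityʳ s)) (cong suc (sym (ℕₚ.+-identityʳ s))))
ballot-reflection zero (suc c) = begin
  ballot 1 c + ballot 0 (suc (suc c)) + multichoose 0 (suc (suc (suc c)))
    ≡⟨ cong₂ (λ x y → ballot 1 c + x + y) (ballot-0 (suc (suc c))) (multichoose-0 (suc (suc (suc c)))) ⟩
  ballot 1 c + 1 + 1
    ≡⟨ cong (λ x → ballot 1 c + x + 1) (sym (multichoose-0 (suc (suc c)))) ⟩
  ballot 1 c + multichoose 0 (suc (suc c)) + 1
    ≡⟨ cong₂ _+_ (ballot-reflection zero c) (sym (multichoose-0 (suc (suc c)))) ⟩
  multichoose 1 (suc c) + multichoose 0 (suc (suc c)) ∎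
  where open ≡-Reasoning
ballot-reflection (suc s) (suc c) = begin
  ballot (suc (suc s)) c + ballot (suc s) (suc (suc c)) + (multichoose (suc s) (suc (suc (s + suc c))) + multichoose s (suc (suc (suc (s + suc c)))))
    ≡⟨ cong₂ (λ x y → ballot (suc (suc s)) c + ballot (suc s) (suc (suc c)) + (multichoose (suc s) (suc (suc x)) + multichoose s (suc (suc y)))) (ℕₚ.+-suc s c) (sym (ℕₚ.+-suc s (suc c))) ⟩
  ballot (suc (suc s)) c + ballot (suc s) (suc (suc c)) + (multichoose (suc s) (suc (suc (suc s + c))) + multichoose s (suc (suc (s + suc (suc c)))))
    ≡⟨ +-interchange (ballot (suc (suc s)) c) (ballot (suc s) (suc (suc c))) _ _ ⟩
  ballot (suc (suc s)) c + multichoose (suc s) (suc (suc (suc s + c))) + (ballot (suc s) (suc (suc c)) + multichoose s (suc (suc (s + suc (suc c)))))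
    ≡⟨ cong₂ _+_ (ballot-reflection (suc s) c) (ballot-reflection s (suc (suc c))) ⟩
  multichoose (suc (suc s)) (suc (suc s + c)) + multichoose (suc s) (suc (s + suc (suc c)))
    ≡⟨ cong₂ (λ x y → multichoose (suc (suc s)) (suc x) + multichoose (suc s) (suc y)) (sym (ℕₚ.+-suc s c)) (ℕₚ.+-suc s (suc c)) ⟩
  multichoose (suc (suc s)) (suc (s + suc c)) + multichoose (suc s) (suc (suc (s + suc c))) ∎
  where open ≡-Reasoning

-- By reflection the ballot number is binom(2s+c, s) - binom(2s+c, s-1), and by Pascal's rule the
-- other summand is binom(2s+c, s) + binom(2s+c, s-1).
ballot-double : ∀ s c → ballot s (suc c) + multichoose s (suc (suc (s + c))) ≡ multichoose s (suc (s + c)) + multichoose s (suc (s + c))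
ballot-double zero c = cong₂ _+_ (trans (ballot-0 (suc c)) (sym (multichoose-0 (suc c)))) (trans (multichoose-0 (suc (suc c))) (sym (multichoose-0 (suc c))))
ballot-double (suc s) c = begin
  ballot (suc s) (suc c) + (multichoose (suc s) (suc (suc (s + c))) + multichoose s (suc (suc (suc (s + c)))))
    ≡⟨ cong (ballot (suc s) (suc c) +_) (ℕₚ.+-comm (multichoose (suc s) (suc (suc (s + c)))) _) ⟩
  ballot (suc s) (suc c) + (multichoose s (suc (suc (suc (s + c)))) + multichoose (suc s) (suc (suc (s + c))))
    ≡⟨ sym (ℕₚ.+-assoc (ballot (suc s) (suc c)) _ _) ⟩
  ballot (suc s) (suc c) + multichoose s (suc (suc (suc (s + c)))) + multichoose (suc s) (suc (suc (s + c)))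
    ≡⟨ cong (λ x → ballot (suc s) (suc c) + multichoose s (suc (suc x)) + multichoose (suc s) (suc (suc (s + c)))) (sym (ℕₚ.+-suc s c)) ⟩
  ballot (suc s) (suc c) + multichoose s (suc (suc (s + suc c))) + multichoose (suc s) (suc (suc (s + c)))
    ≡⟨ cong (_+ multichoose (suc s) (suc (suc (s + c)))) (trans (ballot-reflection s (suc c)) (cong (λ x → multichoose (suc s) (suc x)) (ℕₚ.+-suc s c))) ⟩
  multichoose (suc s) (suc (suc (s + c))) + multichoose (suc s) (suc (suc (s + c))) ∎
  where open ≡-Reasoning

forwardSum : ℕ → ℕ → ℕ
forwardSum s c = sumℕ {s} (λ j → 2 ^ toℕ j * ballot (s ∸ suc (toℕ j)) (c + suc (toℕ j)))

forwardSum-suc : ∀ s c → forwardSum (suc s) c ≡ ballot s (suc c) + (forwardSum s (suc c) + forwardSum s (suc c))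
forwardSum-suc s c = cong₂ _+_ (trans (ℕₚ.*-identityˡ (ballot s (c + 1))) (cong (ballot s) (ℕₚ.+-comm c 1)))
  (trans (sumℕ-cong step) (sumℕ-+ term term))
  where
  term : Fin s → ℕ
  term j = 2 ^ toℕ j * ballot (s ∸ suc (toℕ j)) (suc c + suc (toℕ j))
  step : ∀ j → 2 ^ suc (toℕ j) * ballot (s ∸ suc (toℕ j)) (c + suc (suc (toℕ j))) ≡ term j + term j
  step j = trans (cong (λ x → 2 ^ suc (toℕ j) * ballot (s ∸ suc (toℕ j)) x) (ℕₚ.+-suc c (suc (toℕ j))))
    (trans (ℕₚ.*-assoc 2 (2 ^ toℕ j) _) (cong (term j +_) (ℕₚ.+-identityʳ (term j))))

-- The sum without its first term is twice a sum of the same kind with `c` raised by one, hence the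
-- induction over all `c`. With b, F and a as named below and the induction hypothesis b + F = a,
-- `ballot-double` turns a + F = 2a - b into a single binomial coefficient, and `ballot-reflection`
-- absorbs the remaining ballot number.
ballot-total : ∀ s c → ballot s c + forwardSum s c ≡ multichoose s (s + c)
ballot-total zero c = trans (ℕₚ.+-identityʳ (ballot 0 c)) (trans (ballot-0 c) (sym (multichoose-0 c)))
ballot-total (suc s) c = ℕₚ.+-cancelʳ-≡ w _ _ (begin
  b + forwardSum (suc s) c + w
    ≡⟨ cong (λ x → b + x + w) (trans (forwardSum-suc s c) (trans (sym (ℕₚ.+-assoc (ballot s (suc c)) F F)) (cong (_+ F) ih))) ⟩
  b + (a + F) + w
    ≡⟨ cong (λ x → b + x + w) a+F≡w ⟩
  b + w + w
    ≡⟨ cong (_+ w) (ballot-reflection s c) ⟩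
  multichoose (suc s) (suc (s + c)) + w ∎)
  where
  open ≡-Reasoning
  b = ballot (suc s) c
  F = forwardSum s (suc c)
  w = multichoose s (suc (suc (s + c)))
  a = multichoose s (suc (s + c))
  ih : ballot s (suc c) + F ≡ a
  ih = trans (ballot-total s (suc c)) (cong (multichoose s) (ℕₚ.+-suc s c))
  a+F≡w : a + F ≡ w
  a+F≡w = ℕₚ.+-cancelˡ-≡ (ballot s (suc c)) _ _ (begin
    ballot s (suc c) + (a + F) ≡⟨ trans (cong (ballot s (suc c) +_) (ℕₚ.+-comm a F)) (sym (ℕₚ.+-assoc (ballot s (suc c)) F a)) ⟩
    ballot s (suc c) + F + a   ≡⟨ cong (_+ a) ih ⟩
    a + a                      ≡⟨ sym (ballot-double s c) ⟩
    ballot s (suc c) + w       ∎)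

-- The hypotheses are the closed forms of the two summands in the recursion. The first is stated
-- with a factor `c`, so that it also covers c = 0, where both sides vanish.
ballot-closed-step : ∀ s c → ballot (suc s) c * (suc s ! * (s + suc c) !) ≡ c * suc (2 * s + c) ! →
  ballot s (suc (suc c)) * (s ! * suc (s + suc c) !) ≡ suc (suc c) * suc (2 * s + c) ! →
  ballot (suc s) (suc c) * (suc s ! * (suc s + suc c) !) ≡ suc c * (2 * suc s + c) !
ballot-closed-step s c first second = begin
  (ballot (suc s) c + ballot s (suc (suc c))) * (suc s * s ! * (suc (s + suc c) * (s + suc c) !))
    ≡⟨ distribute (ballot (suc s) c) (ballot s (suc (suc c))) (suc s) (s !) (suc (s + suc c)) ((s + suc c) !) ⟩
  suc (s + suc c) * (ballot (suc s) c * (suc s * s ! * (s + suc c) !)) + suc s * (ballot s (suc (suc c)) * (s ! * (suc (s + suc c) * (s + suc c) !)))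
    ≡⟨ cong₂ (λ x y → suc (s + suc c) * x + suc s * y) first second ⟩
  suc (s + suc c) * (c * P) + suc s * (suc (suc c) * P)
    ≡⟨ collect s c P ⟩
  suc c * (suc (suc (2 * s + c)) * P)
    ≡⟨ cong (λ x → suc c * x !) (index s c) ⟩
  suc c * (2 * suc s + c) ! ∎
  where
  open ≡-Reasoning
  P : ℕ
  P = suc (2 * s + c) !
  distribute : ∀ a b x u y v → (a + b) * (x * u * (y * v)) ≡ y * (a * (x * u * v)) + x * (b * (u * (y * v)))
  distribute = ℕ-solve-∀
  collect : ∀ s c p → suc (s + suc c) * (c * p) + suc s * (suc (suc c) * p) ≡ suc c * (suc (suc (2 * s + c)) * p)
  collect = ℕ-solve-∀
  index : ∀ s c → suc (suc (2 * s + c)) ≡ 2 * suc s + c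
  index = ℕ-solve-∀

ballot-closed : ∀ s c → ballot s (suc c) * (s ! * (s + suc c) !) ≡ suc c * (2 * s + c) !
ballot-closed zero c = trans (cong (_* (1 * suc c !)) (ballot-0 (suc c))) (trans (ℕₚ.*-identityˡ (1 * suc c !)) (ℕₚ.*-identityˡ (suc c !)))
ballot-closed (suc s) zero = ballot-closed-step s 0 refl
  (trans (cong (λ x → ballot s 2 * (s ! * x !)) (sym (ℕₚ.+-suc s 1))) (trans (ballot-closed s 1) (cong (λ x → 2 * x !) (ℕₚ.+-suc (2 * s) 0))))
ballot-closed (suc s) (suc c) = ballot-closed-step s (suc c)
  (trans (cong (λ x → ballot (suc s) (suc c) * (suc s ! * x !)) (ℕₚ.+-suc s (suc c)))
    (trans (ballot-closed (suc s) c) (cong (λ x → suc c * x !) (shift s c))))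
  (trans (cong (λ x → ballot s (suc (suc (suc c))) * (s ! * x !)) (sym (ℕₚ.+-suc s (suc (suc c)))))
    (trans (ballot-closed s (suc (suc c))) (cong (λ x → suc (suc (suc c)) * x !) (ℕₚ.+-suc (2 * s) (suc c)))))
  where
  shift : ∀ s c → 2 * suc s + c ≡ suc (2 * s + suc c)
  shift = ℕ-solve-∀

ballot-catalan : ∀ n → ballot n 1 ≡ catalan n
ballot-catalan n = sym (begin
  ((2 * n) C n) / suc n            ≡⟨ cong (_/ suc n) C≡ ⟩
  ballot n 1 * suc n / suc n       ≡⟨ m*n/n≡m (ballot n 1) (suc n) ⟩
  ballot n 1                       ∎)
  where
  open ≡-Reasoning
  n≤2n : n ≤ 2 * n
  n≤2n = ℕₚ.m≤m+n n (n + 0)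
  instance
    n!*n!≢0 : ℕ.NonZero (n ! * (2 * n ∸ n) !)
    n!*n!≢0 = ℕₚ._!*_!≢0 n (2 * n ∸ n)
  2n∸n : 2 * n ∸ n ≡ n
  2n∸n = trans (ℕₚ.m+n∸m≡n n (n + 0)) (ℕₚ.+-identityʳ n)
  factored : (2 * n) ! ≡ ballot n 1 * suc n * (n ! * (2 * n ∸ n) !)
  factored = begin
    (2 * n) !                             ≡⟨ trans (cong _! (sym (ℕₚ.+-identityʳ (2 * n)))) (sym (ℕₚ.*-identityˡ ((2 * n + 0) !))) ⟩
    1 * (2 * n + 0) !                     ≡⟨ sym (ballot-closed n 0) ⟩
    ballot n 1 * (n ! * (n + 1) !)        ≡⟨ cong (λ x → ballot n 1 * (n ! * x !)) (ℕₚ.+-comm n 1) ⟩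
    ballot n 1 * (n ! * (suc n * n !))    ≡⟨ regroup (ballot n 1) (n !) (suc n) ⟩
    ballot n 1 * suc n * (n ! * n !)      ≡⟨ cong (λ x → ballot n 1 * suc n * (n ! * x !)) (sym 2n∸n) ⟩
    ballot n 1 * suc n * (n ! * (2 * n ∸ n) !) ∎
    where
    regroup : ∀ b x y → b * (x * (y * x)) ≡ b * y * (x * x)
    regroup = ℕ-solve-∀
  C≡ : (2 * n) C n ≡ ballot n 1 * suc n
  C≡ = trans (nCk≡n!/k![n-k]! n≤2n) (trans (cong (_/ (n ! * (2 * n ∸ n) !)) factored) (m*n/n≡m (ballot n 1 * suc n) (n ! * (2 * n ∸ n) !)))

-- Reading off codes from lists of vertices

elem : ∀ {m} → List (Fin m) → Fin m → Bool
elem []       v = false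
elem (w ∷ ws) v = ⌊ v ≟ w ⌋ ∨ elem ws v

∈⇒elem : ∀ {m} {v : Fin m} {ws} → v ∈ ws → elem ws v ≡ true
∈⇒elem {v = v} {w ∷ ws} (here refl) rewrite ≟-refl v = refl
∈⇒elem {v = v} {w ∷ ws} (there v∈) rewrite ∈⇒elem v∈ = Boolₚ.∨-zeroʳ ⌊ v ≟ w ⌋

elem⇒∈ : ∀ {m} {v : Fin m} ws → elem ws v ≡ true → v ∈ ws
elem⇒∈ {v = v} (w ∷ ws) eq with v ≟ w
... | yes v≡w = here v≡w
... | no _    = there (elem⇒∈ ws eq)

∑-map : ∀ {m} (y : Fin m → ℕ) {ws} → Unique ws → ∑ (map y ws) ≡ sumℕ (λ v → toℕᵇ (elem ws v) * y v)
∑-map {m} y [] = sym (sumℕ-0 {m})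
∑-map y {w ∷ ws} (w∉ws ∷ ws!) = begin
  y w + ∑ (map y ws)
    ≡⟨ cong₂ _+_ (sym (sumℕ-ind w y)) (∑-map y ws!) ⟩
  sumℕ (λ v → toℕᵇ ⌊ v ≟ w ⌋ * y v) + sumℕ (λ v → toℕᵇ (elem ws v) * y v)
    ≡⟨ sym (sumℕ-+ (λ v → toℕᵇ ⌊ v ≟ w ⌋ * y v) (λ v → toℕᵇ (elem ws v) * y v)) ⟩
  sumℕ (λ v → toℕᵇ ⌊ v ≟ w ⌋ * y v + toℕᵇ (elem ws v) * y v)
    ≡⟨ sumℕ-cong merge ⟩
  sumℕ (λ v → toℕᵇ (elem (w ∷ ws) v) * y v) ∎
  where
  open ≡-Reasoning
  merge : ∀ v → toℕᵇ ⌊ v ≟ w ⌋ * y v + toℕᵇ (elem ws v) * y v ≡ toℕᵇ (elem (w ∷ ws) v) * y v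
  merge v with v ≟ w
  ... | no _ = refl
  ... | yes refl = trans (cong (λ b → 1 * y v + toℕᵇ b * y v) (≢true⇒≡false λ eq → All.lookup w∉ws (elem⇒∈ ws eq) refl)) (ℕₚ.+-identityʳ (1 * y v))

length-elem : ∀ {m} {ws : List (Fin m)} → Unique ws → length ws ≡ count (elem ws)
length-elem {ws = ws} ws! = trans (ones ws) (trans (∑-map (λ _ → 1) ws!) (sumℕ-cong λ v → ℕₚ.*-identityʳ (toℕᵇ (elem ws v))))
  where
  ones : ∀ {A : Set} (ws : List A) → length ws ≡ ∑ (map (λ _ → 1) ws)
  ones []       = refl
  ones (w ∷ ws) = cong suc (ones ws)

map-≡⇒≡ : ∀ {A B : Set} {y y′ : A → B} ws → map y ws ≡ map y′ ws → ∀ {v} → v ∈ ws → y v ≡ y′ v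
map-≡⇒≡ (w ∷ ws) eq (here refl) = Listₚ.∷-injectiveˡ eq
map-≡⇒≡ (w ∷ ws) eq (there v∈)  = map-≡⇒≡ ws (Listₚ.∷-injectiveʳ eq) v∈

ClosedSuffixes : ∀ {m} → Digraph m → List (Fin m) → Set
ClosedSuffixes R []       = ⊤
ClosedSuffixes R (w ∷ ws) = (∀ t h → R t h ≡ true → h ∈ w ∷ ws → t ∈ w ∷ ws) × ClosedSuffixes R ws

-- The tail of an arrow stands later in the list than its head, so a suffix that contains the head
-- contains the tail.
sorted⇒closed : ∀ {m} (R : Digraph m) (_≺_ : Fin m → Fin m → Set) → (∀ {u v w} → u ≺ v → v ≺ w → u ≺ w) → (∀ {v} → ¬ v ≺ v) →
  ∀ {ws} → AllPairs _≺_ ws → (∀ t h → R t h ≡ true → h ∈ ws → t ∈ ws × h ≺ t) → ClosedSuffixes R ws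
sorted⇒closed R _≺_ ≺-trans ≺-irrefl {[]} _ _ = tt
sorted⇒closed R _≺_ ≺-trans ≺-irrefl {w ∷ ws} (w≺ws ∷ sorted) up =
  (λ t h Rth h∈ → proj₁ (up t h Rth h∈)) , sorted⇒closed R _≺_ ≺-trans ≺-irrefl sorted up′
  where
  up′ : ∀ t h → R t h ≡ true → h ∈ ws → t ∈ ws × h ≺ t
  up′ t h Rth h∈ with up t h Rth (there h∈)
  ... | here refl , h≺t = contradiction (≺-trans (All.lookup w≺ws h∈) h≺t) ≺-irrefl
  ... | there t∈  , h≺t = t∈ , h≺t

-- Closedness places all arrows with head in a suffix inside that suffix. Their number is the sum of
-- the indegrees there, and a forest has fewer arrows than vertices.
Łukasiewicz-indegrees : ∀ {m} {R : Digraph m} → Sparse R → ∀ {ws} → Unique ws → ClosedSuffixes R ws → Łukasiewicz (map (indegree R) ws)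
Łukasiewicz-indegrees sparse {[]} _ _ = tt
Łukasiewicz-indegrees {R = R} sparse {w ∷ ws} uniq@(_ ∷ ws!) (closed , closeds) =
  subst (∑ (map (indegree R) (w ∷ ws)) ≤_) (sym (Listₚ.length-map (indegree R) ws)) (ℕₚ.≤-pred bound) ,
  Łukasiewicz-indegrees sparse ws! closeds
  where
  U = elem (w ∷ ws)
  term : ∀ t h → toℕᵇ (U h) * toℕᵇ (R t h) ≤ toℕᵇ (within R U t h)
  term t h with R t h in Rth | U h in Uh
  ... | false | false = z≤n
  ... | false | true  = z≤n
  ... | true  | false = z≤n
  ... | true  | true  rewrite ∈⇒elem (closed t h Rth (elem⇒∈ (w ∷ ws) Uh)) = ℕₚ.≤-refl
  bound : ∑ (map (indegree R) (w ∷ ws)) < suc (length ws)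
  bound = begin-strict
    ∑ (map (indegree R) (w ∷ ws))
      ≡⟨ trans (∑-map (indegree R) uniq) (sumℕ-cong λ h → sym (sumℕ-* (toℕᵇ (U h)) (λ t → toℕᵇ (R t h)))) ⟩
    sumℕ (λ h → sumℕ (λ t → toℕᵇ (U h) * toℕᵇ (R t h)))
      ≡⟨ sumℕ-comm (λ h t → toℕᵇ (U h) * toℕᵇ (R t h)) ⟩
    sumℕ (λ t → sumℕ (λ h → toℕᵇ (U h) * toℕᵇ (R t h)))
      ≤⟨ sumℕ-mono (λ t → sumℕ-mono (term t)) ⟩
    size (within R U)
      <⟨ sparse U w (∈⇒elem {ws = w ∷ ws} (here refl)) ⟩
    count U
      ≡⟨ sym (length-elem uniq) ⟩
    suc (length ws) ∎
    where
    open ℕₚ.≤-Reasoning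

transpose : ∀ {m} → Digraph m → Digraph m
transpose R t h = R h t

Sparse-transpose : ∀ {m} {R : Digraph m} → Sparse R → Sparse (transpose R)
Sparse-transpose {R = R} sparse U u Uu = ℕₚ.≤-<-trans (ℕₚ.≤-reflexive
  (trans (sumℕ-comm (λ t h → toℕᵇ (R h t ∧ U t ∧ U h))) (sumℕ-cong λ h → sumℕ-cong λ t → cong (λ b → toℕᵇ (R h t ∧ b)) (Boolₚ.∧-comm (U t) (U h)))))
  (sparse U u Uu)

Łukasiewicz-≤ : ∀ l → Łukasiewicz l → ∑ l ≤ length l
Łukasiewicz-≤ []      _        = z≤n
Łukasiewicz-≤ (x ∷ l) (le , _) = ℕₚ.m≤n⇒m≤1+n le

Łukasiewicz-++ : ∀ xs ys → Łukasiewicz xs → Łukasiewicz ys → Łukasiewicz (xs ++ ys)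
Łukasiewicz-++ []       ys _ ły = ły
Łukasiewicz-++ (x ∷ xs) ys (le , łx) ły = bound , Łukasiewicz-++ xs ys łx ły
  where
  bound : x + ∑ (xs ++ ys) ≤ length (xs ++ ys)
  bound = ℕₚ.≤-trans (ℕₚ.≤-reflexive (trans (cong (x +_) (∑-++ xs ys)) (sym (ℕₚ.+-assoc x (∑ xs) (∑ ys)))))
    (ℕₚ.≤-trans (ℕₚ.+-mono-≤ le (Łukasiewicz-≤ ys ły)) (ℕₚ.≤-reflexive (sym (Listₚ.length-++ xs))))

-- If one left part were a proper prefix of the other, the rest of the longer one would be a nonempty suffix
-- with length equal to its sum.
split-unique : ∀ xs {ys} xs′ {ys′} → Łukasiewicz xs → Łukasiewicz xs′ → ∑ xs + length xs′ ≡ ∑ xs′ + length xs →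
  xs ++ ys ≡ xs′ ++ ys′ → xs ≡ xs′
split-unique [] [] _ _ _ _ = refl
split-unique [] (x ∷ xs′) _ (le , _) deficits _ =
  contradiction (ℕₚ.≤-trans (ℕₚ.≤-reflexive (trans deficits (ℕₚ.+-identityʳ _))) le) ℕₚ.1+n≰n
split-unique (x ∷ xs) [] (le , _) _ deficits _ =
  contradiction (ℕₚ.≤-trans (ℕₚ.≤-reflexive (trans (sym deficits) (ℕₚ.+-identityʳ _))) le) ℕₚ.1+n≰n
split-unique (x ∷ xs) (x′ ∷ xs′) (_ , łx) (_ , łx′) deficits eq with Listₚ.∷-injectiveˡ eq
... | refl = cong (x ∷_) (split-unique xs xs′ łx łx′ deficits′ (Listₚ.∷-injectiveʳ eq))
  where
  deficits′ : ∑ xs + length xs′ ≡ ∑ xs′ + length xs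
  deficits′ = ℕₚ.+-cancelˡ-≡ x _ _ (ℕₚ.suc-injective (begin
    suc (x + (∑ xs + length xs′)) ≡⟨ cong suc (sym (ℕₚ.+-assoc x (∑ xs) (length xs′))) ⟩
    suc (x + ∑ xs + length xs′)   ≡⟨ sym (ℕₚ.+-suc (x + ∑ xs) (length xs′)) ⟩
    x + ∑ xs + suc (length xs′)   ≡⟨ deficits ⟩
    x + ∑ xs′ + suc (length xs)   ≡⟨ ℕₚ.+-suc (x + ∑ xs′) (length xs) ⟩
    suc (x + ∑ xs′ + length xs)   ≡⟨ cong suc (ℕₚ.+-assoc x (∑ xs′) (length xs)) ⟩
    suc (x + (∑ xs′ + length xs)) ∎))
    where open ≡-Reasoning

count-below : ∀ {m} k → k ≤ m → count {m} (λ v → toℕ v <ᵇ k) ≡ k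
count-below {m}     zero    _         = sumℕ-0 {m}
count-below {suc m} (suc k) (s≤s k≤m) = cong suc (count-below k k≤m)

count-not : ∀ {m} (p : Fin m → Bool) → count p + count (not ∘ p) ≡ m
count-not {m} p = trans (sym (sumℕ-+ (toℕᵇ ∘ p) (toℕᵇ ∘ not ∘ p))) (trans (sumℕ-cong (λ v → one (p v))) (count-true {m}))
  where
  one : ∀ b → toℕᵇ b + toℕᵇ (not b) ≡ toℕᵇ true
  one true  = refl
  one false = refl

-- Enumeration of arrow sets

module _ {A : Set} where
  ∈-allVecs : {xs : List A} → (∀ x → x ∈ xs) → ∀ k (v : Vec A k) → v ∈ allVecs xs k
  ∈-allVecs all zero    Vec.[]       = here refl
  ∈-allVecs {xs} all (suc k) (x Vec.∷ v) = ∈ₚ.∈-concatMap⁺ (λ x → map (x Vec.∷_) (allVecs xs k))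
    (Any.map (λ { refl → ∈ₚ.∈-map⁺ (x Vec.∷_) (∈-allVecs all k v) }) (all x))

  allVecs-unique : {xs : List A} → Unique xs → ∀ k → Unique (allVecs xs k)
  allVecs-unique xs! zero = [] ∷ []
  allVecs-unique {xs} xs! (suc k) = blocks xs!
    where
    blocks : ∀ {zs} → Unique zs → Unique (concatMap (λ x → map (x Vec.∷_) (allVecs xs k)) zs)
    blocks [] = []
    blocks {z ∷ zs} (z∉ ∷ zs!) = Uniqueₚ.++⁺ (Uniqueₚ.map⁺ (λ { refl → refl }) (allVecs-unique xs! k)) (blocks zs!) disjoint
      where
      later : ∀ zs {v} → v ∈ concatMap (λ x → map (x Vec.∷_) (allVecs xs k)) zs → Vec.head v ∈ zs
      later (z ∷ zs) v∈ with ∈ₚ.∈-++⁻ (map (z Vec.∷_) (allVecs xs k)) v∈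
      ... | inj₂ v∈₂ = there (later zs v∈₂)
      ... | inj₁ v∈₁ with ∈ₚ.∈-map⁻ (z Vec.∷_) v∈₁
      ...   | u , _ , refl = here refl
      disjoint : ∀ {v} → v ∈ map (z Vec.∷_) (allVecs xs k) × v ∈ concatMap (λ x → map (x Vec.∷_) (allVecs xs k)) zs → ⊥
      disjoint (v∈₁ , v∈₂) with ∈ₚ.∈-map⁻ (z Vec.∷_) v∈₁
      ... | u , _ , refl = All.lookup z∉ (later zs v∈₂) refl

∈-allArrowSets : ∀ {n} (S : ArrowSet n) → S ∈ allArrowSets n
∈-allArrowSets S = ∈-allVecs (∈-allVecs (λ { true → here refl ; false → there (here refl) }) _) _ S

allArrowSets-unique : ∀ n → Unique (allArrowSets n)
allArrowSets-unique n = allVecs-unique (allVecs-unique (((λ ()) ∷ []) ∷ [] ∷ []) (suc n)) (suc n)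

Vec-ext : ∀ {A : Set} {k} {u v : Vec A k} → (∀ i → lookup u i ≡ lookup v i) → u ≡ v
Vec-ext {u = u} {v} eq = trans (sym (Vecₚ.tabulate∘lookup u)) (trans (Vecₚ.tabulate-cong eq) (Vecₚ.tabulate∘lookup v))

member-ext : ∀ {n} {S S′ : ArrowSet n} → (∀ t h → member S t h ≡ member S′ t h) → S ≡ S′
member-ext eq = Vec-ext λ t → Vec-ext (eq t)

∑-map-tabulate : ∀ {m} {A : Set} (y : A → ℕ) (e : Fin m → A) → ∑ (map y (List.tabulate e)) ≡ sumℕ (y ∘ e)
∑-map-tabulate {zero}  y e = refl
∑-map-tabulate {suc m} y e = cong (y (e zero) +_) (∑-map-tabulate y (e ∘ suc))

countArrows≡size : ∀ {n} (p : Digraph (suc n)) (S : ArrowSet n) → countArrows p S ≡ size (λ t h → member S t h ∧ p t h)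
countArrows≡size {n} p S = trans (∑-map-tabulate {suc n} (λ t → length (filterᵇ (λ h → member S t h ∧ p t h) (allFin (suc n)))) id)
  (sumℕ-cong λ t → length-filterᵇ-tabulate (λ h → member S t h ∧ p t h) id)

size-+ : ∀ {m} {R R₁ R₂ : Digraph m} → (∀ t h → toℕᵇ (R t h) ≡ toℕᵇ (R₁ t h) + toℕᵇ (R₂ t h)) → size R ≡ size R₁ + size R₂
size-+ {R₁ = R₁} {R₂} eq = trans (sumℕ-cong λ t → trans (sumℕ-cong (eq t)) (sumℕ-+ (toℕᵇ ∘ R₁ t) (toℕᵇ ∘ R₂ t)))
  (sumℕ-+ (λ t → count (R₁ t)) (λ t → count (R₂ t)))

numForward+numBackward : ∀ {n} {E : EdgeRule n} (S : ArrowSet n) → Clique E (member S) → numForward S + numBackward S ≡ size (member S)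
numForward+numBackward S cl = trans (cong₂ _+_ (countArrows≡size (λ t h → toℕ t <ᵇ toℕ h) S) (countArrows≡size (λ t h → toℕ h <ᵇ toℕ t) S))
  (sym (size-+ {R = member S} {λ t h → member S t h ∧ (toℕ t <ᵇ toℕ h)} {λ t h → member S t h ∧ (toℕ h <ᵇ toℕ t)} split))
  where
  split : ∀ t h → toℕᵇ (member S t h) ≡ toℕᵇ (member S t h ∧ (toℕ t <ᵇ toℕ h)) + toℕᵇ (member S t h ∧ (toℕ h <ᵇ toℕ t))
  split t h with member S t h in Sth
  ... | false = refl
  ... | true with ℕₚ.<-cmp (toℕ t) (toℕ h)
  ...   | tri< t<h _ h≮t = cong₂ (λ a b → toℕᵇ a + toℕᵇ b) (sym (<⇒<ᵇ-true t<h)) (sym (≮⇒<ᵇ-false h≮t))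
  ...   | tri> t≮h _ h<t = cong₂ (λ a b → toℕᵇ a + toℕᵇ b) (sym (≮⇒<ᵇ-false t≮h)) (sym (<⇒<ᵇ-true h<t))
  ...   | tri≈ _ t≡h _ = contradiction (Finₚ.toℕ-injective t≡h) (loopless cl Sth)

-- Facets with a forward arrow

Bool-ext : ∀ {a b} → (a ≡ true → b ≡ true) → (b ≡ true → a ≡ true) → a ≡ b
Bool-ext {true}  {b}     f g = sym (f refl)
Bool-ext {false} {true}  f g = g refl
Bool-ext {false} {false} f g = refl

elem-filterᵇ : ∀ {m} (p : Fin m → Bool) {xs} → (∀ v → v ∈ xs) → ∀ v → elem (filterᵇ p xs) v ≡ p v
elem-filterᵇ p {xs} all v = Bool-ext (λ eq → proj₂ (∈-filterᵇ⁻ p {xs = xs} (elem⇒∈ (filterᵇ p xs) eq))) (λ pv → ∈⇒elem (∈-filterᵇ⁺ p (all v) pv))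

filterᵇ-unique : ∀ {A : Set} (p : A → Bool) {xs} → Unique xs → Unique (filterᵇ p xs)
filterᵇ-unique p = Uniqueₚ.filter⁺ (Bool.T? ∘ p)

∑-map-filterᵇ : ∀ {m} (y : Fin m → ℕ) (p : Fin m → Bool) {xs} → Unique xs → (∀ v → v ∈ xs) →
  ∑ (map y (filterᵇ p xs)) ≡ sumℕ (λ v → toℕᵇ (p v) * y v)
∑-map-filterᵇ y p xs! all = trans (∑-map y (filterᵇ-unique p xs!)) (sumℕ-cong λ v → cong (λ b → toℕᵇ b * y v) (elem-filterᵇ p all v))

length-filterᵇ-all : ∀ {m} (p : Fin m → Bool) {xs} → Unique xs → (∀ v → v ∈ xs) → length (filterᵇ p xs) ≡ count p
length-filterᵇ-all p xs! all = trans (length-elem (filterᵇ-unique p xs!)) (sumℕ-cong λ v → cong toℕᵇ (elem-filterᵇ p all v))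

descending : ∀ m → List (Fin m)
descending m = List.tabulate Fin.opposite

∈-descending : ∀ {m} (v : Fin m) → v ∈ descending m
∈-descending v = subst (_∈ _) (Finₚ.opposite-involutive v) (∈ₚ.∈-tabulate⁺ (Fin.opposite v))

opposite-anti : ∀ {m} {i j : Fin m} → i Fin.< j → Fin.opposite j Fin.< Fin.opposite i
opposite-anti {m} {i} {j} i<j = subst₂ _<_ (sym (Finₚ.opposite-prop j)) (sym (Finₚ.opposite-prop i)) (ℕₚ.∸-monoʳ-< (s≤s i<j) (Finₚ.toℕ<n j))

descending-sorted : ∀ m → AllPairs (λ u v → v Fin.< u) (descending m)
descending-sorted m = AllPairsₚ.tabulate⁺-< opposite-anti

descending-unique : ∀ m → Unique (descending m)
descending-unique m = AllPairs.map (λ { v<u refl → ℕₚ.<-irrefl refl v<u }) (descending-sorted m)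

ascending-sorted : ∀ m → AllPairs Fin._<_ (allFin m)
ascending-sorted m = AllPairsₚ.tabulate⁺-< id

filterᵇ-sorted : ∀ {A : Set} {_≺_ : A → A → Set} (p : A → Bool) {xs} → AllPairs _≺_ xs → AllPairs _≺_ (filterᵇ p xs)
filterᵇ-sorted p = AllPairsₚ.filter⁺ (Bool.T? ∘ p)

module _ {m : ℕ} where

  left : Fin m → Fin m → Bool
  left G v = toℕ v <ᵇ toℕ G

  -- Wider than the crossing of the gap: arrows with tail on the right side are included. At a gap,
  -- `upper` therefore consists of the forward arrows and the backward arrows on the right, and
  -- `lower` of the backward arrows on the left.
  crossing : Fin m → Digraph m
  crossing G t h = (toℕ t <ᵇ toℕ h) ∨ not (left G t)

  lower upper collapsed : Digraph m → Fin m → Digraph m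
  active : Digraph m → Fin m → Fin m → Bool
  lower R G t h = R t h ∧ not (crossing G t h)
  upper R G t h = R t h ∧ crossing G t h
  active R G t = left G t ∧ (0 <ᵇ outdegree (upper R G) t)
  -- All heads beyond the gap are contracted to the vertex G.
  collapsed R G t h = lower R G t h ∨ (active R G t ∧ ⌊ h ≟ G ⌋)

  lefts rights : Fin m → List (Fin m)
  lefts G  = filterᵇ (left G) (allFin m)
  rights G = filterᵇ (not ∘ left G) (descending m)

  actives : Digraph m → Fin m → List (Fin m)
  actives R G = filterᵇ (active R G) (allFin m)

  leftCode rightCode forwardCode : Digraph m → Fin m → List ℕ
  leftCode R G    = map (indegree (lower R G)) (lefts G)
  rightCode R G   = map (outdegree (upper R G)) (rights G)
  forwardCode R G = map (outdegree (upper R G)) (actives R G)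

  lower⁻ : ∀ {R : Digraph m} {G t h} → lower R G t h ≡ true → R t h ≡ true × h Fin.≤ t × t Fin.< G
  lower⁻ {R} {G} {t} {h} eq with ∧-true⁻ {R t h} eq
  ... | Rth , ¬crossing with toℕ t <ᵇ toℕ h in t<h | toℕ t <ᵇ toℕ G in t<G
  ...   | false | true = Rth , ℕₚ.≮⇒≥ (λ lt → contradiction (trans (sym (<⇒<ᵇ-true lt)) t<h) λ ()) , <ᵇ-true⇒< t<G

  upper⁻ : ∀ {R : Digraph m} {G t h} → upper R G t h ≡ true → R t h ≡ true × (t Fin.< h ⊎ G Fin.≤ t)
  upper⁻ {R} {G} {t} {h} eq with ∧-true⁻ {R t h} eq
  ... | Rth , cross with toℕ t <ᵇ toℕ h in t<h | toℕ t <ᵇ toℕ G in t<G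
  ...   | true  | _     = Rth , inj₁ (<ᵇ-true⇒< t<h)
  ...   | false | false = Rth , inj₂ (ℕₚ.≮⇒≥ (λ lt → contradiction (trans (sym (<⇒<ᵇ-true lt)) t<G) λ ()))

  lower+upper : ∀ (R : Digraph m) G t h → toℕᵇ (R t h) ≡ toℕᵇ (lower R G t h) + toℕᵇ (upper R G t h)
  lower+upper R G t h with R t h | crossing G t h
  ... | false | _     = refl
  ... | true  | true  = refl
  ... | true  | false = refl

module Codes {n : ℕ} (1≤n : 1 ≤ n) {E : EdgeRule n} (symmetric : Symmetric E) (uniform : Uniform E)
             (tri : IsTriangulationOfBoundary E) (simion : InSimionClass E)
             (THTH-nests : Nests E T H T H) (HTHT-not : DoesNotNest E H T H T) where
  open Geometry tri
  open Determined tri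
  open Rules 1≤n symmetric uniform tri simion THTH-nests HTHT-not

  private
    N = suc n

  -- The facet with indegree n at h consists of all arrows into h.
  common-head : ∀ {s s′ h} → s ≢ h → s′ ≢ h → s ≢ s′ → E s h s′ h ≡ true
  common-head {s} {s′} {h} s≢h s′≢h s≢s′ = star (facet-with-indegrees tri 1≤n (λ v → toℕᵇ ⌊ v ≟ h ⌋ * n) (sumℕ-ind h (λ _ → n)))
    where
    count-others : count (λ t → not ⌊ t ≟ h ⌋) ≡ n
    count-others = ℕₚ.suc-injective (trans (cong (_+ count (λ t → not ⌊ t ≟ h ⌋)) (sym (sumℕ-ind′ h))) (count-not (λ t → ⌊ t ≟ h ⌋)))
    star : (Σ (ArrowSet n) λ S → IsFace E S × (∀ v → indegree (member S) v ≡ toℕᵇ ⌊ v ≟ h ⌋ * n)) → E s h s′ h ≡ true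
    star (S , face , deg) = adjacent cl (full s s≢h) (full s′ s′≢h) (s≢s′ ∘ proj₁)
      where
      cl = IsFace⇒Clique S face
      indegree-h : indegree (member S) h ≡ n
      indegree-h = trans (deg h) (trans (cong (λ b → toℕᵇ b * n) (≟-refl h)) (ℕₚ.*-identityˡ n))
      entries : ∀ t → toℕᵇ (member S t h) ≡ toℕᵇ (not ⌊ t ≟ h ⌋)
      entries = sumℕ-≡⇒≡ (λ t → toℕᵇ-mono (λ Sth → cong not (≟-≢ (loopless cl Sth)))) (ℕₚ.≤-reflexive (trans count-others (sym indegree-h)))
      full : ∀ t → t ≢ h → member S t h ≡ true
      full t t≢h with member S t h | trans (entries t) (cong (toℕᵇ ∘ not) (≟-≢ t≢h))
      ... | true | _ = refl

  module Facet {R : Digraph N} (cl : Clique E R) (sizeR : size R ≡ n) {G : Fin N} (isGap : Gap.IsGap cl G) where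
    open Gap.IsGap isGap

    LB D CL : Digraph N
    LB = lower R G
    D  = upper R G
    CL  = collapsed R G

    -- The collapsed part lives on the left side and the contraction vertex `G`, the upper part on
    -- the right side and the active tails. The active tails thus belong to both sets.
    UC UD : Fin N → Bool
    UC v = toℕ v <ᵇ suc (toℕ G)
    UD v = active R G v ∨ not (left G v)

    left⁺ : ∀ {v} → v Fin.< G → left G v ≡ true
    left⁺ = <⇒<ᵇ-true

    right⁺ : ∀ {v} → G Fin.≤ v → not (left G v) ≡ true
    right⁺ G≤v = cong not (≮⇒<ᵇ-false (ℕₚ.≤⇒≯ G≤v))

    right⁻ : ∀ {v} → not (left G v) ≡ true → G Fin.≤ v
    right⁻ {v} eq = ℕₚ.≮⇒≥ λ lt → contradiction (trans (sym (left⁺ {v} lt)) (not-true⁻ eq)) λ ()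

    LB-backward : ∀ {t h} → LB t h ≡ true → R t h ≡ true × h Fin.< t × t Fin.< G
    LB-backward {t} {h} eq with lower⁻ {R = R} {G} {t} {h} eq
    ... | Rth , h≤t , t<G = Rth , ℕₚ.≤∧≢⇒< h≤t (λ h≡t → loopless cl Rth (sym (Finₚ.toℕ-injective h≡t))) , t<G

    D-cases : ∀ {t h} → D t h ≡ true → (t Fin.< G × G Fin.≤ h × t Fin.< h) ⊎ (G Fin.≤ t × G Fin.≤ h × h Fin.< t)
    D-cases {t} {h} eq with upper⁻ {R = R} {G} {t} {h} eq
    ... | Rth , inj₁ t<h = let t<G , G≤h = forward-crosses Rth t<h in inj₁ (t<G , G≤h , t<h)
    ... | Rth , inj₂ G≤t with ℕₚ.<-cmp (toℕ t) (toℕ h)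
    ...   | tri< t<h _ _ = contradiction (proj₁ (forward-crosses Rth t<h)) (ℕₚ.≤⇒≯ G≤t)
    ...   | tri≈ _ t≡h _ = contradiction (Finₚ.toℕ-injective t≡h) (loopless cl Rth)
    ...   | tri> _ _ h<t with backward-avoids Rth h<t
    ...     | inj₁ t<G = contradiction t<G (ℕₚ.≤⇒≯ G≤t)
    ...     | inj₂ G≤h = inj₂ (G≤t , G≤h , h<t)

    active⁺ : ∀ {t h} → D t h ≡ true → t Fin.< G → active R G t ≡ true
    active⁺ {t} {h} Dth t<G = cong₂ _∧_ (left⁺ t<G) (<⇒<ᵇ-true (count-≥1 (D t) h Dth))

    active⁻ : ∀ {t} → active R G t ≡ true → t Fin.< G × 1 ≤ outdegree D t
    active⁻ {t} eq with ∧-true⁻ {left G t} eq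
    ... | l , o = <ᵇ-true⇒< l , <ᵇ-true⇒< o

    active-arrow : ∀ {t} → active R G t ≡ true → t Fin.< G × ∃ λ q → R t q ≡ true × G Fin.≤ q
    active-arrow {t} eq with active⁻ {t} eq
    ... | t<G , 1≤out with count≥1⇒∃ (D t) 1≤out
    ...   | q , Dtq with D-cases {t} {q} Dtq
    ...     | inj₁ (_ , G≤q , _) = t<G , q , proj₁ (upper⁻ {R = R} {G} {t} {q} Dtq) , G≤q
    ...     | inj₂ (G≤t , _)     = contradiction t<G (ℕₚ.≤⇒≯ G≤t)

    C-cases : ∀ {t h} → CL t h ≡ true → LB t h ≡ true ⊎ (active R G t ≡ true × h ≡ G)
    C-cases {t} {h} eq with LB t h
    ... | true  = inj₁ refl
    ... | false with ∧-true⁻ {active R G t} eq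
    ...   | a , h≟G = inj₂ (a , ≟-true⁻ h≟G)

    -- A head beyond the gap can be moved to `G` because it compares in the same way with all
    -- vertices on the left. Uniformity then carries adjacency over to the contracted arrow.
    same-side-pattern : ∀ {t h s q} → t Fin.< G → h Fin.< G → s Fin.< G → G Fin.≤ q → SamePattern (quad t h s G) (quad t h s q)
    same-side-pattern {t} {h} {s} {q} t<G h<G s<G G≤q = compare
      where
      above : ∀ {v} → v Fin.< G → (toℕ v <ᵇ toℕ G) ≡ (toℕ v <ᵇ toℕ q)
      above v<G = trans (<⇒<ᵇ-true v<G) (sym (<⇒<ᵇ-true (ℕₚ.<-≤-trans v<G G≤q)))
      below : ∀ {v} → v Fin.< G → (toℕ G <ᵇ toℕ v) ≡ (toℕ q <ᵇ toℕ v)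
      below v<G = trans (≮⇒<ᵇ-false (ℕₚ.<-asym v<G)) (sym (≮⇒<ᵇ-false (ℕₚ.<-asym (ℕₚ.<-≤-trans v<G G≤q))))
      compare : SamePattern (quad t h s G) (quad t h s q)
      compare zero zero = refl
      compare zero (suc zero) = refl
      compare zero (suc (suc zero)) = refl
      compare zero (suc (suc (suc zero))) = above t<G
      compare (suc zero) zero = refl
      compare (suc zero) (suc zero) = refl
      compare (suc zero) (suc (suc zero)) = refl
      compare (suc zero) (suc (suc (suc zero))) = above h<G
      compare (suc (suc zero)) zero = refl
      compare (suc (suc zero)) (suc zero) = refl
      compare (suc (suc zero)) (suc (suc zero)) = refl
      compare (suc (suc zero)) (suc (suc (suc zero))) = above s<G
      compare (suc (suc (suc zero))) zero = below t<G
      compare (suc (suc (suc zero))) (suc zero) = below h<G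
      compare (suc (suc (suc zero))) (suc (suc zero)) = below s<G
      compare (suc (suc (suc zero))) (suc (suc (suc zero))) = trans (≮⇒<ᵇ-false {toℕ G} {toℕ G} (ℕₚ.<-irrefl refl)) (sym (≮⇒<ᵇ-false {toℕ q} {toℕ q} (ℕₚ.<-irrefl refl)))

    -- Two lower arrows are adjacent in `R` already. A contracted arrow s→G is compared with a lower
    -- arrow through some arrow s→q of `R` with the same pattern. Two contracted arrows share the
    -- head `G`.
    C-clique : Clique E CL
    C-clique = clique (λ {t} {h} eq → loop (C-cases {t} {h} eq)) (λ {t₁} {h₁} {t₂} {h₂} eq₁ eq₂ → adj (C-cases {t₁} {h₁} eq₁) (C-cases {t₂} {h₂} eq₂))
      where
      loop : ∀ {t h} → LB t h ≡ true ⊎ (active R G t ≡ true × h ≡ G) → t ≢ h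
      loop {t} {h} (inj₁ lb) = loopless cl (proj₁ (LB-backward {t} {h} lb))
      loop (inj₂ (a , refl)) = <⇒≢ (proj₁ (active-arrow a))
      mixed : ∀ {t h s} → LB t h ≡ true → active R G s ≡ true → E t h s G ≡ true
      mixed {t} {h} {s} lb a with LB-backward {t} {h} lb | active-arrow {s} a
      ... | Rth , h<t , t<G | s<G , q , Rsq , G≤q =
        trans (uniform t h s G t h s q (loopless cl Rth) (<⇒≢ s<G) (loopless cl Rth) (loopless cl Rsq)
                (same-side-pattern t<G (ℕₚ.<-trans h<t t<G) s<G G≤q))
              (adjacent cl Rth Rsq λ { (_ , refl) → ℕₚ.<⇒≱ (ℕₚ.<-trans h<t t<G) G≤q })
      adj : ∀ {t₁ h₁ t₂ h₂} → LB t₁ h₁ ≡ true ⊎ (active R G t₁ ≡ true × h₁ ≡ G) → LB t₂ h₂ ≡ true ⊎ (active R G t₂ ≡ true × h₂ ≡ G) →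
            ¬ (t₁ ≡ t₂ × h₁ ≡ h₂) → E t₁ h₁ t₂ h₂ ≡ true
      adj {t₁} {h₁} {t₂} {h₂} (inj₁ lb₁) (inj₁ lb₂) ≢ = adjacent cl (proj₁ (LB-backward {t₁} {h₁} lb₁)) (proj₁ (LB-backward {t₂} {h₂} lb₂)) ≢
      adj {t₁} {h₁} (inj₁ lb) (inj₂ (a , refl)) ≢ = mixed {t₁} {h₁} lb a
      adj {t₁} {h₁} {t₂} {h₂} (inj₂ (a , refl)) (inj₁ lb) ≢ = trans (symmetric t₁ G t₂ h₂) (mixed {t₂} {h₂} lb a)
      adj (inj₂ (a₁ , refl)) (inj₂ (a₂ , refl)) ≢ = common-head (<⇒≢ (proj₁ (active-arrow a₁))) (<⇒≢ (proj₁ (active-arrow a₂))) λ t≡ → ≢ (t≡ , refl)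

    C-inside : Inside CL UC
    C-inside t h eq with C-cases {t} {h} eq
    ... | inj₁ lb = let _ , h<t , t<G = LB-backward {t} {h} lb in
      <⇒<ᵇ-true (ℕₚ.m≤n⇒m≤1+n t<G) , <⇒<ᵇ-true (ℕₚ.m≤n⇒m≤1+n (ℕₚ.<-trans h<t t<G))
    ... | inj₂ (a , refl) = <⇒<ᵇ-true (ℕₚ.m≤n⇒m≤1+n (proj₁ (active-arrow a))) , <⇒<ᵇ-true {toℕ G} ℕₚ.≤-refl

    D-clique : Clique E D
    D-clique = Clique-resp (λ t h eq → proj₁ (∧-true⁻ {R t h} eq)) cl

    right-UD : ∀ v → G Fin.≤ v → UD v ≡ true
    right-UD v G≤v = trans (cong (active R G v ∨_) (right⁺ G≤v)) (Boolₚ.∨-zeroʳ (active R G v))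

    D-inside : Inside D UD
    D-inside t h eq with D-cases {t} {h} eq
    ... | inj₁ (t<G , G≤h , _) = cong (_∨ not (left G t)) (active⁺ {t} {h} eq t<G) , right-UD h G≤h
    ... | inj₂ (G≤t , G≤h , _) = right-UD t G≤t , right-UD h G≤h

    Inside-size : ∀ {Q : Digraph N} {U} → Clique E Q → Inside Q U → ∀ u → U u ≡ true → size Q < count U
    Inside-size {Q} {U} clQ inside u Uu = ℕₚ.≤-<-trans
      (size-mono {R = Q} λ t h Qth → let Ut , Uh = inside t h Qth in within⁺ Q U Qth Ut Uh) (clique-sparse tri clQ U u Uu)

    size-split : size LB + size D ≡ n
    size-split = trans (sym (size-+ {R = R} {LB} {D} (lower+upper R G))) sizeR

    count-left : count (left G) ≡ toℕ G
    count-left = count-below (toℕ G) (ℕₚ.<⇒≤ (Finₚ.toℕ<n G))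

    count-sides : toℕ G + count (not ∘ left G) ≡ N
    count-sides = trans (cong (_+ count (not ∘ left G)) (sym count-left)) (count-not (left G))

    size-C : size CL ≡ size LB + count (active R G)
    size-C = trans (size-+ {R = CL} {LB} {λ t h → active R G t ∧ ⌊ h ≟ G ⌋} split) (cong (size LB +_) (sumℕ-cong row))
      where
      split : ∀ t h → toℕᵇ (CL t h) ≡ toℕᵇ (LB t h) + toℕᵇ (active R G t ∧ ⌊ h ≟ G ⌋)
      split t h = disjoint (LB t h) (active R G t ∧ ⌊ h ≟ G ⌋) λ lb ah →
        let _ , h<t , t<G = LB-backward {t} {h} lb in <⇒≢ (ℕₚ.<-trans h<t t<G) (≟-true⁻ (proj₂ (∧-true⁻ {active R G t} ah)))
        where
        disjoint : ∀ a b → (a ≡ true → b ≡ true → ⊥) → toℕᵇ (a ∨ b) ≡ toℕᵇ a + toℕᵇ b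
        disjoint true  true  ¬both = ⊥-elim (¬both refl refl)
        disjoint true  false _ = refl
        disjoint false b     _ = refl
      row : ∀ t → count (λ h → active R G t ∧ ⌊ h ≟ G ⌋) ≡ toℕᵇ (active R G t)
      row t with active R G t
      ... | true  = sumℕ-ind′ G
      ... | false = sumℕ-0 {N}

    count-UC : count UC ≡ suc (toℕ G)
    count-UC = count-below (suc (toℕ G)) (Finₚ.toℕ<n G)

    count-UD : count UD ≡ count (active R G) + count (not ∘ left G)
    count-UD = trans (sumℕ-cong split) (sumℕ-+ (toℕᵇ ∘ active R G) (toℕᵇ ∘ not ∘ left G))
      where
      split : ∀ v → toℕᵇ (UD v) ≡ toℕᵇ (active R G v) + toℕᵇ (not (left G v))
      split v with left G v | 0 <ᵇ outdegree D v
      ... | false | _     = refl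
      ... | true  | true  = refl
      ... | true  | false = refl

    bound-C : size LB + count (active R G) ≤ toℕ G
    bound-C = ℕₚ.≤-pred (subst₂ _<_ size-C count-UC (Inside-size C-clique C-inside G (<⇒<ᵇ-true {toℕ G} ℕₚ.≤-refl)))

    bound-D : suc (size D) ≤ count (active R G) + count (not ∘ left G)
    bound-D = subst (size D <_) count-UD (Inside-size D-clique D-inside G (right-UD G ℕₚ.≤-refl))

    -- The two forest bounds add up to the number of arrows, so both are attained.
    bounds-total : toℕ G + (count (active R G) + count (not ∘ left G)) ≡ size LB + count (active R G) + suc (size D)
    bounds-total = begin
      toℕ G + (a + r)          ≡⟨ x+[y+z]≡y+[x+z] (toℕ G) a r ⟩
      a + (toℕ G + r)          ≡⟨ cong (a +_) (trans count-sides (cong suc (sym size-split))) ⟩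
      a + suc (size LB + size D) ≡⟨ regroup a (size LB) (size D) ⟩
      size LB + a + suc (size D) ∎
      where
      open ≡-Reasoning
      a = count (active R G)
      r = count (not ∘ left G)
      x+[y+z]≡y+[x+z] : ∀ x y z → x + (y + z) ≡ y + (x + z)
      x+[y+z]≡y+[x+z] = ℕ-solve-∀
      regroup : ∀ a l d → a + suc (l + d) ≡ l + a + suc d
      regroup = ℕ-solve-∀

    size-LB : size LB + count (active R G) ≡ toℕ G
    size-LB = ℕₚ.≤-antisym bound-C (ℕₚ.+-cancelʳ-≤ (suc (size D)) _ _
      (ℕₚ.≤-trans (ℕₚ.+-monoʳ-≤ (toℕ G) bound-D) (ℕₚ.≤-reflexive bounds-total)))

    size-D : suc (size D) ≡ count (active R G) + count (not ∘ left G)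
    size-D = sym (ℕₚ.+-cancelˡ-≡ (toℕ G) _ _ (trans bounds-total (cong (_+ suc (size D)) size-LB)))

    C-forest : SpanningForest CL UC
    C-forest = record { isClique = C-clique ; inside = C-inside ; spanning = trans (cong suc (trans size-C size-LB)) (sym count-UC) }

    D-forest : SpanningForest D UD
    D-forest = record { isClique = D-clique ; inside = D-inside ; spanning = trans size-D (sym count-UD) }

    ∑-leftCode : ∑ (leftCode R G) ≡ size LB
    ∑-leftCode = trans (∑-map-filterᵇ (indegree LB) (left G) (Uniqueₚ.allFin⁺ N) ∈ₚ.∈-allFin)
      (trans (sumℕ-cong drop) (sym (size≡Σindegree LB)))
      where
      drop : ∀ v → toℕᵇ (left G v) * indegree LB v ≡ indegree LB v
      drop v with left G v in eq
      ... | true  = ℕₚ.+-identityʳ _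
      ... | false = sym (trans (sumℕ-cong λ t → cong toℕᵇ (≢true⇒≡false λ lb →
        let _ , v<t , t<G = LB-backward {t} {v} lb in contradiction (trans (sym (left⁺ {v} (ℕₚ.<-trans v<t t<G))) eq) λ ())) (sumℕ-0 {N}))

    ∑-rightCode+forwardCode : ∑ (rightCode R G) + ∑ (forwardCode R G) ≡ size D
    ∑-rightCode+forwardCode = trans
      (cong₂ _+_ (∑-map-filterᵇ (outdegree D) (not ∘ left G) (descending-unique N) ∈-descending)
                 (∑-map-filterᵇ (outdegree D) (active R G) (Uniqueₚ.allFin⁺ N) ∈ₚ.∈-allFin))
      (trans (sym (sumℕ-+ (λ v → toℕᵇ (not (left G v)) * outdegree D v) (λ v → toℕᵇ (active R G v) * outdegree D v))) (sumℕ-cong row))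
      where
      row : ∀ v → toℕᵇ (not (left G v)) * outdegree D v + toℕᵇ (active R G v) * outdegree D v ≡ outdegree D v
      row v with left G v | outdegree D v
      ... | false | x     = trans (ℕₚ.+-identityʳ _) (ℕₚ.*-identityˡ x)
      ... | true  | zero  = refl
      ... | true  | suc x = ℕₚ.*-identityˡ (suc x)

    ∑-forwardCode : ∑ (forwardCode R G) ≡ size (λ t h → R t h ∧ (toℕ t <ᵇ toℕ h))
    ∑-forwardCode = trans (∑-map-filterᵇ (outdegree D) (active R G) (Uniqueₚ.allFin⁺ N) ∈ₚ.∈-allFin) (sumℕ-cong row)
      where
      row : ∀ t → toℕᵇ (active R G t) * outdegree D t ≡ count (λ h → R t h ∧ (toℕ t <ᵇ toℕ h))
      row t with active R G t in act
      ... | true  = trans (ℕₚ.+-identityʳ _) (sumℕ-cong λ h → cong (λ b → toℕᵇ (R t h ∧ b))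
        (trans (cong (λ b → (toℕ t <ᵇ toℕ h) ∨ not b) (left⁺ {t} (proj₁ (active⁻ {t} act)))) (Boolₚ.∨-identityʳ (toℕ t <ᵇ toℕ h))))
      ... | false = sym (trans (sumℕ-cong λ h → cong toℕᵇ (≢true⇒≡false λ eq → inactive h (∧-true⁻ {R t h} eq))) (sumℕ-0 {N}))
        where
        inactive : ∀ h → R t h ≡ true × (toℕ t <ᵇ toℕ h) ≡ true → ⊥
        inactive h (Rth , t<h) = contradiction (trans (sym (active⁺ {t} {h} (cong₂ (λ a b → a ∧ (b ∨ not (left G t))) Rth t<h)
          (proj₁ (forward-crosses Rth (<ᵇ-true⇒< t<h))))) act) λ ()

    length-leftCode : length (leftCode R G) ≡ toℕ G
    length-leftCode = trans (Listₚ.length-map (indegree LB) (lefts G))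
      (trans (length-filterᵇ-all (left G) (Uniqueₚ.allFin⁺ N) ∈ₚ.∈-allFin) count-left)

    length-rightCode : length (rightCode R G) ≡ count (not ∘ left G)
    length-rightCode = trans (Listₚ.length-map (outdegree D) (rights G)) (length-filterᵇ-all (not ∘ left G) (descending-unique N) ∈-descending)

    length-forwardCode : length (forwardCode R G) ≡ count (active R G)
    length-forwardCode = trans (Listₚ.length-map (outdegree D) (actives R G)) (length-filterᵇ-all (active R G) (Uniqueₚ.allFin⁺ N) ∈ₚ.∈-allFin)

    -- The tree on the left side and `G` has as many arrows as there are left vertices, one of them
    -- for each active tail and the others counted by the left code. Equal forward codes therefore
    -- give left codes of equal deficit, as `split-unique` requires.
    deficit-leftCode : ∑ (leftCode R G) + length (forwardCode R G) ≡ length (leftCode R G)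
    deficit-leftCode = trans (cong₂ _+_ ∑-leftCode length-forwardCode) (trans size-LB (sym length-leftCode))

    Łukasiewicz-leftCode : Łukasiewicz (leftCode R G)
    Łukasiewicz-leftCode = Łukasiewicz-indegrees (Sparse-mono {R = LB} {R} (λ t h eq → proj₁ (∧-true⁻ {R t h} eq)) (clique-sparse tri cl))
      (filterᵇ-unique (left G) (Uniqueₚ.allFin⁺ N))
      (sorted⇒closed LB Fin._<_ ℕₚ.<-trans (ℕₚ.<-irrefl refl) (filterᵇ-sorted (left G) (ascending-sorted N)) λ t h lb _ →
        let _ , h<t , t<G = LB-backward {t} {h} lb in ∈-filterᵇ⁺ (left G) (∈ₚ.∈-allFin t) (left⁺ t<G) , h<t)

    -- Forward arrows start on the left and contribute nothing to outdegrees on the right. The other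
    -- arrows descend and stay on the right, so in the transposed graph they run against the
    -- descending order.
    Łukasiewicz-rightCode : Łukasiewicz (rightCode R G)
    Łukasiewicz-rightCode = Łukasiewicz-indegrees (Sparse-transpose {R = D} (clique-sparse tri D-clique))
      (filterᵇ-unique (not ∘ left G) (descending-unique N))
      (sorted⇒closed (transpose D) (λ u v → v Fin.< u) (λ v<u w<v → ℕₚ.<-trans w<v v<u) (ℕₚ.<-irrefl refl)
        (filterᵇ-sorted (not ∘ left G) (descending-sorted N)) up)
      where
      up : ∀ t h → D h t ≡ true → h ∈ rights G → t ∈ rights G × t Fin.< h
      up t h Dht h∈ with D-cases {h} {t} Dht
      ... | inj₁ (h<G , _)       = contradiction h<G (ℕₚ.≤⇒≯ (right⁻ (proj₂ (∈-filterᵇ⁻ (not ∘ left G) h∈))))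
      ... | inj₂ (_ , G≤t , t<h) = ∈-filterᵇ⁺ (not ∘ left G) (∈-descending t) (right⁺ G≤t) , t<h

    forwardCode-positive : All (1 ≤_) (forwardCode R G)
    forwardCode-positive = All.tabulate positive
      where
      positive : ∀ {k} → k ∈ forwardCode R G → 1 ≤ k
      positive k∈ with ∈ₚ.∈-map⁻ (outdegree D) k∈
      ... | t , t∈ , refl = proj₂ (active⁻ {t} (proj₂ (∈-filterᵇ⁻ (active R G) t∈)))

    C-left : ∀ t h → h Fin.< G → CL t h ≡ LB t h
    C-left t h h<G = trans (cong (λ b → LB t h ∨ (active R G t ∧ b)) (≟-≢ (<⇒≢ h<G)))
      (trans (cong (LB t h ∨_) (Boolₚ.∧-zeroʳ (active R G t))) (Boolₚ.∨-identityʳ (LB t h)))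

    C-G : ∀ t → CL t G ≡ active R G t
    C-G t = trans (cong₂ (λ a b → a ∨ (active R G t ∧ b))
        (≢true⇒≡false λ lb → let _ , G<t , t<G = LB-backward {t} {G} lb in ℕₚ.<-asym G<t t<G) (≟-refl G))
      (Boolₚ.∧-identityʳ (active R G t))

    LB-right : ∀ t h → G Fin.≤ h → LB t h ≡ false
    LB-right t h G≤h = ≢true⇒≡false λ lb → let _ , h<t , t<G = LB-backward {t} {h} lb in ℕₚ.<⇒≱ (ℕₚ.<-trans h<t t<G) G≤h

  module _ {R R′ : Digraph N} (cl : Clique E R) (cl′ : Clique E R′) (sizeR : size R ≡ n) (sizeR′ : size R′ ≡ n)
           {G G′ : Fin N} (isGap : Gap.IsGap cl G) (isGap′ : Gap.IsGap cl′ G′) where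
    private
      module P  = Facet cl sizeR isGap
      module P′ = Facet cl′ sizeR′ isGap′

    leftCodes-agree : leftCode R G ++ rightCode R G ≡ leftCode R′ G′ ++ rightCode R′ G′ → forwardCode R G ≡ forwardCode R′ G′ →
      leftCode R G ≡ leftCode R′ G′
    leftCodes-agree word≡ forward≡ = split-unique (leftCode R G) (leftCode R′ G′) P.Łukasiewicz-leftCode P′.Łukasiewicz-leftCode deficits word≡
      where
      open ≡-Reasoning
      a = length (forwardCode R G)
      deficits : ∑ (leftCode R G) + length (leftCode R′ G′) ≡ ∑ (leftCode R′ G′) + length (leftCode R G)
      deficits = begin
        ∑ (leftCode R G) + length (leftCode R′ G′)
          ≡⟨ cong (∑ (leftCode R G) +_) (trans (sym P′.deficit-leftCode) (cong (λ z → ∑ (leftCode R′ G′) + length z) (sym forward≡))) ⟩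
        ∑ (leftCode R G) + (∑ (leftCode R′ G′) + a)
          ≡⟨ swap (∑ (leftCode R G)) (∑ (leftCode R′ G′)) a ⟩
        ∑ (leftCode R′ G′) + (∑ (leftCode R G) + a)
          ≡⟨ cong (∑ (leftCode R′ G′) +_) P.deficit-leftCode ⟩
        ∑ (leftCode R′ G′) + length (leftCode R G) ∎
        where
        swap : ∀ x y z → x + (y + z) ≡ y + (x + z)
        swap = ℕ-solve-∀

    gaps-agree : leftCode R G ≡ leftCode R′ G′ → G ≡ G′
    gaps-agree left≡ = Finₚ.toℕ-injective (trans (sym P.length-leftCode) (trans (cong length left≡) P′.length-leftCode))

  module _ {R R′ : Digraph N} (cl : Clique E R) (cl′ : Clique E R′) (sizeR : size R ≡ n) (sizeR′ : size R′ ≡ n)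
           {G : Fin N} (isGap : Gap.IsGap cl G) (isGap′ : Gap.IsGap cl′ G)
           (left≡ : leftCode R G ≡ leftCode R′ G) (right≡ : rightCode R G ≡ rightCode R′ G) (forward≡ : forwardCode R G ≡ forwardCode R′ G) where
    private
      module P  = Facet cl sizeR isGap
      module P′ = Facet cl′ sizeR′ isGap′

    collapsed-agree : ∀ t h → collapsed R G t h ≡ collapsed R′ G t h
    collapsed-agree = determined-by-indegrees P.C-forest P′.C-forest indegrees
      where
      indegrees : ∀ w → P.UC w ≡ true → indegree P.CL w ≡ indegree P′.CL w
      indegrees w UCw with ℕₚ.m≤n⇒m<n∨m≡n (ℕₚ.≤-pred (<ᵇ-true⇒< UCw))
      ... | inj₁ w<G = trans (sumℕ-cong λ t → cong toℕᵇ (P.C-left t w w<G))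
        (trans (map-≡⇒≡ (lefts G) left≡ (∈-filterᵇ⁺ (left G) (∈ₚ.∈-allFin w) (P.left⁺ w<G)))
          (sym (sumℕ-cong λ t → cong toℕᵇ (P′.C-left t w w<G))))
      -- After contraction the indegree of `G` is the number of active tails, that is, the length of
      -- the forward code.
      ... | inj₂ w≡G with refl ← Finₚ.toℕ-injective w≡G = trans (sumℕ-cong λ t → cong toℕᵇ (P.C-G t))
        (trans (sym P.length-forwardCode) (trans (cong length forward≡) (trans P′.length-forwardCode
          (sym (sumℕ-cong λ t → cong toℕᵇ (P′.C-G t))))))

    lower-agree : ∀ t h → lower R G t h ≡ lower R′ G t h
    lower-agree t h with toℕ h ℕₚ.<? toℕ G
    ... | yes h<G = trans (sym (P.C-left t h h<G)) (trans (collapsed-agree t h) (P′.C-left t h h<G))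
    ... | no h≮G  = trans (P.LB-right t h (ℕₚ.≮⇒≥ h≮G)) (sym (P′.LB-right t h (ℕₚ.≮⇒≥ h≮G)))

    active-agree : ∀ t → active R G t ≡ active R′ G t
    active-agree t = trans (sym (P.C-G t)) (trans (collapsed-agree t G) (P′.C-G t))

    actives-agree : actives R G ≡ actives R′ G
    actives-agree = filterᵇ-cong active-agree (allFin N)
      where
      filterᵇ-cong : ∀ {A : Set} {p q : A → Bool} → (∀ x → p x ≡ q x) → ∀ xs → filterᵇ p xs ≡ filterᵇ q xs
      filterᵇ-cong p≡q [] = refl
      filterᵇ-cong {p = p} {q} p≡q (x ∷ xs) with p x | q x | p≡q x
      ... | true  | true  | _ = cong (x ∷_) (filterᵇ-cong p≡q xs)
      ... | false | false | _ = filterᵇ-cong p≡q xs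

    upper-agree : ∀ t h → upper R G t h ≡ upper R′ G t h
    upper-agree = determined-by-outdegrees P.D-forest D′-forest outdegrees
      where
      UD≡ : ∀ v → P′.UD v ≡ P.UD v
      UD≡ v = cong (_∨ not (left G v)) (sym (active-agree v))
      D′-forest : SpanningForest P′.D P.UD
      D′-forest = record
        { isClique = P′.D-clique
        ; inside = λ t h eq → let Ut , Uh = P′.D-inside t h eq in trans (sym (UD≡ t)) Ut , trans (sym (UD≡ h)) Uh
        ; spanning = trans (SpanningForest.spanning P′.D-forest) (sumℕ-cong λ v → cong toℕᵇ (UD≡ v)) }
      outdegrees : ∀ w → P.UD w ≡ true → outdegree P.D w ≡ outdegree P′.D w
      outdegrees w UDw with active R G w in act
      -- The forward code lists outdegrees without naming their tails; the names come from the left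
      -- side, where the collapsed facets have already been identified.
      ... | true  = map-≡⇒≡ (actives R G) (trans forward≡ (cong (map (outdegree P′.D)) (sym actives-agree))) (∈-filterᵇ⁺ (active R G) (∈ₚ.∈-allFin w) act)
      ... | false = map-≡⇒≡ (rights G) right≡ (∈-filterᵇ⁺ (not ∘ left G) (∈-descending w) UDw)

    facets-agree : ∀ t h → R t h ≡ R′ t h
    facets-agree t h = toℕᵇ-injective (trans (lower+upper R G t h)
      (trans (cong₂ (λ a b → toℕᵇ a + toℕᵇ b) (lower-agree t h) (upper-agree t h)) (sym (lower+upper R′ G t h))))
      where
      toℕᵇ-injective : ∀ {a b} → toℕᵇ a ≡ toℕᵇ b → a ≡ b
      toℕᵇ-injective {true}  {true}  _ = refl
      toℕᵇ-injective {false} {false} _ = refl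

-- Counting facets

length-cartesianProduct : {A B : Set} (xs : List A) (ys : List B) → length (List.cartesianProduct xs ys) ≡ length xs * length ys
length-cartesianProduct []       ys = refl
length-cartesianProduct (x ∷ xs) ys = trans (Listₚ.length-++ (map (x ,_) ys))
  (cong₂ _+_ (Listₚ.length-map (x ,_) ys) (length-cartesianProduct xs ys))

module Counting {n : ℕ} (1≤n : 1 ≤ n) {E : EdgeRule n} (symmetric : Symmetric E) (uniform : Uniform E)
                (tri : IsTriangulationOfBoundary E) (simion : InSimionClass E)
                (THTH-nests : Nests E T H T H) (HTHT-not : DoesNotNest E H T H T) where
  open Geometry tri
  open Determined tri
  open Rules 1≤n symmetric uniform tri simion THTH-nests HTHT-not
  open Codes 1≤n symmetric uniform tri simion THTH-nests HTHT-not

  private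
    N = suc n

  isFacetᵇ : ℕ → ℕ → ArrowSet n → Bool
  isFacetᵇ i j S = isFaceᵇ E S ∧ (numForward S ℕ.≡ᵇ i) ∧ (numBackward S ℕ.≡ᵇ j)

  ≡ᵇ-true⁻ : ∀ a b → (a ℕ.≡ᵇ b) ≡ true → a ≡ b
  ≡ᵇ-true⁻ a b eq = ℕₚ.≡ᵇ⇒≡ a b (Equivalence.from Boolₚ.T-≡ eq)

  ≡ᵇ-true⁺ : ∀ a b → a ≡ b → (a ℕ.≡ᵇ b) ≡ true
  ≡ᵇ-true⁺ a b eq = Equivalence.to Boolₚ.T-≡ (ℕₚ.≡⇒≡ᵇ a b eq)

  record FacetWith (i : ℕ) (S : ArrowSet n) : Set where
    field
      isClique : Clique E (member S)
      forward  : numForward S ≡ i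
      size≡n   : size (member S) ≡ n

  isFacetᵇ⁻ : ∀ {i} → i ≤ n → ∀ S → isFacetᵇ i (n ∸ i) S ≡ true → FacetWith i S
  isFacetᵇ⁻ {i} i≤n S eq with ∧-true⁻ {isFaceᵇ E S} eq
  ... | face , counts with ∧-true⁻ {numForward S ℕ.≡ᵇ i} counts
  ...   | fwd , bwd = record
    { isClique = IsFace⇒Clique S face
    ; forward  = ≡ᵇ-true⁻ (numForward S) i fwd
    ; size≡n   = trans (sym (numForward+numBackward S (IsFace⇒Clique S face)))
                   (trans (cong₂ _+_ (≡ᵇ-true⁻ (numForward S) i fwd) (≡ᵇ-true⁻ (numBackward S) (n ∸ i) bwd)) (ℕₚ.m+[n∸m]≡n i≤n)) }

  facet-count≤ : ∀ {i} {B : Set} (Code : ArrowSet n → B → Set) → (∀ {S S′ b} → Code S b → Code S′ b → S ≡ S′) →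
    i ≤ n → (ys : List B) → (∀ S → FacetWith i S → ∃ λ b → b ∈ ys × Code S b) → f E i (n ∸ i) ≤ length ys
  facet-count≤ {i} Code inj i≤n ys code = pigeonhole Code inj {filterᵇ (isFacetᵇ i (n ∸ i)) (allArrowSets n)}
    (filterᵇ-unique (isFacetᵇ i (n ∸ i)) (allArrowSets-unique n)) ys
    (λ {S} S∈ → code S (isFacetᵇ⁻ i≤n S (proj₂ (∈-filterᵇ⁻ (isFacetᵇ i (n ∸ i)) {xs = allArrowSets n} S∈))))

  record BackwardCode (S : ArrowSet n) (y : List ℕ) : Set where
    field
      isClique : Clique E (member S)
      size≡n   : size (member S) ≡ n
      word     : map (indegree (member S)) (allFin N) ≡ y

  backward-injective : ∀ {S S′ y} → BackwardCode S y → BackwardCode S′ y → S ≡ S′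
  backward-injective {S} {S′} c c′ = member-ext (determined-by-indegrees (forest c) (forest c′)
    λ w _ → map-≡⇒≡ (allFin N) (trans (BackwardCode.word c) (sym (BackwardCode.word c′))) (∈ₚ.∈-allFin w))
    where
    forest : ∀ {S y} → BackwardCode S y → SpanningForest (member S) (λ _ → true)
    forest c = record
      { isClique = BackwardCode.isClique c ; inside = λ _ _ _ → refl , refl
      ; spanning = trans (cong suc (BackwardCode.size≡n c)) (sym (count-true {N})) }

  backward-code : ∀ S → FacetWith 0 S → ∃ λ y → y ∈ words n 1 × BackwardCode S y
  backward-code S facet = map (indegree R) (allFin N) ,
    ∈-words n 1 (map (indegree R) (allFin N)) łukasiewicz
      (trans (∑-map-tabulate {N} (indegree R) id) (trans (sym (size≡Σindegree R)) size≡n))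
      (trans (Listₚ.length-map (indegree R) (allFin N)) (trans (Listₚ.length-tabulate id) (ℕₚ.+-comm 1 n))) ,
    record { isClique = isClique ; size≡n = size≡n ; word = refl }
    where
    open FacetWith facet
    R = member S
    backward : ∀ t h → R t h ≡ true → h Fin.< t
    backward t h Rth with ℕₚ.<-cmp (toℕ t) (toℕ h)
    ... | tri> _ _ h<t = h<t
    ... | tri≈ _ t≡h _ = contradiction (Finₚ.toℕ-injective t≡h) (loopless isClique Rth)
    ... | tri< t<h _ _ = contradiction (trans (sym (cong₂ _∧_ Rth (<⇒<ᵇ-true t<h)))
      (size≡0⇒none (λ t h → R t h ∧ (toℕ t <ᵇ toℕ h)) (trans (sym (countArrows≡size (λ t h → toℕ t <ᵇ toℕ h) S)) forward) t h)) λ ()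
    łukasiewicz : Łukasiewicz (map (indegree R) (allFin N))
    łukasiewicz = Łukasiewicz-indegrees (clique-sparse tri isClique) (Uniqueₚ.allFin⁺ N)
      (sorted⇒closed R Fin._<_ ℕₚ.<-trans (ℕₚ.<-irrefl refl) (ascending-sorted N) λ t h Rth _ → ∈ₚ.∈-allFin t , backward t h Rth)

  record ForwardCode (S : ArrowSet n) (b : List ℕ × List ℕ) : Set where
    field
      isClique : Clique E (member S)
      size≡n   : size (member S) ≡ n
      G        : Fin N
      isGap    : Gap.IsGap isClique G
      word     : leftCode (member S) G ++ rightCode (member S) G ≡ proj₁ b
      steps    : forwardCode (member S) G ≡ proj₂ b

  forward-injective : ∀ {S S′ b} → ForwardCode S b → ForwardCode S′ b → S ≡ S′
  forward-injective {S} {S′} {b} c c′ = member-ext (same-gap G≡ left≡)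
    where
    module c  = ForwardCode c
    module c′ = ForwardCode c′
    left≡ : leftCode (member S) c.G ≡ leftCode (member S′) c′.G
    left≡ = leftCodes-agree c.isClique c′.isClique c.size≡n c′.size≡n c.isGap c′.isGap (trans c.word (sym c′.word)) (trans c.steps (sym c′.steps))
    G≡ : c′.G ≡ c.G
    G≡ = sym (gaps-agree c.isClique c′.isClique c.size≡n c′.size≡n c.isGap c′.isGap left≡)
    right≡ : rightCode (member S) c.G ≡ rightCode (member S′) c′.G
    right≡ = Listₚ.++-cancelˡ (leftCode (member S) c.G) _ _
      (trans c.word (trans (sym c′.word) (cong (_++ rightCode (member S′) c′.G) (sym left≡))))
    same-gap : c′.G ≡ c.G → leftCode (member S) c.G ≡ leftCode (member S′) c′.G → ∀ t h → member S t h ≡ member S′ t h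
    same-gap eq left≡ = facets-agree c.isClique c′.isClique c.size≡n c′.size≡n c.isGap
      (subst (Gap.IsGap c′.isClique) eq c′.isGap)
      (trans left≡ (cong (leftCode (member S′)) eq))
      (trans right≡ (cong (rightCode (member S′)) eq))
      (trans c.steps (trans (sym c′.steps) (cong (forwardCode (member S′)) eq)))

  -- With i forward arrows, the word counts the n - i backward arrows and has one letter for each of
  -- the n + 1 vertices, whence the deficit i + 1.
  forward-code : ∀ j → suc j ≤ n → ∀ S → FacetWith (suc j) S →
    ∃ λ b → b ∈ List.cartesianProduct (words (n ∸ suc j) (suc (suc j))) (compositions j) × ForwardCode S b
  forward-code j j<n S facet = at-gap (Gap.gap isClique forward-arrow)
    where
    open FacetWith facet
    R = member S
    Fwd : Digraph N
    Fwd t h = R t h ∧ (toℕ t <ᵇ toℕ h)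
    size-Fwd : size Fwd ≡ suc j
    size-Fwd = trans (sym (countArrows≡size (λ t h → toℕ t <ᵇ toℕ h) S)) forward
    forward-arrow : ∃₂ λ t h → R t h ≡ true × t Fin.< h
    forward-arrow with Finₚ.any? (λ t → Finₚ.any? λ h → Fwd t h Boolₚ.≟ true)
    ... | yes (t , h , eq) = let Rth , t<h = ∧-true⁻ {R t h} eq in t , h , Rth , <ᵇ-true⇒< t<h
    ... | no none = contradiction (trans (sym size-Fwd) (trans (sumℕ-cong λ t → trans (sumℕ-cong λ h → cong toℕᵇ (≢true⇒≡false λ eq → none (t , h , eq))) (sumℕ-0 {N})) (sumℕ-0 {N}))) λ ()
    at-gap : ∃ (Gap.IsGap isClique) → ∃ λ b → b ∈ List.cartesianProduct (words (n ∸ suc j) (suc (suc j))) (compositions j) × ForwardCode S b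
    at-gap (G , isGap) = (leftCode R G ++ rightCode R G , forwardCode R G) ,
      ∈ₚ.∈-cartesianProduct⁺
        (∈-words (n ∸ suc j) (suc (suc j)) (leftCode R G ++ rightCode R G)
          (Łukasiewicz-++ (leftCode R G) (rightCode R G) Łukasiewicz-leftCode Łukasiewicz-rightCode) word-sum word-length)
        (∈-compositions j (forwardCode R G) forwardCode-positive (trans ∑-forwardCode size-Fwd)) ,
      record { isClique = isClique ; size≡n = size≡n ; G = G ; isGap = isGap ; word = refl ; steps = refl }
      where
      open Facet isClique size≡n isGap
      open ≡-Reasoning
      word-sum : ∑ (leftCode R G ++ rightCode R G) ≡ n ∸ suc j
      word-sum = begin
        ∑ (leftCode R G ++ rightCode R G)
          ≡⟨ sym (ℕₚ.m+n∸n≡m _ (suc j)) ⟩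
        ∑ (leftCode R G ++ rightCode R G) + suc j ∸ suc j
          ≡⟨ cong₂ (λ x y → x + y ∸ suc j) (∑-++ (leftCode R G) (rightCode R G)) (sym (trans ∑-forwardCode size-Fwd)) ⟩
        ∑ (leftCode R G) + ∑ (rightCode R G) + ∑ (forwardCode R G) ∸ suc j
          ≡⟨ cong (_∸ suc j) (trans (ℕₚ.+-assoc (∑ (leftCode R G)) _ _) (trans (cong₂ _+_ ∑-leftCode ∑-rightCode+forwardCode) size-split)) ⟩
        n ∸ suc j ∎
      word-length : length (leftCode R G ++ rightCode R G) ≡ n ∸ suc j + suc (suc j)
      word-length = begin
        length (leftCode R G ++ rightCode R G)
          ≡⟨ trans (Listₚ.length-++ (leftCode R G)) (trans (cong₂ _+_ length-leftCode length-rightCode) count-sides) ⟩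
        suc n
          ≡⟨ cong suc (sym (ℕₚ.m∸n+n≡m j<n)) ⟩
        suc (n ∸ suc j + suc j)
          ≡⟨ sym (ℕₚ.+-suc (n ∸ suc j) (suc j)) ⟩
        n ∸ suc j + suc (suc j) ∎

  bound : Fin N → ℕ
  bound zero    = ballot n 1
  bound (suc j) = 2 ^ toℕ j * ballot (n ∸ suc (toℕ j)) (suc (suc (toℕ j)))

  count≤bound : ∀ i → f E (toℕ i) (n ∸ toℕ i) ≤ bound i
  count≤bound zero = ℕₚ.≤-trans (facet-count≤ BackwardCode backward-injective z≤n (words n 1) backward-code) (ℕₚ.≤-reflexive (length-words n 1))
  count≤bound (suc j) = ℕₚ.≤-trans
    (facet-count≤ ForwardCode forward-injective (Finₚ.toℕ<n j) codes (forward-code (toℕ j) (Finₚ.toℕ<n j)))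
    (ℕₚ.≤-reflexive (trans (length-cartesianProduct (words (n ∸ suc (toℕ j)) (suc (suc (toℕ j)))) (compositions (toℕ j)))
      (trans (cong₂ _*_ (length-words (n ∸ suc (toℕ j)) (suc (suc (toℕ j)))) (length-compositions (toℕ j)))
             (ℕₚ.*-comm (ballot (n ∸ suc (toℕ j)) (suc (suc (toℕ j)))) (2 ^ toℕ j)))))
    where codes = List.cartesianProduct (words (n ∸ suc (toℕ j)) (suc (suc (toℕ j)))) (compositions (toℕ j))

  -- The common value of both bounds is binom(2n, n).
  Σbound : sumℕ bound ≡ multichoose n N
  Σbound = trans (cong (ballot n 1 +_) (sumℕ-cong {m = n} {g = λ j → 2 ^ toℕ j * ballot (n ∸ suc (toℕ j)) (1 + suc (toℕ j))} λ j → refl))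
    (trans (ballot-total n 1) (cong (multichoose n) (ℕₚ.+-comm n 1)))

  isAnyFacetᵇ : ArrowSet n → Bool
  isAnyFacetᵇ S = isFaceᵇ E S ∧ (size (member S) ℕ.≡ᵇ n)

  multichoose≤Σcount : multichoose n N ≤ sumℕ {N} (λ i → f E (toℕ i) (n ∸ toℕ i))
  multichoose≤Σcount = ℕₚ.≤-trans (ℕₚ.≤-reflexive (sym (length-weakCompositions n N)))
    (ℕₚ.≤-trans (pigeonhole HasIndegrees (λ {y} {y′} {S} → same-indegrees {y} {y′} {S}) (weakCompositions-unique n N) (filterᵇ isAnyFacetᵇ (allArrowSets n)) realise)
      (length-filterᵇ-cover isAnyFacetᵇ {N} (λ i → isFacetᵇ (toℕ i) (n ∸ toℕ i)) cover (allArrowSets n)))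
    where
    HasIndegrees : Vec ℕ N → ArrowSet n → Set
    HasIndegrees y S = ∀ v → indegree (member S) v ≡ lookup y v
    same-indegrees : ∀ {y y′ S} → HasIndegrees y S → HasIndegrees y′ S → y ≡ y′
    same-indegrees p p′ = Vec-ext λ v → trans (sym (p v)) (p′ v)
    realise : ∀ {y} → y ∈ weakCompositions n N → ∃ λ S → S ∈ filterᵇ isAnyFacetᵇ (allArrowSets n) × HasIndegrees y S
    realise {y} y∈ = found (facet-with-indegrees tri 1≤n (lookup y) (weakCompositions-sum n N y∈))
      where
      found : (Σ (ArrowSet n) λ S → IsFace E S × (∀ v → indegree (member S) v ≡ lookup y v)) →
              ∃ λ S → S ∈ filterᵇ isAnyFacetᵇ (allArrowSets n) × HasIndegrees y S
      found (S , face , deg) = S , ∈-filterᵇ⁺ isAnyFacetᵇ (∈-allArrowSets S) (cong₂ _∧_ face (≡ᵇ-true⁺ (size (member S)) n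
        (trans (size≡Σindegree (member S)) (trans (sumℕ-cong deg) (weakCompositions-sum n N y∈))))) , deg
    cover : ∀ S → isAnyFacetᵇ S ≡ true → ∃ λ (i : Fin N) → isFacetᵇ (toℕ i) (n ∸ toℕ i) S ≡ true
    cover S eq with ∧-true⁻ {isFaceᵇ E S} eq
    ... | face , sz = fromℕ< fwd<N , cong₂ _∧_ face (cong₂ _∧_ (≡ᵇ-true⁺ (numForward S) _ (sym toℕ-i)) (≡ᵇ-true⁺ (numBackward S) _ bwd))
      where
      total : numForward S + numBackward S ≡ n
      total = trans (numForward+numBackward S (IsFace⇒Clique S face)) (≡ᵇ-true⁻ (size (member S)) n sz)
      fwd<N : numForward S < N
      fwd<N = s≤s (ℕₚ.≤-trans (ℕₚ.m≤m+n (numForward S) (numBackward S)) (ℕₚ.≤-reflexive total))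
      toℕ-i : toℕ (fromℕ< fwd<N) ≡ numForward S
      toℕ-i = Finₚ.toℕ-fromℕ< fwd<N
      bwd : numBackward S ≡ n ∸ toℕ (fromℕ< fwd<N)
      bwd = sym (trans (cong₂ _∸_ (sym total) toℕ-i) (ℕₚ.m+n∸m≡n (numForward S) (numBackward S)))

  count≡bound : ∀ i → f E (toℕ i) (n ∸ toℕ i) ≡ bound i
  count≡bound = sumℕ-≡⇒≡ count≤bound (ℕₚ.≤-trans (ℕₚ.≤-reflexive Σbound) multichoose≤Σcount)

  count-with-forward : ∀ j → suc j ≤ n →
    f E (suc j) (n ∸ suc j) * ((n ∸ suc j) ! * (suc n) !) ≡ 2 ^ j * ((suc j + 1) * (2 * n ∸ suc j) !)
  count-with-forward j j<n = begin
    f E (suc j) s * (s ! * (suc n) !)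
      ≡⟨ cong₂ (λ x y → x * (s ! * y !)) at-j (sym s+c) ⟩
    2 ^ j * ballot s (suc (suc j)) * (s ! * (s + suc (suc j)) !)
      ≡⟨ ℕₚ.*-assoc (2 ^ j) (ballot s (suc (suc j))) _ ⟩
    2 ^ j * (ballot s (suc (suc j)) * (s ! * (s + suc (suc j)) !))
      ≡⟨ cong (2 ^ j *_) (ballot-closed s (suc j)) ⟩
    2 ^ j * (suc (suc j) * (2 * s + suc j) !)
      ≡⟨ cong₂ (λ x y → 2 ^ j * (x * y !)) (ℕₚ.+-comm 1 (suc j)) 2s+i ⟩
    2 ^ j * ((suc j + 1) * (2 * n ∸ suc j) !) ∎
    where
    open ≡-Reasoning
    s = n ∸ suc j
    s+c : s + suc (suc j) ≡ suc n
    s+c = trans (ℕₚ.+-suc s (suc j)) (cong suc (ℕₚ.m∸n+n≡m j<n))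
    2s+i : 2 * s + suc j ≡ 2 * n ∸ suc j
    2s+i = sym (begin
      2 * n ∸ suc j                   ≡⟨ cong (λ x → 2 * x ∸ suc j) (sym (ℕₚ.m∸n+n≡m j<n)) ⟩
      2 * (s + suc j) ∸ suc j         ≡⟨ cong (_∸ suc j) (double s (suc j)) ⟩
      2 * s + suc j + suc j ∸ suc j   ≡⟨ ℕₚ.m+n∸n≡m (2 * s + suc j) (suc j) ⟩
      2 * s + suc j                   ∎)
      where
      double : ∀ x y → 2 * (x + y) ≡ 2 * x + y + y
      double = ℕ-solve-∀
    at-index : ∀ (k : Fin n) → toℕ k ≡ j → f E (suc j) s ≡ 2 ^ j * ballot s (suc (suc j))
    at-index k refl = count≡bound (suc k)
    at-j : f E (suc j) s ≡ 2 ^ j * ballot s (suc (suc j))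
    at-j = at-index (fromℕ< j<n) (Finₚ.toℕ-fromℕ< j<n)

theorem7p5 : ∀ (n : ℕ) → 1 ≤ n → (E : EdgeRule n) →
    Symmetric E → Uniform E → IsTriangulationOfBoundary E → InSimionClass E →
    Nests E T H T H → DoesNotNest E H T H T →
    (∀ (i : ℕ) → 1 ≤ i → i ≤ n →
    f E i (n ∸ i) * ((n ∸ i) ! * (suc n) !) ≡ 2 ^ (i ∸ 1) * ((i + 1) * (2 * n ∸ i) !))
    × f E 0 n ≡ catalan n
theorem7p5 n 1≤n E symmetric uniform tri simion THTH-nests HTHT-not =
  (λ { (suc j) _ j<n → count-with-forward j j<n }) , trans (count≡bound zero) (ballot-catalan n)
  where open Counting 1≤n symmetric uniform tri simion THTH-nests HTHT-not
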